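{- Let $\mathbb F$ be a finite field and let $\mathcal M$ be a matrix class over $\mathbb F$. Then $\mathcal M$ has bounded twin-width if and only if there exists a matrix over $\mathbb F$ that is not a linear minor of any matrix in $\mathcal M$.
   Context: A matrix $M$ over a finite alphabet $A$ with (totally ordered) row index set $R$ and column index set $C$ is identified with the ordered binary structure with domain $R\uplus C$, a unary relation interpreted as $R$, a binary relation $<$ that is a total order on $R\uplus C$ extending the orders of rows and of columns with all rows preceding all columns, and for each $a\in A$ a binary relation $E_a$ containing exactly the pairs $(r,c)$ with $r\in R$, $c\in C$, $M[r,c]=a$. Twin-width of a binary structure with domain $U$: a contraction sequence is a sequence of partitions $\mathcal P_{|U|},\dots,\mathcal P_1$ of $U$, where $\mathcal P_{|U|}$ consists of singletons, $\mathcal P_1=\{U\}$, and each $\mathcal P_{i-1}$ is obtained from $\mathcal P_i$ by merging two parts. Two distinct parts $X,Y$ of a partition are red-adjacent if there are $u,u'\in X$, $v,v'\in Y$ such that the atomic type of $(u,v)$ differs from that of $(u',v')$, where the atomic type of $(u,v)$ records which unary relations contain $u$, which contain $v$, which binary relations contain $(u,v)$ and which contain $(v,u)$. A $d$-sequence is a contraction sequence in which every part of every $\mathcal P_i$ is red-adjacent to at most $d$ other parts of $\mathcal P_i$; the twin-width of the structure is the least $d$ for which a $d$-sequence exists. A set of matrices has bounded twin-width if the twin-widths of its members are bounded by a constant. A matrix class is a set of matrices closed under taking submatrices (deleting rows and/or columns). A weighted sum operation on a matrix over $\mathbb F$ replaces two consecutive rows $r_i,r_{i+1}$ by the single row $\alpha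 r_i+\beta r_{i+1}$ (at the position of $r_i$, with $r_{i+1}$ removed), for some $\alpha,\beta\in\mathbb F$, or does the same with two consecutive columns. A matrix $N$ is a linear minor of $M$ if $N$ can be obtained from $M$ by a finite (possibly empty) sequence of weighted sum operations. -}

module Defs where

open import Level using (0ℓ)
open import Data.Nat using (ℕ; zero; suc; _+_; _≤_)
open import Data.Fin as Fin using (Fin; inject₁; punchIn; _↑ˡ_; _↑ʳ_)
open import Data.Fin.Properties using () renaming (_≟_ to _≟ᶠ_)
open import Data.Bool using (if_then_else_)
open import Data.List using (List; length)
open import Data.List.Membership.Propositional using (_∈_)
open import Data.Product using (Σ; ∃; _×_; _,_)
open import Data.Unit using (⊤)
open import Relation.Nullary using (¬_)
open import Relation.Nullary.Decidable using (⌊_⌋)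
open import Relation.Binary.PropositionalEquality using (_≡_; _≢_)
open import Function.Bundles using (_⇔_)
open import Algebra.Structures using (IsCommutativeRing)

record FiniteField : Set₁ where
  field
    Carrier : Set
    _+F_ : Carrier → Carrier → Carrier
    _*F_ : Carrier → Carrier → Carrier
    -F_  : Carrier → Carrier
    0F   : Carrier
    1F   : Carrier
    isCommutativeRing : IsCommutativeRing _≡_ _+F_ _*F_ -F_ 0F 1F
    0≢1  : 0F ≢ 1F
    inverse : ∀ x → x ≢ 0F → ∃ λ y → x *F y ≡ 1F
    size : ℕ
    enum : Fin size → Carrier
    enum-injective : ∀ i j → enum i ≡ enum j → i ≡ j
    enum-surjective : ∀ x → ∃ λ i → enum i ≡ x

Mat : Set → ℕ → ℕ → Set
Mat A m n = Fin m → Fin n → A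

StrictMono : ∀ {k l} → (Fin k → Fin l) → Set
StrictMono {k} f = ∀ (i j : Fin k) → i Fin.< j → f i Fin.< f j

sub : ∀ {A m n m' n'} → Mat A m n → (Fin m' → Fin m) → (Fin n' → Fin n) → Mat A m' n'
sub M σ τ i j = M (σ i) (τ j)

record MatrixClass (A : Set) : Set₁ where
  field
    member : ∀ {m n} → Mat A m n → Set
    closed : ∀ {m n m' n'} (M : Mat A m n) (σ : Fin m' → Fin m) (τ : Fin n' → Fin n) →
             StrictMono σ → StrictMono τ → member M → member (sub M σ τ)

record Structure : Set₁ where
  field
    size   : ℕ
    USym   : Set
    BSym   : Set
    U      : USym → Fin size → Set
    B      : BSym → Fin size → Fin size → Set

module _ (S : Structure) where
  open Structure S

  SameType : Fin size → Fin size → Fin size → Fin size → Set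
  SameType u v u' v' =
    (∀ s → U s u ⇔ U s u') × (∀ s → U s v ⇔ U s v') ×
    (∀ b → B b u v ⇔ B b u' v') × (∀ b → B b v u ⇔ B b v' u')

  -- a partition of the domain into k labelled parts: u ↦ label of its part
  -- parts X ≠ Y of p are red-adjacent
  RedAdj : ∀ {k} → (Fin size → Fin k) → Fin k → Fin k → Set
  RedAdj p X Y = X ≢ Y × Σ (Fin size) λ u → Σ (Fin size) λ u' → Σ (Fin size) λ v → Σ (Fin size) λ v' →
    p u ≡ X × p u' ≡ X × p v ≡ Y × p v' ≡ Y × ¬ SameType u v u' v'

  RedDegreeAtMost : ∀ {k} → ℕ → (Fin size → Fin k) → Set
  RedDegreeAtMost {k} d p = ∀ (X : Fin k) → Σ (List (Fin k)) λ L →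
    length L ≤ d × (∀ Y → RedAdj p X Y → Y ∈ L)

  Surj : ∀ {a b} → (Fin a → Fin b) → Set
  Surj {a} {b} f = ∀ (y : Fin b) → ∃ λ (x : Fin a) → f x ≡ y

  -- A contraction sequence P_size, ..., P_1.  part k is the partition
  -- P_{k+1} (with k+1 nonempty parts) for k + 1 ≤ size; values of part k
  -- for k + 1 > size are irrelevant.
  record ContractionSeq : Set where
    field
      part     : (k : ℕ) → Fin size → Fin (suc k)
      nonempty : ∀ k → suc k ≤ size → Surj (part k)
      finest   : ∀ k → suc k ≡ size → ∀ u v → part k u ≡ part k v → u ≡ v
      merge    : ∀ k → suc (suc k) ≤ size →
                 Σ (Fin (suc (suc k)) → Fin (suc k)) λ f →
                   Surj f × (∀ u → part k u ≡ f (part (suc k) u))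

  IsDSequence : ℕ → ContractionSeq → Set
  IsDSequence d c = ∀ k → suc k ≤ size → RedDegreeAtMost d (ContractionSeq.part c k)

  TwinWidthAtMost : ℕ → Set
  TwinWidthAtMost d = Σ ContractionSeq (IsDSequence d)

-- A matrix as an ordered binary structure on R ⊎ C ≅ Fin (m + n):
-- rows r ↦ r ↑ˡ n, columns c ↦ m ↑ʳ c, so the order of Fin (m + n)
-- extends the row and column orders with all rows preceding all columns.

data MatBSym (A : Set) : Set where
  lt : MatBSym A
  E  : A → MatBSym A

matStructure : ∀ {A m n} → Mat A m n → Structure
matStructure {A} {m} {n} M = record
  { size = m + n
  ; USym = ⊤
  ; BSym = MatBSym A
  ; U    = λ _ u → ∃ λ (r : Fin m) → u ≡ r ↑ˡ n
  ; B    = rel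
  }
  where
  rel : MatBSym A → Fin (m + n) → Fin (m + n) → Set
  rel lt    u v = u Fin.< v
  rel (E a) u v = Σ (Fin m) λ r → Σ (Fin n) λ c → u ≡ r ↑ˡ n × v ≡ m ↑ʳ c × M r c ≡ a

BoundedTwinWidth : ∀ {A} → MatrixClass A → Set
BoundedTwinWidth 𝓜 = ∃ λ (d : ℕ) → ∀ {m n} (M : Mat _ m n) →
  MatrixClass.member 𝓜 M → TwinWidthAtMost (matStructure M) d

module _ (F : FiniteField) where
  open FiniteField F

  rowSum : ∀ {m n} → Carrier → Carrier → Fin m → Mat Carrier (suc m) n → Mat Carrier m n
  rowSum α β i M j c =
    if ⌊ j ≟ᶠ i ⌋ then (α *F M (inject₁ i) c) +F (β *F M (Fin.suc i) c)
                  else M (punchIn (Fin.suc i) j) c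

  colSum : ∀ {m n} → Carrier → Carrier → Fin n → Mat Carrier m (suc n) → Mat Carrier m n
  colSum α β i M r j =
    if ⌊ j ≟ᶠ i ⌋ then (α *F M r (inject₁ i)) +F (β *F M r (Fin.suc i))
                  else M r (punchIn (Fin.suc i) j)

  data LinearMinor : ∀ {m' n' m n} → Mat Carrier m' n' → Mat Carrier m n → Set where
    done   : ∀ {m n} {N M : Mat Carrier m n} → (∀ r c → N r c ≡ M r c) → LinearMinor N M
    rowOp  : ∀ {m' n' m n} {N : Mat Carrier m' n'} {M : Mat Carrier (suc m) n}
             (α β : Carrier) (i : Fin m) → LinearMinor N (rowSum α β i M) → LinearMinor N M
    colOp  : ∀ {m' n' m n} {N : Mat Carrier m' n'} {M : Mat Carrier m (suc n)}
             (α β : Carrier) (i : Fin n) → LinearMinor N (colSum α β i M) → LinearMinor N M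

-- If the twin-width is at most d, look at the first moment of a contraction sequence where a part spans
-- three consecutive blocks of a fixed division of the rows and columns. Because of the order, only d + 1
-- parts meet the middle block, and they are homogeneous to some block on the other side; so a linear minor
-- which is a large grid of large identity matrices would have an identity block of too small rank.
--
-- Conversely, merge consecutive parts of a division greedily as long as every part has few distinct rows
-- (columns) outside a bounded number of parts. If this ends in the trivial division, identifying rows of a
-- part which agree outside the few complex blocks yields partitions of bounded red degree. If it gets stuck,
-- every pair of consecutive row parts (say) contains many disjoint intervals of column parts with many
-- distinct rows, and a variant of the Marcus–Tardos theorem finds a k × k division all of whose cells have
-- many distinct rows. Then row combinations v₁, v₂, … of the row blocks can be chosen one after another so
-- that they are linearly independent on each column block, and column combinations are obtained by solving
-- linear equations; hence every small matrix is a linear minor.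

module Submission where

open import Defs
open import Data.Nat using (ℕ; zero; suc; _+_; _*_; _∸_; _^_; _≤_; _<_; z≤n; s≤s; _≤?_; _<?_; _⊔_; pred; _≡ᵇ_; _<ᵇ_; >-nonZero; ⌊_/2⌋; s≤s⁻¹; _≟_)
open import Data.Nat.Properties hiding (_≟_; _≤?_; _<?_; ≤-isTotalOrder; ≤-isDecTotalOrder)
open import Data.Nat.Solver using (module +-*-Solver)
open import Algebra.Bundles using (CommutativeRing)
import Algebra.Properties.Ring
import Algebra.Properties.Semiring.Sum
open import Data.Bool using (Bool; true; false; if_then_else_; _∧_; _∨_; T)
open import Data.Empty using (⊥)
import Data.Fin as Fin
open import Data.Fin using (Fin; toℕ; fromℕ<; inject₁; punchIn; punchOut; pinch; _↑ˡ_; _↑ʳ_; splitAt; combine; remQuot; funToFin; finToFun)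
open import Data.Fin.Properties using (any?; all?; pigeonhole; toℕ-injective; toℕ<n; punchInᵢ≢i; punchIn-injective; punchIn-mono-≤; punchIn-punchOut; punchOut-punchIn; punchOut-injective; injective⇒≤; toℕ-inject₁; toℕ-inject≤; inject≤-injective; pinch-mono-≤; combine-injective; combine-monoˡ-<; finToFun-funToFin; funToFin-finToFin; toℕ-fromℕ<; remQuot-combine; combine-remQuot; splitAt-↑ˡ; splitAt-↑ʳ; splitAt⁻¹-↑ˡ; splitAt⁻¹-↑ʳ; ↑ˡ-injective; ↑ʳ-injective; toℕ-↑ˡ; toℕ-↑ʳ) renaming (_≟_ to _≟ᶠ_)
open import Data.List using (List; []; _∷_; length; _++_; map; concatMap; tabulate; lookup)
open import Data.List.Membership.DecPropositional _≟_ using (_∈?_)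
open import Data.List.Membership.Propositional using (_∈_; _∉_)
open import Data.List.Membership.Propositional.Properties using (∈-++⁺ˡ; ∈-++⁺ʳ; ∈-map⁺; ∈-concatMap⁺; ∈-tabulate⁺)
open import Data.List.Properties using (length-++; length-map; length-tabulate)
import Data.List.Relation.Unary.Any as Any
open import Data.List.Relation.Unary.Any using (Any; here; there)
open import Data.List.Relation.Unary.Any.Properties using (lookup-index)
open import Data.Product using (Σ; ∃; ∃₂; _×_; _,_; proj₁; proj₂; map₁; map₂)
open import Data.Sum using (_⊎_; inj₁; inj₂; [_,_]′; swap)
open import Data.Unit using (⊤; tt)
open import Data.Vec.Functional using () renaming (_∷_ to _◂_)
open import Function using (_∘_; id; case_of_; flip)
open import Function.Bundles using (_⇔_; mk⇔; module Equivalence)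
open import Relation.Binary.Definitions using (tri<; tri≈; tri>)
open import Relation.Binary.PropositionalEquality using (_≡_; _≢_; refl; sym; trans; cong; cong₂; subst; subst₂; module ≡-Reasoning; _≗_)
open import Relation.Nullary using (¬_; Dec; yes; no; contradiction)
open import Relation.Nullary.Decidable using (⌊_⌋; _×-dec_; _⊎-dec_; ¬?; map′; decidable-stable)

-- A stuck division is encoded as a 0/1 matrix with one row for each pair of consecutive row parts,
-- whose points are cut positions between column parts. A single point says nothing; two points in
-- the same row bound an interval with many distinct rows. So Marcus-Tardos is needed for grids
-- whose cells each contain two points of one row, and contracting rows becomes delicate, since such
-- a pair must not be assembled from different rows. The bound is linear in the side of a square, so
-- merging is always tried on the side with more parts.
--
-- In the other outcome the identifications of rows must become coarser along the sequence of
-- divisions. The few exceptional parts of a merged part need not include those of the two parts it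
-- came from, so they cannot define the identification. The blocks to be ignored are therefore
-- singled out by an intrinsic property that persists under merging: having many distinct rows or
-- many distinct columns.

-- Counting points and the pigeonhole principle

∑ : ℕ → (ℕ → ℕ) → ℕ
∑ zero    f = 0
∑ (suc n) f = ∑ n f + f n

bit : Bool → ℕ
bit true  = 1
bit false = 0

count : ℕ → (ℕ → Bool) → ℕ
count n Q = ∑ n (bit ∘ Q)

∑-mono : ∀ n {f g} → (∀ i → i < n → f i ≤ g i) → ∑ n f ≤ ∑ n g
∑-mono zero    h = z≤n
∑-mono (suc n) h = +-mono-≤ (∑-mono n (λ i i<n → h i (m<n⇒m<1+n i<n))) (h n ≤-refl)

∑-cong : ∀ n {f g} → (∀ i → f i ≡ g i) → ∑ n f ≡ ∑ n g
∑-cong zero    h = refl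
∑-cong (suc n) h = cong₂ _+_ (∑-cong n h) (h n)

∑-+ : ∀ n f g → ∑ n (λ i → f i + g i) ≡ ∑ n f + ∑ n g
∑-+ zero    f g = refl
∑-+ (suc n) f g rewrite ∑-+ n f g = solve 4 (λ a b c d → (a :+ b) :+ (c :+ d) := (a :+ c) :+ (b :+ d)) refl (∑ n f) (∑ n g) (f n) (g n)
  where open +-*-Solver

∑-* : ∀ n k f → ∑ n (λ i → k * f i) ≡ k * ∑ n f
∑-* zero    k f = sym (*-zeroʳ k)
∑-* (suc n) k f rewrite ∑-* n k f = sym (*-distribˡ-+ k (∑ n f) (f n))

∑-const : ∀ n k → ∑ n (λ _ → k) ≡ n * k
∑-const zero    k = refl
∑-const (suc n) k rewrite ∑-const n k = +-comm (n * k) k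

∑-comm : ∀ m n (f : ℕ → ℕ → ℕ) → ∑ m (λ i → ∑ n (f i)) ≡ ∑ n (λ j → ∑ m (λ i → f i j))
∑-comm zero    n f = sym (trans (∑-const n 0) (*-zeroʳ n))
∑-comm (suc m) n f rewrite ∑-comm m n f = sym (∑-+ n (λ j → ∑ m (λ i → f i j)) (f m))

∑-+-split : ∀ m n f → ∑ (m + n) f ≡ ∑ m f + ∑ n (λ i → f (m + i))
∑-+-split m zero    f rewrite +-identityʳ m = sym (+-identityʳ _)
∑-+-split m (suc n) f rewrite +-suc m n | ∑-+-split m n f = +-assoc (∑ m f) _ _

∑-blocks : ∀ n s f → ∑ (n * s) f ≡ ∑ n (λ J → ∑ s (λ b → f (J * s + b)))
∑-blocks zero    s f = refl
∑-blocks (suc n) s f rewrite +-comm s (n * s) | ∑-+-split (n * s) s f | ∑-blocks n s f = refl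

-- `X` will be the existence of a double grid: an estimate may fail at some index by producing one,
-- which is then passed on.
∑-or : ∀ {X : Set} n {f g} → (∀ i → i < n → X ⊎ f i ≤ g i) → X ⊎ ∑ n f ≤ ∑ n g
∑-or zero    h = inj₂ z≤n
∑-or (suc n) h with ∑-or n (λ i i<n → h i (m<n⇒m<1+n i<n)) | h n ≤-refl
... | inj₁ x | _      = inj₁ x
... | inj₂ _ | inj₁ x = inj₁ x
... | inj₂ p | inj₂ q = inj₂ (+-mono-≤ p q)

bit≤1 : ∀ b → bit b ≤ 1
bit≤1 true  = ≤-refl
bit≤1 false = z≤n

count≤ : ∀ n Q → count n Q ≤ n
count≤ n Q = ≤-trans (∑-mono n (λ i _ → bit≤1 (Q i))) (≤-reflexive (trans (∑-const n 1) (*-identityʳ n)))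

select : ∀ n Q k → k ≤ count n Q → Σ (ℕ → ℕ) λ e →
  (∀ i → i < k → Q (e i) ≡ true × e i < n) × (∀ i → suc i < k → e i < e (suc i))
select n       Q zero    le = (λ _ → 0) , (λ _ ()) , (λ _ ())
select (suc n) Q (suc k) le with Q n in eq
... | false with e , p , m ← select n Q (suc k) (subst (suc k ≤_) (+-identityʳ _) le)
  = e , (λ i i<k → proj₁ (p i i<k) , m<n⇒m<1+n (proj₂ (p i i<k))) , m
... | true with e , p , m ← select n Q k (s≤s⁻¹ (subst (suc k ≤_) (+-comm (count n Q) 1) le))
  = e′ , p′ , m′
  where
  e′ : ℕ → ℕ
  e′ i with i <? k
  ... | yes _ = e i
  ... | no  _ = n
  p′ : ∀ i → i < suc k → Q (e′ i) ≡ true × e′ i < suc n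
  p′ i _ with i <? k
  ... | yes i<k = proj₁ (p i i<k) , m<n⇒m<1+n (proj₂ (p i i<k))
  ... | no  _   = eq , ≤-refl
  m′ : ∀ i → suc i < suc k → e′ i < e′ (suc i)
  m′ i (s≤s i<k) with i <? k | suc i <? k
  ... | yes _ | yes si<k = m i si<k
  ... | yes q | no _     = proj₂ (p i q)
  ... | no ¬q | _        = contradiction i<k ¬q

≡ᵇ-refl : ∀ n → (n ≡ᵇ n) ≡ true
≡ᵇ-refl zero    = refl
≡ᵇ-refl (suc n) = ≡ᵇ-refl n

≡ᵇ-true : ∀ m n → (m ≡ᵇ n) ≡ true → m ≡ n
≡ᵇ-true m n eq = ≡ᵇ⇒≡ m n (subst T (sym eq) tt)

∧-true : ∀ {a b} → a ∧ b ≡ true → a ≡ true × b ≡ true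
∧-true {true} eq = refl , eq

∑-hit : ∀ c (f : ℕ → ℕ) i → i < c → f i ≤ ∑ c f
∑-hit (suc c) f i i<c with i ≟ c
... | yes refl = m≤n+m (f i) (∑ c f)
... | no  i≢c  = ≤-trans (∑-hit c f i (≤∧≢⇒< (s≤s⁻¹ i<c) i≢c)) (m≤m+n _ (f c))

∑-large : ∀ c K f → (∃ λ i → i < c × K < f i) ⊎ ∑ c f ≤ c * K
∑-large zero    K f = inj₂ z≤n
∑-large (suc c) K f with ∑-large c K f | K <? f c
... | inj₁ (i , i<c , p) | _     = inj₁ (i , m<n⇒m<1+n i<c , p)
... | inj₂ _ | yes p = inj₁ (c , ≤-refl , p)
... | inj₂ q | no ¬p = inj₂ (≤-trans (+-mono-≤ q (≮⇒≥ ¬p)) (≤-reflexive (+-comm (c * K) K)))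

colour-pigeonhole : ∀ n c K Q (col : ℕ → ℕ) → (∀ x → col x < c) → c * K < count n Q →
  ∃ λ i → K < count n (λ x → Q x ∧ (col x ≡ᵇ i))
colour-pigeonhole n c K Q col col< big
  with ∑-large c K (λ i → count n (λ x → Q x ∧ (col x ≡ᵇ i)))
... | inj₁ (i , _ , p) = i , p
... | inj₂ le = contradiction (≤-trans big (≤-trans bound le)) (<-irrefl refl)
  where
  term : ∀ x → bit (Q x) ≤ ∑ c (λ i → bit (Q x ∧ (col x ≡ᵇ i)))
  term x with Q x in eq
  ... | false = z≤n
  ... | true  = ≤-trans (≤-reflexive (sym (cong bit (≡ᵇ-refl (col x)))))
                        (∑-hit c (λ i → bit (col x ≡ᵇ i)) (col x) (col< x))
  bound : count n Q ≤ ∑ c (λ i → count n (λ x → Q x ∧ (col x ≡ᵇ i)))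
  bound = ≤-trans (∑-mono n (λ x _ → term x)) (≤-reflexive (∑-comm n c _))

-- A subset of `s` positions read as a binary number. These are the `2 ^ s` colours with which the
-- pigeonhole principle finds equal patterns.
code : ℕ → (ℕ → Bool) → ℕ
code zero    f = 0
code (suc s) f = bit (f s) + 2 * code s f

code< : ∀ s f → code s f < 2 ^ s
code< zero    f = ≤-refl
code< (suc s) f = begin-strict
  bit (f s) + 2 * code s f <⟨ +-monoˡ-< (2 * code s f) (s≤s (bit≤1 (f s))) ⟩
  2 + 2 * code s f         ≡⟨ sym (*-suc 2 (code s f)) ⟩
  2 * suc (code s f)       ≤⟨ *-monoʳ-≤ 2 (code< s f) ⟩
  2 * 2 ^ s                ∎
  where open ≤-Reasoning

bit-parity : ∀ a b m n → bit a + 2 * m ≡ bit b + 2 * n → a ≡ b × m ≡ n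
bit-parity true  true  m n eq = refl , *-cancelˡ-≡ m n 2 (suc-injective eq)
bit-parity false false m n eq = refl , *-cancelˡ-≡ m n 2 eq
bit-parity true  false m n eq = contradiction (sym eq) (even≢odd n m)
bit-parity false true  m n eq = contradiction eq (even≢odd m n)

code-injective : ∀ s f g → code s f ≡ code s g → ∀ i → i < s → f i ≡ g i
code-injective (suc s) f g eq i i<s with i ≟ s
... | yes refl = proj₁ (bit-parity (f i) (g i) (code s f) (code s g) eq)
... | no i≢s = code-injective s f g (proj₂ (bit-parity (f s) (g s) (code s f) (code s g) eq)) i (≤∧≢⇒< (s≤s⁻¹ i<s) i≢s)

-- Double grids in dense 0/1 matrices

-- Both points of a cell lie in the same row `a`, because later only an interval between two points
-- of one row carries information.
record DoubleGrid (k : ℕ) (B : ℕ → ℕ → Bool) : Set where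
  constructor doubleGrid
  field
    rowCut colCut : ℕ → ℕ
    cell : ∀ i j → i < k → j < k → ∃ λ a → ∃ λ x → ∃ λ y →
      rowCut i ≤ a × a < rowCut (suc i) × colCut j ≤ x × x < y × y < colCut (suc j) ×
      B a x ≡ true × B a y ≡ true

block-<-suc : ∀ J s x → x < s → J * s + x < suc J * s
block-<-suc J s x x<s = subst (J * s + x <_) (+-comm (J * s) s) (+-monoʳ-< (J * s) x<s)

*2-mono : ∀ {j k} → j < k → suc (suc (2 * j)) < suc (2 * k)
*2-mono {j} {k} j<k = s≤s (subst (_≤ 2 * k) (*-suc 2 j) (*-monoʳ-≤ 2 j<k))

*2-mono₁ : ∀ {j k} → j < k → suc (2 * j) < suc (2 * k)
*2-mono₁ j<k = <-trans ≤-refl (*2-mono j<k)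

*2-mono₀ : ∀ {j k} → j < k → 2 * j < suc (2 * k)
*2-mono₀ j<k = <-trans ≤-refl (*2-mono₁ j<k)

module ColumnContraction (k s : ℕ) (B : ℕ → ℕ → Bool) where
  window : ℕ → ℕ → ℕ → Bool
  window J a x = B a (J * s + x)

  B′ : ℕ → ℕ → Bool
  B′ a J = 0 <ᵇ count s (window J a)

  wide : ℕ → ℕ → Bool
  wide J a = 2 * k <ᵇ count s (window J a)

  window-bound : ∀ J a → count s (window J a) ≤ 2 * k * bit (B′ a J) + s * bit (wide J a)
  window-bound J a with 2 * k <ᵇ count s (window J a) in eq
  ... | true  = ≤-trans (count≤ s (window J a)) (≤-trans (≤-reflexive (sym (*-identityʳ s))) (m≤n+m (s * 1) _))
  ... | false with count s (window J a)
  ...   | zero  = z≤n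
  ...   | suc c = ≤-trans (≮⇒≥ (λ p → subst T eq (<⇒<ᵇ p)))
                    (≤-trans (≤-reflexive (sym (*-identityʳ (2 * k)))) (m≤m+n _ _))

  -- Some `k + 1` wide rows have the same points in the window, at least `2 * k + 1` of them. Cell
  -- `(i, j)` uses row `i` and the points `2 * j` and `2 * j + 1`; the last row and the last point
  -- only close the last cells.
  wide-grid : ∀ r J → 2 ^ s * k < count r (wide J) → DoubleGrid k B
  wide-grid r J big
    with i , big′ ← colour-pigeonhole r (2 ^ s) k (wide J) (λ a → code s (window J a)) (λ a → code< s _) big
    with e , eP , e< ← select r _ (suc k) big′
    with b , bP , b< ← select s (window J (e 0)) (suc (2 * k))
           (<ᵇ⇒< (2 * k) _ (subst T (sym (proj₁ (∧-true {wide J (e 0)} (proj₁ (eP 0 (s≤s z≤n)))))) tt))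
    = doubleGrid e (λ j → J * s + b (2 * j)) cell
    where
    codeOf : ∀ u → u < suc k → code s (window J (e u)) ≡ i
    codeOf u u< = ≡ᵇ-true _ _ (proj₂ (∧-true {wide J (e u)} (proj₁ (eP u u<))))
    point : ∀ u x → u < suc k → x < suc (2 * k) → B (e u) (J * s + b x) ≡ true
    point u x u< x< = trans (code-injective s _ _ (trans (codeOf u u<) (sym (codeOf 0 (s≤s z≤n)))) (b x) (proj₂ (bP x x<)))
                            (proj₁ (bP x x<))
    cell : ∀ i j → i < k → j < k → _
    cell i j i<k j<k = e i , J * s + b (2 * j) , J * s + b (suc (2 * j)) ,
      ≤-refl , e< i (s≤s i<k) , ≤-refl ,
      +-monoʳ-< (J * s) (b< (2 * j) (*2-mono₁ j<k)) ,
      subst (λ z → J * s + b (suc (2 * j)) < J * s + b z) (sym (*-suc 2 j))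
        (+-monoʳ-< (J * s) (b< (suc (2 * j)) (*2-mono j<k))) ,
      point i _ (m<n⇒m<1+n i<k) (*2-mono₀ j<k) ,
      point i _ (m<n⇒m<1+n i<k) (*2-mono₁ j<k)

  -- The two points of a cell of `B′` stand for different windows of one row, so any point of `B` in
  -- each of them gives a pair in the right order.
  grid-lift : DoubleGrid k B′ → DoubleGrid k B
  grid-lift (doubleGrid p q cell) = doubleGrid p (λ j → q j * s) lifted
    where
    hit : ∀ a J → B′ a J ≡ true → ∃ λ x → x < s × B a (J * s + x) ≡ true
    hit a J eq with e , eP , _ ← select s (window J a) 1 (<ᵇ⇒< 0 _ (subst T (sym eq) tt)) =
      e 0 , proj₂ (eP 0 (s≤s z≤n)) , proj₁ (eP 0 (s≤s z≤n))
    lifted : ∀ i j → i < k → j < k → _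
    lifted i j i<k j<k with a , x , y , pa , ap , qx , xy , yq , Bx , By ← cell i j i<k j<k
      with x′ , x′<s , Bx′ ← hit a x Bx | y′ , y′<s , By′ ← hit a y By
      = a , x * s + x′ , y * s + y′ , pa , ap ,
        ≤-trans (*-monoˡ-≤ s qx) (m≤m+n (x * s) x′) ,
        <-≤-trans (block-<-suc x s x′ x′<s) (≤-trans (*-monoˡ-≤ s xy) (m≤m+n (y * s) y′)) ,
        <-≤-trans (block-<-suc y s y′ y′<s) (*-monoˡ-≤ s yq) , Bx′ , By′

  contract : ∀ r n → DoubleGrid k B ⊎
    ∑ r (λ a → count (n * s) (B a)) ≤ 2 * k * ∑ r (λ a → count n (B′ a)) + s * (n * (2 ^ s * k))
  contract r n with ∑-or n {λ J → count r (wide J)} {λ _ → 2 ^ s * k} perBlock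
    where
    perBlock : ∀ J → J < n → DoubleGrid k B ⊎ count r (wide J) ≤ 2 ^ s * k
    perBlock J _ with 2 ^ s * k <? count r (wide J)
    ... | yes p = inj₁ (wide-grid r J p)
    ... | no ¬p = inj₂ (≮⇒≥ ¬p)
  ... | inj₁ g = inj₁ g
  ... | inj₂ wideBound = inj₂ (begin
    ∑ r (λ a → count (n * s) (B a))
      ≡⟨ ∑-cong r (λ a → ∑-blocks n s (bit ∘ B a)) ⟩
    ∑ r (λ a → ∑ n (λ J → count s (window J a)))
      ≤⟨ ∑-mono r (λ a _ → ∑-mono n (λ J _ → window-bound J a)) ⟩
    ∑ r (λ a → ∑ n (λ J → 2 * k * bit (B′ a J) + s * bit (wide J a)))
      ≡⟨ ∑-cong r (λ a → ∑-+ n _ _) ⟩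
    ∑ r (λ a → ∑ n (λ J → 2 * k * bit (B′ a J)) + ∑ n (λ J → s * bit (wide J a)))
      ≡⟨ ∑-+ r _ _ ⟩
    ∑ r (λ a → ∑ n (λ J → 2 * k * bit (B′ a J))) + ∑ r (λ a → ∑ n (λ J → s * bit (wide J a)))
      ≡⟨ cong₂ _+_ (trans (∑-cong r (λ a → ∑-* n (2 * k) _)) (∑-* r (2 * k) _))
                   (trans (∑-cong r (λ a → ∑-* n s _)) (∑-* r s _)) ⟩
    2 * k * ∑ r (λ a → count n (B′ a)) + s * ∑ r (λ a → ∑ n (λ J → bit (wide J a)))
      ≡⟨ cong (λ z → 2 * k * ∑ r (λ a → count n (B′ a)) + s * z) (∑-comm r n _) ⟩
    2 * k * ∑ r (λ a → count n (B′ a)) + s * ∑ n (λ J → count r (wide J))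
      ≤⟨ +-monoʳ-≤ (2 * k * ∑ r (λ a → count n (B′ a))) (*-monoʳ-≤ s (≤-trans wideBound (≤-reflexive (∑-const n _)))) ⟩
    2 * k * ∑ r (λ a → count n (B′ a)) + s * (n * (2 ^ s * k)) ∎)
    where open ≤-Reasoning

-- Scanning the columns from left to right, a column is marked as soon as some row of the
-- family has two points after the previously marked column; a chunk is the set of columns
-- from one mark (exclusive) to the next (inclusive).
module Chunks (k s : ℕ) (R : ℕ → ℕ → Bool) where
  mutual
    seen : ℕ → ℕ → Bool
    seen zero    a = false
    seen (suc b) a = if mark b then false else pattern′ b a

    mark : ℕ → Bool
    mark b = 0 <ᵇ count s (λ a → seen b a ∧ R a b)

    pattern′ : ℕ → ℕ → Bool
    pattern′ b a = seen b a ∨ R a b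

  start : ℕ → ℕ
  start zero    = 0
  start (suc b) = if mark b then suc b else start b

  tall : ℕ → Bool
  tall b = mark b ∧ (k <ᵇ count s (pattern′ b))

  start≤ : ∀ b → start b ≤ b
  start≤ zero    = z≤n
  start≤ (suc b) with mark b
  ... | true  = ≤-refl
  ... | false = m≤n⇒m≤1+n (start≤ b)

  seen-point : ∀ b a → seen b a ≡ true → ∃ λ x → start b ≤ x × x < b × R a x ≡ true
  seen-point (suc b) a eq with mark b
  ... | false with seen b a in eq′
  ...   | true with x , sx , xb , Rx ← seen-point b a eq′ = x , sx , m<n⇒m<1+n xb , Rx
  ...   | false = b , start≤ b , ≤-refl , eq

  start-after : ∀ b b′ → b < b′ → mark b ≡ true → suc b ≤ start b′
  start-after b (suc b′) b<b′ mb with mark b′ in eq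
  ... | true = b<b′
  ... | false with b ≟ b′
  ...   | no b≢b′ = start-after b b′ (≤∧≢⇒< (s≤s⁻¹ b<b′) b≢b′) mb
  ...   | yes refl with trans (sym eq) mb
  ...     | ()

  pattern-point : ∀ b a → pattern′ b a ≡ true → ∃ λ x → start b ≤ x × x ≤ b × R a x ≡ true
  pattern-point b a eq with seen b a in eq′
  ... | true with x , sx , xb , Rx ← seen-point b a eq′ = x , sx , <⇒≤ xb , Rx
  ... | false = b , start≤ b , ≤-refl , eq

  mark-pair : ∀ b → mark b ≡ true → ∃ λ a → a < s × ∃ λ x → start b ≤ x × x < b × R a x ≡ true × R a b ≡ true
  mark-pair b eq with e , eP , _ ← select s _ 1 (<ᵇ⇒< 0 _ (subst T (sym eq) tt))
    with both , e<s ← eP 0 (s≤s z≤n)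
    with s1 , R1 ← ∧-true {seen b (e 0)} both
    with x , sx , xb , Rx ← seen-point b (e 0) s1 = e 0 , e<s , x , sx , xb , Rx , R1

  -- An amortised count in which `seen` holds the points not yet paid for. Before a mark no row has
  -- two points in the chunk, so counting rows counts points. A mark pays for its whole chunk: a row
  -- of the pattern has at most one point before the marked column and one in it, hence there are at
  -- most `2 * k` points unless the chunk is tall.
  step-bound : ∀ b → count s (seen b) + count s (λ a → R a b) ≤
                     2 * k * bit (mark b) + 2 * s * bit (tall b) + count s (seen (suc b))
  step-bound b with mark b in eqm
  ... | false = ≤-trans (≤-reflexive (sym (∑-+ s _ _))) (≤-trans (∑-mono s disjoint) (m≤n+m _ _))
    where
    disjoint : ∀ a → a < s → bit (seen b a) + bit (R a b) ≤ bit (pattern′ b a)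
    disjoint a a<s with seen b a in eq₁ | R a b in eq₂
    ... | false | _     = ≤-refl
    ... | true  | false = ≤-refl
    ... | true  | true  = contradiction (subst T eqm (<⇒<ᵇ (≤-trans
            (≤-reflexive (sym (cong bit (trans (cong₂ _∧_ eq₁ eq₂) refl))))
            (∑-hit s (λ a → bit (seen b a ∧ R a b)) a a<s)))) (λ ())
  ... | true = ≤-trans (+-mono-≤ (∑-mono s seen≤) (∑-mono s R≤)) (≤-trans main (m≤m+n _ _))
    where
    seen≤ : ∀ a → a < s → bit (seen b a) ≤ bit (pattern′ b a)
    seen≤ a _ with seen b a
    ... | true  = ≤-refl
    ... | false = z≤n
    R≤ : ∀ a → a < s → bit (R a b) ≤ bit (pattern′ b a)
    R≤ a _ with seen b a
    ... | true  = bit≤1 (R a b)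
    ... | false = ≤-refl
    P = count s (pattern′ b)
    double : ∀ x → x + x ≡ 2 * x
    double x = cong (x +_) (sym (+-identityʳ x))
    main : P + P ≤ 2 * k * 1 + 2 * s * bit (k <ᵇ P)
    main with k <ᵇ P in eq
    ... | true  = ≤-trans (≤-reflexive (double P)) (≤-trans (*-monoʳ-≤ 2 (count≤ s _))
                    (≤-trans (≤-reflexive (sym (*-identityʳ (2 * s)))) (m≤n+m _ _)))
    ... | false = ≤-trans (≤-reflexive (double P)) (≤-trans (*-monoʳ-≤ 2 P≤k)
                    (≤-trans (≤-reflexive (sym (*-identityʳ (2 * k)))) (m≤m+n _ _)))
      where
      P≤k : P ≤ k
      P≤k = ≮⇒≥ (λ p → subst T eq (<⇒<ᵇ p))

  scan-bound : ∀ c → ∑ c (λ b → count s (λ a → R a b)) ≤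
                     2 * k * count c mark + 2 * s * count c tall + count s (seen c)
  scan-bound zero    = z≤n
  scan-bound (suc c) = begin
    X + Rc ≤⟨ +-monoˡ-≤ Rc (scan-bound c) ⟩
    2 * k * M + 2 * s * L + S + Rc ≡⟨ +-assoc (2 * k * M + 2 * s * L) S Rc ⟩
    2 * k * M + 2 * s * L + (S + Rc) ≤⟨ +-monoʳ-≤ (2 * k * M + 2 * s * L) (step-bound c) ⟩
    2 * k * M + 2 * s * L + (2 * k * m + 2 * s * l + S′)
      ≡⟨ solve 7 (λ K M Z L m l S → K :* M :+ Z :* L :+ (K :* m :+ Z :* l :+ S) := K :* (M :+ m) :+ Z :* (L :+ l) :+ S)
           refl (2 * k) M (2 * s) L m l S′ ⟩
    2 * k * (M + m) + 2 * s * (L + l) + S′ ∎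
    where
    open ≤-Reasoning
    open +-*-Solver
    X = ∑ c (λ b → count s (λ a → R a b))
    Rc = count s (λ a → R a c)
    M = count c mark
    L = count c tall
    S = count s (seen c)
    S′ = count s (seen (suc c))
    m = bit (mark c)
    l = bit (tall c)

module RowContraction (k s : ℕ) (B : ℕ → ℕ → Bool) where
  open module Ch (A : ℕ) = Chunks k s (λ a → B (A * s + a))

  -- A point wherever some row of the group has one would not do, since two such points may come
  -- from different rows. A mark certifies two points of one row in the chunk that ends there, so
  -- for marks `x < y` the chunk of `y` already contains a pair lying after `x`.
  B′ : ℕ → ℕ → Bool
  B′ = mark

  -- There are `2 * k + 1` tall marks whose chunks are met by the same rows, more than `k` of them.
  -- Cell `(i, j)` takes one point of row `i` from each of the chunks ending at the marks
  -- `2 * j + 1` and `2 * j + 2`; both chunks begin after mark `2 * j`, where the column cut is.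
  tall-grid : ∀ c A → 2 ^ s * (2 * k) < count c (tall A) → DoubleGrid k B
  tall-grid c A big
    with i , big′ ← colour-pigeonhole c (2 ^ s) (2 * k) (tall A) (λ b → code s (pattern′ A b)) (λ b → code< s _) big
    with b , bP , b< ← select c _ (suc (2 * k)) big′
    with e , eP , e< ← select s (pattern′ A (b 0)) (suc k)
           (<ᵇ⇒< k _ (subst T (sym (proj₂ (∧-true {mark A (b 0)} (proj₁ (∧-true {tall A (b 0)} (proj₁ (bP 0 (s≤s z≤n)))))))) tt))
    = doubleGrid (λ i → A * s + e i) (λ j → suc (b (2 * j))) cell
    where
    codeOf : ∀ u → u < suc (2 * k) → code s (pattern′ A (b u)) ≡ i
    codeOf u u< = ≡ᵇ-true _ _ (proj₂ (∧-true {tall A (b u)} (proj₁ (bP u u<))))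
    marked : ∀ u → u < suc (2 * k) → mark A (b u) ≡ true
    marked u u< = proj₁ (∧-true {mark A (b u)} (proj₁ (∧-true {tall A (b u)} (proj₁ (bP u u<)))))
    inPattern : ∀ u x → u < suc (2 * k) → x < suc k → pattern′ A (b u) (e x) ≡ true
    inPattern u x u< x< = trans (code-injective s _ _ (trans (codeOf u u<) (sym (codeOf 0 (s≤s z≤n)))) (e x) (proj₂ (eP x x<)))
                            (proj₁ (eP x x<))
    point : ∀ u x → suc u < suc (2 * k) → x < suc k →
      ∃ λ y → suc (b u) ≤ y × y ≤ b (suc u) × B (A * s + e x) y ≡ true
    point u x u< x< with y , sy , yb , By ← pattern-point A (b (suc u)) (e x) (inPattern (suc u) x u< x<)
      = y , ≤-trans (start-after A (b u) (b (suc u)) (b< u u<) (marked u (<-trans ≤-refl u<))) sy , yb , By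
    cell : ∀ i j → i < k → j < k → _
    cell i j i<k j<k
      with x , bx , xb , Bx ← point (2 * j) i (*2-mono₁ j<k) (m<n⇒m<1+n i<k)
         | y , by , yb , By ← point (suc (2 * j)) i (*2-mono j<k) (m<n⇒m<1+n i<k)
      = A * s + e i , x , y , ≤-refl , +-monoʳ-< (A * s) (e< i (s≤s i<k)) , bx , ≤-trans (s≤s xb) by ,
        s≤s (subst (λ z → y ≤ b z) (sym (*-suc 2 j)) yb) , Bx , By

  grid-lift : DoubleGrid k B′ → DoubleGrid k B
  grid-lift (doubleGrid p q cell) = doubleGrid (λ i → p i * s) q lifted
    where
    lifted : ∀ i j → i < k → j < k → _
    lifted i j i<k j<k with A , x , y , pA , Ap , qx , xy , yq , Mx , My ← cell i j i<k j<k
      with a , a<s , z , sz , zy , Bz , By ← mark-pair A y My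
      = A * s + a , z , y , ≤-trans (*-monoˡ-≤ s pA) (m≤m+n (A * s) a) ,
        <-≤-trans (block-<-suc A s a a<s) (*-monoˡ-≤ s Ap) ,
        ≤-trans qx (≤-trans (n≤1+n x) (≤-trans (start-after A x y xy Mx) sz)) , zy , yq , Bz , By

  contract : ∀ n c → DoubleGrid k B ⊎
    ∑ (n * s) (λ a → count c (B a)) ≤
      2 * k * ∑ n (λ A → count c (B′ A)) + n * (2 * s * (2 ^ s * (2 * k)) + s)
  contract n c with ∑-or n {λ A → ∑ s (λ a → count c (B (A * s + a)))}
                           {λ A → 2 * k * count c (B′ A) + (2 * s * (2 ^ s * (2 * k)) + s)} perBlock
    where
    perBlock : ∀ A → A < n → DoubleGrid k B ⊎
      ∑ s (λ a → count c (B (A * s + a))) ≤ 2 * k * count c (B′ A) + (2 * s * (2 ^ s * (2 * k)) + s)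
    perBlock A _ with 2 ^ s * (2 * k) <? count c (tall A)
    ... | yes p = inj₁ (tall-grid c A p)
    ... | no ¬p = inj₂ (begin
      ∑ s (λ a → count c (B (A * s + a)))       ≡⟨ ∑-comm s c _ ⟩
      ∑ c (λ b → count s (λ a → B (A * s + a) b)) ≤⟨ scan-bound A c ⟩
      2 * k * count c (B′ A) + 2 * s * count c (tall A) + count s (seen A c)
        ≤⟨ +-mono-≤ (+-monoʳ-≤ (2 * k * count c (B′ A)) (*-monoʳ-≤ (2 * s) (≮⇒≥ ¬p))) (count≤ s _) ⟩
      2 * k * count c (B′ A) + 2 * s * (2 ^ s * (2 * k)) + s
        ≡⟨ +-assoc (2 * k * count c (B′ A)) _ s ⟩
      2 * k * count c (B′ A) + (2 * s * (2 ^ s * (2 * k)) + s) ∎)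
      where open ≤-Reasoning
  ... | inj₁ g = inj₁ g
  ... | inj₂ le = inj₂ (begin
    ∑ (n * s) (λ a → count c (B a)) ≡⟨ ∑-blocks n s _ ⟩
    ∑ n (λ A → ∑ s (λ a → count c (B (A * s + a)))) ≤⟨ le ⟩
    ∑ n (λ A → 2 * k * count c (B′ A) + Z) ≡⟨ ∑-+ n _ _ ⟩
    ∑ n (λ A → 2 * k * count c (B′ A)) + ∑ n (λ _ → Z) ≡⟨ cong₂ _+_ (∑-* n (2 * k) _) (∑-const n Z) ⟩
    2 * k * ∑ n (λ A → count c (B′ A)) + n * Z ∎)
    where
    open ≤-Reasoning
    Z = 2 * s * (2 ^ s * (2 * k)) + s

-- Contracting columns and rows in groups of s divides the number of points by at most (2k)² < s, up to
-- an error linear in the number of groups, so a large density would grow at each contraction.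
module MarcusTardos (k : ℕ) where
  s : ℕ
  s = suc (4 * (k * k))

  density : ℕ
  density = suc (s * (2 ^ s * k) + 2 * k * (2 * s * (2 ^ s * (2 * k)) + s))

  double-grid : ∀ m B → DoubleGrid k B ⊎ ∑ (s ^ m) (λ a → count (s ^ m) (B a)) ≤ density * s ^ m
  double-grid zero B = inj₂ (≤-trans (bit≤1 (B 0 0)) (s≤s z≤n))
  double-grid (suc m) B = subst (λ z → DoubleGrid k B ⊎ ∑ z (λ a → count z (B a)) ≤ density * z) (*-comm n s) goal
    where
    n = s ^ m
    open ColumnContraction k s B using () renaming (B′ to B₁; contract to contract₁; grid-lift to lift₁)
    open RowContraction k s B₁ using () renaming (B′ to B₂; contract to contract₂; grid-lift to lift₂)
    goal : DoubleGrid k B ⊎ ∑ (n * s) (λ a → count (n * s) (B a)) ≤ density * (n * s)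
    goal with contract₁ (n * s) n | contract₂ n n | double-grid m B₂
    ... | inj₁ g | _      | _      = inj₁ g
    ... | _      | inj₁ g | _      = inj₁ (lift₁ g)
    ... | _      | _      | inj₁ g = inj₁ (lift₁ (lift₂ g))
    ... | inj₂ x | inj₂ y | inj₂ z = inj₂ (begin
      ∑ (n * s) (λ a → count (n * s) (B a)) ≤⟨ x ⟩
      2 * k * ∑ (n * s) (λ a → count n (B₁ a)) + s * (n * X) ≤⟨ +-monoˡ-≤ (s * (n * X)) (*-monoʳ-≤ (2 * k) (≤-trans y (+-monoˡ-≤ (n * Y) (*-monoʳ-≤ (2 * k) z)))) ⟩
      2 * k * (2 * k * (density * n) + n * Y) + s * (n * X)
        -- The extra `n` accounts for the `suc` in `density`, which keeps the density positive as
        -- the one-point case requires.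
        ≤⟨ m≤m+n _ n ⟩
      2 * k * (2 * k * (density * n) + n * Y) + s * (n * X) + n
        ≡⟨ solve 6 (λ k d n Y s X →
              con 2 :* k :* (con 2 :* k :* (d :* n) :+ n :* Y) :+ s :* (n :* X) :+ n :=
              con 4 :* (k :* k) :* (d :* n) :+ (con 1 :+ (s :* X :+ con 2 :* k :* Y)) :* n)
              refl k density n Y s X ⟩
      4 * (k * k) * (density * n) + density * n ≡⟨ +-comm _ (density * n) ⟩
      s * (density * n) ≡⟨ solve 3 (λ s d n → s :* (d :* n) := d :* (n :* s)) refl s density n ⟩
      density * (n * s) ∎)
      where
      open ≤-Reasoning
      open +-*-Solver
      X = 2 ^ s * k
      Y = 2 * s * (2 ^ s * (2 * k)) + s

-- Linear minors as weighted sums over blocks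

private variable m n m′ n′ : ℕ

Monotone : (Fin m → Fin n) → Set
Monotone g = ∀ {x y} → x Fin.≤ y → g x Fin.≤ g y

pinch-punchIn : (i j : Fin n) → pinch i (punchIn (Fin.suc i) j) ≡ j
pinch-punchIn Fin.zero    Fin.zero    = refl
pinch-punchIn Fin.zero    (Fin.suc j) = refl
pinch-punchIn (Fin.suc i) Fin.zero    = refl
pinch-punchIn (Fin.suc i) (Fin.suc j) = cong Fin.suc (pinch-punchIn i j)

pinch-suc : (i : Fin n) → pinch i (Fin.suc i) ≡ i
pinch-suc Fin.zero    = refl
pinch-suc (Fin.suc i) = cong Fin.suc (pinch-suc i)

punchIn-inject₁ : (i : Fin n) → punchIn (Fin.suc i) i ≡ inject₁ i
punchIn-inject₁ Fin.zero    = refl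
punchIn-inject₁ (Fin.suc i) = cong Fin.suc (punchIn-inject₁ i)

strict⇒≥id : (g : Fin m → Fin n) → StrictMono g → ∀ x → toℕ x ≤ toℕ (g x)
strict⇒≥id g g< Fin.zero    = z≤n
strict⇒≥id g g< (Fin.suc x) = ≤-<-trans (strict⇒≥id (g ∘ inject₁) (λ i j i<j → g< _ _ (subst₂ _<_ (sym (toℕ-inject₁ i)) (sym (toℕ-inject₁ j)) i<j)) x)
                                (g< (inject₁ x) (Fin.suc x) (s≤s (≤-reflexive (toℕ-inject₁ x))))

strict-surjective⇒id : (g : Fin m → Fin n) → StrictMono g → (∀ y → ∃ λ x → g x ≡ y) →
  m ≡ n × (∀ x → toℕ (g x) ≡ toℕ x)
strict-surjective⇒id g g< surj = ≤-antisym (injective⇒≤ inj) (injective⇒≤ h-inj) , λ x → ≤-antisym (upper x) (strict⇒≥id g g< x)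
  where
  h = proj₁ ∘ surj
  inj : ∀ {x y} → g x ≡ g y → x ≡ y
  inj {x} {y} eq with <-cmp (toℕ x) (toℕ y)
  ... | tri< p _ _ = contradiction (cong toℕ eq) (<⇒≢ (g< x y p))
  ... | tri≈ _ p _ = toℕ-injective p
  ... | tri> _ _ p = contradiction (cong toℕ (sym eq)) (<⇒≢ (g< y x p))
  h-inj : ∀ {x y} → h x ≡ h y → x ≡ y
  h-inj {x} {y} eq = trans (sym (proj₂ (surj x))) (trans (cong g eq) (proj₂ (surj y)))
  h< : StrictMono h
  h< i j i<j with <-cmp (toℕ (h i)) (toℕ (h j))
  ... | tri< p _ _ = p
  ... | tri≈ _ p _ = contradiction (cong toℕ (h-inj (toℕ-injective p))) (<⇒≢ i<j)
  ... | tri> _ _ p = contradiction (subst₂ Fin._<_ (proj₂ (surj j)) (proj₂ (surj i)) (g< _ _ p)) (<-asym i<j)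
  upper : ∀ x → toℕ (g x) ≤ toℕ x
  upper x = subst (toℕ (g x) ≤_) (cong toℕ (inj (proj₂ (surj (g x))))) (strict⇒≥id h h< (g x))

module LinearAlgebra (F : FiniteField) where
  open FiniteField F public using (Carrier; _+F_; _*F_; -F_; 0F; 1F; 0≢1; inverse; enum; enum-surjective) renaming (size to q)

  commutativeRing : CommutativeRing _ _
  commutativeRing = record { isCommutativeRing = FiniteField.isCommutativeRing F }

  open CommutativeRing commutativeRing public using ()
    renaming (+-assoc to +F-assoc; +-comm to +F-comm; +-identityˡ to +F-identityˡ; +-identityʳ to +F-identityʳ;
              *-assoc to *F-assoc; *-comm to *F-comm; *-identityˡ to *F-identityˡ; *-identityʳ to *F-identityʳ;
              distribˡ to *F-distribˡ; zeroˡ to *F-zeroˡ; zeroʳ to *F-zeroʳ;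
              -‿inverseˡ to -F-inverseˡ; -‿inverseʳ to -F-inverseʳ)
  open Algebra.Properties.Semiring.Sum (CommutativeRing.semiring commutativeRing) public
    using (sum; sum-cong-≗; sum-remove; ∑-distrib-+; *-distribˡ-sum; *-distribʳ-sum; sum-replicate-zero)
    renaming (∑-comm to sum-comm)
  open Algebra.Properties.Ring (CommutativeRing.ring commutativeRing) public
    using (-‿distribˡ-*)

  index : Carrier → Fin q
  index = proj₁ ∘ enum-surjective

  index-injective : ∀ {x y} → index x ≡ index y → x ≡ y
  index-injective {x} {y} eq = trans (sym (proj₂ (enum-surjective x))) (trans (cong enum eq) (proj₂ (enum-surjective y)))

  _≟F_ : (x y : Carrier) → Dec (x ≡ y)
  x ≟F y = map′ index-injective (cong index) (index x ≟ᶠ index y)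

  sum-zero : (f : Fin n → Carrier) → (∀ j → f j ≡ 0F) → sum f ≡ 0F
  sum-zero {n} f z = trans (sum-cong-≗ z) (sum-replicate-zero n)

  sum-single : (f : Fin n → Carrier) (i : Fin n) → (∀ j → j ≢ i → f j ≡ 0F) → sum f ≡ f i
  sum-single {suc n} f i z = trans (sum-remove {i = i} f)
    (trans (cong (f i +F_) (sum-zero _ (λ j → z _ (punchInᵢ≢i i j)))) (+F-identityʳ _))

  only : ∀ {k} → Fin k → Fin k → Carrier → Carrier
  only i r x = if ⌊ i ≟ᶠ r ⌋ then x else 0F

  only-≡ : ∀ {k} {i r : Fin k} x → i ≡ r → only i r x ≡ x
  only-≡ {i = i} {r} x eq with i ≟ᶠ r
  ... | yes _ = refl
  ... | no ¬p = contradiction eq ¬p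

  only-≢ : ∀ {k} {i r : Fin k} x → i ≢ r → only i r x ≡ 0F
  only-≢ {i = i} {r} x ne with i ≟ᶠ r
  ... | yes p = contradiction p ne
  ... | no _  = refl

  only-+ : ∀ {k} (i r : Fin k) x y → only i r (x +F y) ≡ only i r x +F only i r y
  only-+ i r x y with i ≟ᶠ r
  ... | yes _ = refl
  ... | no _  = sym (+F-identityʳ 0F)

  only-* : ∀ {k} (i r : Fin k) a x → only i r (a *F x) ≡ a *F only i r x
  only-* i r a x with i ≟ᶠ r
  ... | yes _ = refl
  ... | no _  = sym (*F-zeroʳ a)

  comb : (Fin m → Fin m′) → (Fin m → Carrier) → (Fin m → Carrier) → Fin m′ → Carrier
  comb g α X r = sum (λ x → only (g x) r (α x *F X x))

  comb-cong : ∀ (g : Fin m → Fin m′) α {X Y} → X ≗ Y → ∀ r → comb g α X r ≡ comb g α Y r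
  comb-cong g α eq r = sum-cong-≗ (λ x → cong (λ z → only (g x) r (α x *F z)) (eq x))

  *F-swap : ∀ a b c → a *F (b *F c) ≡ b *F (a *F c)
  *F-swap a b c = trans (sym (*F-assoc a b c)) (trans (cong (_*F c) (*F-comm a b)) (*F-assoc b a c))

  comb-linear : ∀ (g : Fin m → Fin m′) α a b (P Q : Fin m → Carrier) r →
    comb g α (λ x → (a *F P x) +F (b *F Q x)) r ≡ (a *F comb g α P r) +F (b *F comb g α Q r)
  comb-linear g α a b P Q r = begin
    comb g α (λ x → (a *F P x) +F (b *F Q x)) r
      ≡⟨ sum-cong-≗ (λ x → trans (cong (only (g x) r) (trans (*F-distribˡ (α x) _ _) (cong₂ _+F_ (*F-swap (α x) a _) (*F-swap (α x) b _))))
           (trans (only-+ (g x) r _ _) (cong₂ _+F_ (only-* (g x) r a _) (only-* (g x) r b _)))) ⟩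
    sum (λ x → (a *F only (g x) r (α x *F P x)) +F (b *F only (g x) r (α x *F Q x)))
      ≡⟨ ∑-distrib-+ (λ x → a *F only (g x) r (α x *F P x)) (λ x → b *F only (g x) r (α x *F Q x)) ⟩
    sum (λ x → a *F only (g x) r (α x *F P x)) +F sum (λ x → b *F only (g x) r (α x *F Q x))
      ≡⟨ sym (cong₂ _+F_ (*-distribˡ-sum a (λ x → only (g x) r (α x *F P x))) (*-distribˡ-sum b (λ x → only (g x) r (α x *F Q x)))) ⟩
    (a *F comb g α P r) +F (b *F comb g α Q r) ∎
    where open ≡-Reasoning

  merge : Carrier → Carrier → Fin n → (Fin (suc n) → Carrier) → Fin n → Carrier
  merge a b i X j = if ⌊ j ≟ᶠ i ⌋ then (a *F X (inject₁ i)) +F (b *F X (Fin.suc i)) else X (punchIn (Fin.suc i) j)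

  -- The term at `i + 1` is taken out of the sum and added to the term at `i`. This serves in both
  -- directions: to undo an operation in `comb-unmerge`, and to perform one in `combine-rows`.
  comb-merge : ∀ {n} (g′ : Fin (suc n) → Fin m′) α′ (g : Fin n → Fin m′) α i a b →
    (∀ j → g′ (punchIn (Fin.suc i) j) ≡ g j) → g′ (Fin.suc i) ≡ g i →
    α′ (inject₁ i) ≡ α i *F a → α′ (Fin.suc i) ≡ α i *F b →
    (∀ j → j ≢ i → α′ (punchIn (Fin.suc i) j) ≡ α j) →
    ∀ X r → comb g′ α′ X r ≡ comb g α (merge a b i X) r
  comb-merge {n = n} g′ α′ g α i a b gp gs αa αb αo X r = begin
    sum t                                  ≡⟨ sum-remove {i = Fin.suc i} t ⟩
    e +F sum (t ∘ punchIn (Fin.suc i))      ≡⟨ +F-comm e _ ⟩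
    sum (t ∘ punchIn (Fin.suc i)) +F e
      ≡⟨ cong (sum (t ∘ punchIn (Fin.suc i)) +F_) (sym (trans (sum-single (λ j → only j i e) i (λ j → only-≢ e)) (only-≡ {i = i} e refl))) ⟩
    sum (t ∘ punchIn (Fin.suc i)) +F sum (λ j → only j i e)
      ≡⟨ sym (∑-distrib-+ (t ∘ punchIn (Fin.suc i)) (λ j → only j i e)) ⟩
    sum (λ j → t (punchIn (Fin.suc i) j) +F only j i e)  ≡⟨ sum-cong-≗ term ⟩
    comb g α (merge a b i X) r ∎
    where
    open ≡-Reasoning
    t : Fin (suc n) → Carrier
    t x = only (g′ x) r (α′ x *F X x)
    e = t (Fin.suc i)
    term : ∀ j → t (punchIn (Fin.suc i) j) +F only j i e ≡ only (g j) r (α j *F merge a b i X j)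
    term j with j ≟ᶠ i
    ... | no j≢i = trans (+F-identityʳ _) (cong₂ (λ u v → only u r (v *F X (punchIn (Fin.suc i) j))) (gp j) (αo j j≢i))
    ... | yes refl = begin
      t (punchIn (Fin.suc i) i) +F e
        ≡⟨ cong (_+F e) (trans (cong t (punchIn-inject₁ i)) (cong (λ u → only u r (α′ (inject₁ i) *F X (inject₁ i))) (trans (cong g′ (sym (punchIn-inject₁ i))) (gp i)))) ⟩
      only (g i) r (α′ (inject₁ i) *F X (inject₁ i)) +F e
        ≡⟨ cong₂ _+F_ (cong (λ u → only (g i) r (u *F X (inject₁ i))) αa) (cong₂ (λ u v → only u r (v *F X (Fin.suc i))) gs αb) ⟩
      only (g i) r ((α i *F a) *F X (inject₁ i)) +F only (g i) r ((α i *F b) *F X (Fin.suc i))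
        ≡⟨ sym (only-+ (g i) r _ _) ⟩
      only (g i) r (((α i *F a) *F X (inject₁ i)) +F ((α i *F b) *F X (Fin.suc i)))
        ≡⟨ cong (only (g i) r) (trans (cong₂ _+F_ (*F-assoc _ _ _) (*F-assoc _ _ _)) (sym (*F-distribˡ (α i) _ _))) ⟩
      only (g i) r (α i *F ((a *F X (inject₁ i)) +F (b *F X (Fin.suc i)))) ∎

  comb-id : ∀ (α : Fin m → Carrier) X r → α r ≡ 1F → comb id α X r ≡ X r
  comb-id α X r eq = trans (sum-single _ r (λ j → only-≢ _)) (trans (only-≡ _ refl) (trans (cong (_*F X r) eq) (*F-identityˡ _)))

  LinearMinor-transpose : {N : Mat Carrier m′ n′} {M : Mat Carrier m n} →
    LinearMinor F N M → LinearMinor F (flip N) (flip M)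
  LinearMinor-transpose (done eq)       = done (λ r c → eq c r)
  LinearMinor-transpose (rowOp α β i l) = colOp α β i (LinearMinor-transpose l)
  LinearMinor-transpose (colOp α β i l) = rowOp α β i (LinearMinor-transpose l)

  merge-cong : ∀ a b (i : Fin n) {X Y} → X ≗ Y → merge a b i X ≗ merge a b i Y
  merge-cong a b i eq j with j ≟ᶠ i
  ... | yes _ = cong₂ (λ u v → (a *F u) +F (b *F v)) (eq _) (eq _)
  ... | no _  = eq _

  LinearMinor-cong : {N : Mat Carrier m′ n′} {M M₁ : Mat Carrier m n} → (∀ r c → M r c ≡ M₁ r c) →
    LinearMinor F N M → LinearMinor F N M₁
  LinearMinor-cong eq (done eq′)      = done (λ r c → trans (eq′ r c) (eq r c))
  LinearMinor-cong eq (rowOp α β i l) = rowOp α β i (LinearMinor-cong (λ r c → merge-cong α β i (λ x → eq x c) r) l)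
  LinearMinor-cong eq (colOp α β i l) = colOp α β i (LinearMinor-cong (λ r c → merge-cong α β i (eq r) c) l)

  LinearMinor-trans : ∀ {k l} {A : Mat Carrier k l} {B : Mat Carrier m′ n′} {C : Mat Carrier m n} →
    LinearMinor F A B → LinearMinor F B C → LinearMinor F A C
  LinearMinor-trans p (done eq)       = LinearMinor-cong eq p
  LinearMinor-trans p (rowOp α β i l) = rowOp α β i (LinearMinor-trans p l)
  LinearMinor-trans p (colOp α β i l) = colOp α β i (LinearMinor-trans p l)

  -- In matrix terms `N` is a product A M B, where column `x` of A has `α x` in row `g x` and zeros
  -- elsewhere, and B is the transpose of a matrix of this kind. Monotonicity records that only
  -- consecutive rows or columns are merged.
  record Form (N : Mat Carrier m′ n′) (M : Mat Carrier m n) : Set where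
    field
      g : Fin m → Fin m′
      h : Fin n → Fin n′
      α : Fin m → Carrier
      β : Fin n → Carrier
      g-mono : Monotone g
      h-mono : Monotone h
      formula : ∀ r c → N r c ≡ comb g α (λ x → comb h β (M x) c) r

  module Unmerge {k} (g : Fin n → Fin k) (α : Fin n → Carrier) (i : Fin n) (a b : Carrier) where
    g′ : Fin (suc n) → Fin k
    g′ = g ∘ pinch i
    α′ : Fin (suc n) → Carrier
    α′ x with x ≟ᶠ Fin.suc i | x ≟ᶠ inject₁ i
    ... | yes _ | _     = α i *F b
    ... | no _  | yes _ = α i *F a
    ... | no _  | no _  = α (pinch i x)
    comb-unmerge : ∀ X r → comb g α (merge a b i X) r ≡ comb g′ α′ X r
    comb-unmerge X r = sym (comb-merge g′ α′ g α i a b (λ j → cong g (pinch-punchIn i j)) (cong g (pinch-suc i)) αa αb αo X r)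
      where
      αa : α′ (inject₁ i) ≡ α i *F a
      αa with inject₁ i ≟ᶠ Fin.suc i | inject₁ i ≟ᶠ inject₁ i
      ... | yes p | _ = contradiction (trans (sym (toℕ-inject₁ i)) (cong toℕ p)) (<⇒≢ ≤-refl)
      ... | no _ | yes _ = refl
      ... | no _ | no ¬p = contradiction refl ¬p
      αb : α′ (Fin.suc i) ≡ α i *F b
      αb with Fin.suc i ≟ᶠ Fin.suc i | Fin.suc i ≟ᶠ inject₁ i
      ... | yes _ | _ = refl
      ... | no ¬p | _ = contradiction refl ¬p
      αo : ∀ j → j ≢ i → α′ (punchIn (Fin.suc i) j) ≡ α j
      αo j j≢i with punchIn (Fin.suc i) j ≟ᶠ Fin.suc i | punchIn (Fin.suc i) j ≟ᶠ inject₁ i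
      ... | yes p | _ = contradiction p (punchInᵢ≢i (Fin.suc i) j)
      ... | no _ | yes p = contradiction (punchIn-injective (Fin.suc i) j i (trans p (sym (punchIn-inject₁ i)))) j≢i
      ... | no _ | no _ = cong α (pinch-punchIn i j)

  LinearMinor⇒Form : {N : Mat Carrier m′ n′} {M : Mat Carrier m n} → LinearMinor F N M → Form N M
  LinearMinor⇒Form {N = N} {M} (done eq) = record
    { g = id ; h = id ; α = λ _ → 1F ; β = λ _ → 1F ; g-mono = id ; h-mono = id
    ; formula = λ r c → trans (eq r c) (sym (trans (comb-id _ _ r refl) (comb-id _ _ c refl))) }
  LinearMinor⇒Form {N = N} {M} (rowOp a b i l) = record
    { g = g′ ; h = h ; α = α′ ; β = β ; g-mono = λ p → g-mono (pinch-mono-≤ i p) ; h-mono = h-mono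
    ; formula = λ r c → trans (formula r c) (trans (comb-cong g α (λ x → linear x c) r) (comb-unmerge (λ x → comb h β (M x) c) r)) }
    where
    open Form (LinearMinor⇒Form l)
    open Unmerge g α i a b
    linear : ∀ x c → comb h β (rowSum F a b i M x) c ≡ merge a b i (λ x → comb h β (M x) c) x
    linear x c with x ≟ᶠ i
    ... | yes _ = comb-linear h β a b (M (inject₁ i)) (M (Fin.suc i)) c
    ... | no _  = refl
  LinearMinor⇒Form {N = N} {M} (colOp a b i l) = record
    { g = g ; h = g′ ; α = α ; β = α′ ; g-mono = g-mono ; h-mono = λ p → h-mono (pinch-mono-≤ i p)
    ; formula = λ r c → trans (formula r c) (comb-cong g α (λ x → comb-unmerge (M x) c) r) }
    where
    open Form (LinearMinor⇒Form l)
    open Unmerge h β i a b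

  -- A weighted sum can rescale a row only by merging it, hence the condition on α.
  combine-rows : ∀ m (M : Mat Carrier m n) (g : Fin m → Fin m′) (α : Fin m → Carrier) → Monotone g →
    (∀ r → ∃ λ x → g x ≡ r) → (∀ x → α x ≡ 1F ⊎ ∃ λ y → y ≢ x × g y ≡ g x) →
    (N : Mat Carrier m′ n) → (∀ r c → N r c ≡ comb g α (λ x → M x c) r) → LinearMinor F N M
  combine-rows zero M g α mono surj unit N eq = base refl N eq surj
    where
    base : ∀ {m′} {g : Fin 0 → Fin m′} → 0 ≡ 0 → (N : Mat Carrier m′ _) → (∀ r c → N r c ≡ comb g α (λ x → M x c) r) →
      (∀ r → ∃ λ x → g x ≡ r) → LinearMinor F N M
    base {zero}  _ N eq surj = done (λ ())
    base {suc _} _ N eq surj with () ← proj₁ (surj Fin.zero)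
  combine-rows {m′ = m′} (suc m) M g α mono surj unit N eq with any? (λ i → g (inject₁ i) ≟ᶠ g (Fin.suc i))
  ... | yes (i , gi) = rowOp a b i (combine-rows m _ g₁ α₁ mono₁ surj₁ unit₁ N
          (λ r c → trans (eq r c) (comb-merge g α g₁ α₁ i a b (λ _ → refl) (trans (sym gi) (cong g (sym (punchIn-inject₁ i)))) αa αb αo (λ x → M x c) r)))
    where
    a = α (inject₁ i)
    b = α (Fin.suc i)
    g₁ = g ∘ punchIn (Fin.suc i)
    α₁ : Fin m → Carrier
    -- Both weights are spent in this operation, so the merged row enters the later ones with weight
    -- 1.
    α₁ j = if ⌊ j ≟ᶠ i ⌋ then 1F else α (punchIn (Fin.suc i) j)
    α₁i : α₁ i ≡ 1F
    α₁i with i ≟ᶠ i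
    ... | yes _ = refl
    ... | no ¬p = contradiction refl ¬p
    αa : α (inject₁ i) ≡ α₁ i *F a
    αa = sym (trans (cong (_*F a) α₁i) (*F-identityˡ a))
    αb : α (Fin.suc i) ≡ α₁ i *F b
    αb = sym (trans (cong (_*F b) α₁i) (*F-identityˡ b))
    αo : ∀ j → j ≢ i → α (punchIn (Fin.suc i) j) ≡ α₁ j
    αo j ne with j ≟ᶠ i
    ... | yes p = contradiction p ne
    ... | no _  = refl
    mono₁ : Monotone g₁
    mono₁ {x} {y} p = mono (punchIn-mono-≤ (Fin.suc i) x y p)
    reindex : ∀ x → ∃ λ j → g₁ j ≡ g x × (x ≢ Fin.suc i → punchIn (Fin.suc i) j ≡ x) × (x ≡ Fin.suc i → j ≡ i)
    reindex x with Fin.suc i ≟ᶠ x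
    ... | yes refl = i , trans (cong g (punchIn-inject₁ i)) gi , (λ ne → contradiction refl ne) , λ _ → refl
    ... | no ne = punchOut ne , cong g (punchIn-punchOut ne) , (λ _ → punchIn-punchOut ne) , λ p → contradiction (sym p) ne
    surj₁ : ∀ r → ∃ λ x → g₁ x ≡ r
    surj₁ r with x , gx ← surj r with j , gj , _ ← reindex x = j , trans gj gx
    unit₁ : ∀ x → α₁ x ≡ 1F ⊎ ∃ λ y → y ≢ x × g₁ y ≡ g₁ x
    unit₁ x with x ≟ᶠ i
    ... | yes _ = inj₁ refl
    ... | no x≢i with unit (punchIn (Fin.suc i) x)
    ...   | inj₁ p = inj₁ p
    ...   | inj₂ (y , y≢ , gy) with j , gj , jo , ji ← reindex y = inj₂ (j , j≢ , trans gj gy)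
      where
      j≢ : j ≢ x
      j≢ refl with y ≟ᶠ Fin.suc i
      ... | yes p = x≢i (ji p)
      ... | no ne = y≢ (sym (jo ne))
  -- When no two consecutive rows share a block, `g` is strictly monotone and onto, hence the
  -- identity. Then no row has a partner and `unit` forces all weights to be 1.
  ... | no none with strict-surjective⇒id g strict surj
    where
    strict : StrictMono g
    strict x y x<y with m≤n⇒m<n∨m≡n (mono {x} {y} (<⇒≤ x<y))
    ... | inj₁ p = p
    ... | inj₂ p = contradiction (i , toℕ-injective (≤-antisym (mono (≤-trans (≤-reflexive (toℕ-inject₁ i)) (n≤1+n _)))
                     (≤-trans (mono {Fin.suc i} {y} (subst (λ z → suc z ≤ toℕ y) (sym ti) x<y)) (≤-reflexive (sym (trans (cong (toℕ ∘ g) xi) p)))))) none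
      where
      x<m : toℕ x < m
      x<m = <-≤-trans x<y (s≤s⁻¹ (toℕ<n y))
      i : Fin m
      i = fromℕ< x<m
      ti : toℕ i ≡ toℕ x
      ti = toℕ-fromℕ< x<m
      xi : inject₁ i ≡ x
      xi = toℕ-injective (trans (toℕ-inject₁ i) ti)
  ...   | refl , gid = done (λ r c → trans (eq r c) (final r c))
    where
    g≡id : ∀ x → g x ≡ x
    g≡id x = toℕ-injective (gid x)
    α≡1 : ∀ x → α x ≡ 1F
    α≡1 x with unit x
    ... | inj₁ p = p
    ... | inj₂ (y , ne , gy) = contradiction (trans (sym (g≡id y)) (trans gy (g≡id x))) ne
    final : ∀ r c → comb g α (λ x → M x c) r ≡ M r c
    final r c = trans (sum-cong-≗ (λ x → cong (λ z → only z r (α x *F M x c)) (g≡id x))) (comb-id α (λ x → M x c) r (α≡1 r))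

-- Greedy selection and linear systems over a finite field

-- Add points as long as one is unrelated to all points chosen so far; a family that cannot be
-- extended relates to everything.
dichotomy : {P : Fin m → Set} (P? : ∀ x → Dec (P x)) {R : Fin m → Fin m → Set} (R? : ∀ x y → Dec (R x y)) →
  (∀ {x y} → R x y → R y x) → ∀ Q →
  (Σ (Fin Q → Fin m) λ e → (∀ u → P (e u)) × (∀ u v → u ≢ v → ¬ R (e u) (e v))) ⊎
  (Σ ℕ λ k → k < Q × Σ (Fin k → Fin m) λ e → (∀ u → P (e u)) × (∀ x → P x → ∃ λ u → R x (e u)))
dichotomy P? R? sym-R zero = inj₁ ((λ ()) , (λ ()) , (λ ()))
dichotomy {P = P} P? {R} R? sym-R (suc Q) with dichotomy P? R? sym-R Q
... | inj₂ (k , k<Q , rest) = inj₂ (k , m<n⇒m<1+n k<Q , rest)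
... | inj₁ (e , Pe , apart) with any? (λ x → P? x ×-dec all? (λ u → ¬? (R? x (e u))))
...   | yes (x , Px , new) = inj₁ (x ◂ e , (λ { Fin.zero → Px ; (Fin.suc u) → Pe u }) , apart′)
  where
  apart′ : ∀ u v → u ≢ v → ¬ R ((x ◂ e) u) ((x ◂ e) v)
  apart′ Fin.zero    Fin.zero    ne r = ne refl
  apart′ Fin.zero    (Fin.suc v) ne r = new v r
  apart′ (Fin.suc u) Fin.zero    ne r = new u (sym-R r)
  apart′ (Fin.suc u) (Fin.suc v) ne r = apart u v (ne ∘ cong Fin.suc) r
...   | no none = inj₂ (Q , ≤-refl , e , Pe , cover)
  where
  cover : ∀ x → P x → ∃ λ u → R x (e u)
  cover x Px with any? (λ u → R? x (e u))
  ... | yes p = p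
  ... | no ¬p = contradiction (x , Px , λ u r → ¬p (u , r)) none

funToFin-cong : {f g : Fin m → Fin n} → f ≗ g → funToFin f ≡ funToFin g
funToFin-cong {zero}  eq = refl
funToFin-cong {suc m} eq = cong₂ combine (eq Fin.zero) (funToFin-cong (eq ∘ Fin.suc))

funToFin-injective : (f g : Fin m → Fin n) → funToFin f ≡ funToFin g → f ≗ g
funToFin-injective f g eq i = trans (sym (finToFun-funToFin f i)) (trans (cong (λ z → finToFun z i) eq) (finToFun-funToFin g i))

finToFun-injective : (x y : Fin (n ^ m)) → finToFun {n} {m} x ≗ finToFun y → x ≡ y
finToFun-injective {n} {m} x y eq = trans (sym (funToFin-finToFin {m} {n} x)) (trans (funToFin-cong eq) (funToFin-finToFin {m} {n} y))

-- If every φ were bad, then φ ↦ (j , φ without its j-th coordinate) would be injective for bad j.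
avoid : ∀ n T → n < T → (Bad : Fin n → (Fin n → Fin T) → Set) → (∀ j φ → Dec (Bad j φ)) →
  (∀ j φ ψ → (∀ i → i ≢ j → φ i ≡ ψ i) → Bad j φ → Bad j ψ → φ j ≡ ψ j) →
  Σ (Fin n → Fin T) λ φ → ∀ j → ¬ Bad j φ
avoid zero T n<T Bad Bad? unique = (λ ()) , λ ()
avoid (suc n) T n<T Bad Bad? unique with any? {n = T ^ suc n} (λ x → all? (λ j → ¬? (Bad? j (finToFun x))))
... | yes (x , good) = finToFun x , good
... | no none = contradiction (collision (pigeonhole (*-monoˡ-< (T ^ n) {{>-nonZero (m^n>0 T {{>-nonZero (≤-trans (s≤s z≤n) n<T)}} n)}} n<T) key)) id
  where
  bad : ∀ x → ∃ λ j → Bad j (finToFun {T} {suc n} x)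
  bad x with any? (λ j → Bad? j (finToFun x))
  ... | yes p = p
  ... | no ¬p = contradiction (x , λ j b → ¬p (j , b)) none
  key : Fin (T ^ suc n) → Fin (suc n * T ^ n)
  key x = combine (proj₁ (bad x)) (funToFin (finToFun {T} {suc n} x ∘ punchIn (proj₁ (bad x))))
  collision : (∃₂ λ x y → x Fin.< y × key x ≡ key y) → ⊥
  collision (x , y , x<y , eq) with bad x | bad y | combine-injective (proj₁ (bad x)) _ (proj₁ (bad y)) _ eq
  ... | j , bx | .j , by | refl , eq′ = <⇒≢ x<y (cong toℕ (finToFun-injective {T} {suc n} x y same))
    where
    off : ∀ i → i ≢ j → finToFun {T} {suc n} x i ≡ finToFun y i
    off i i≢j = subst (λ z → finToFun {T} {suc n} x z ≡ finToFun y z) (punchIn-punchOut (i≢j ∘ sym)) (funToFin-injective _ _ eq′ (punchOut (i≢j ∘ sym)))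
    same : finToFun {T} {suc n} x ≗ finToFun y
    same i with i ≟ᶠ j
    ... | yes refl = unique j _ _ off bx by
    ... | no i≢j = off i i≢j

module Solving (F : FiniteField) where
  open LinearAlgebra F

  Vector : ℕ → Set
  Vector n = Fin n → Carrier

  infixl 7 _∙_
  _∙_ : Vector n → Vector n → Carrier
  v ∙ β = sum (λ c → v c *F β c)

  infixl 6 _⊹_⊛_
  _⊹_⊛_ : Vector n → Carrier → Vector n → Vector n
  (u ⊹ a ⊛ v) c = u c +F (a *F v c)

  ∙-comm : ∀ (u v : Vector n) → u ∙ v ≡ v ∙ u
  ∙-comm u v = sum-cong-≗ (λ c → *F-comm (u c) (v c))

  ∙-linearʳ : ∀ (u : Vector n) β a γ → u ∙ (β ⊹ a ⊛ γ) ≡ (u ∙ β) +F (a *F (u ∙ γ))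
  ∙-linearʳ u β a γ = begin
    sum (λ c → u c *F (β c +F (a *F γ c)))
      ≡⟨ sum-cong-≗ (λ c → trans (*F-distribˡ (u c) _ _) (cong ((u c *F β c) +F_) (*F-swap (u c) a (γ c)))) ⟩
    sum (λ c → (u c *F β c) +F (a *F (u c *F γ c)))
      ≡⟨ ∑-distrib-+ (λ c → u c *F β c) (λ c → a *F (u c *F γ c)) ⟩
    (u ∙ β) +F sum (λ c → a *F (u c *F γ c))
      ≡⟨ cong ((u ∙ β) +F_) (sym (*-distribˡ-sum a (λ c → u c *F γ c))) ⟩
    (u ∙ β) +F (a *F (u ∙ γ)) ∎
    where open ≡-Reasoning

  ∙-linearˡ : ∀ (u v : Vector n) a β → (u ⊹ a ⊛ v) ∙ β ≡ (u ∙ β) +F (a *F (v ∙ β))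
  ∙-linearˡ u v a β = trans (∙-comm (u ⊹ a ⊛ v) β) (trans (∙-linearʳ β u a v) (cong₂ (λ x y → x +F (a *F y)) (∙-comm β u) (∙-comm β v)))

  InSpan : (Fin m → Vector n) → Vector n → Set
  InSpan w v = ∃ λ l → ∀ c → v c ≡ l ∙ (λ i → w i c)

  InSpan-⊹ : ∀ (w : Fin m → Vector n) u a v → InSpan w u → InSpan w v → InSpan w (u ⊹ a ⊛ v)
  InSpan-⊹ w u a v (k , eq) (l , eq′) = (k ⊹ a ⊛ l) , λ c →
    trans (cong₂ (λ x y → x +F (a *F y)) (eq c) (eq′ c)) (sym (∙-linearˡ k l a (λ i → w i c)))

  InSpan-≗ : ∀ (w : Fin m → Vector n) {u v} → u ≗ v → InSpan w u → InSpan w v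
  InSpan-≗ w eq (k , eq′) = k , λ c → trans (sym (eq c)) (eq′ c)

  cancel : ∀ x y → (x +F (-F y)) +F y ≡ x
  cancel x y = trans (+F-assoc x _ y) (trans (cong (x +F_) (-F-inverseˡ y)) (+F-identityʳ x))

  Dual : (Fin m → Vector n) → Vector n → Set
  Dual w v = ∃ λ β → (∀ i → w i ∙ β ≡ 0F) × v ∙ β ≡ 1F

  -- The Fredholm alternative, by elimination. If the functional `β` found for the later vectors
  -- does not vanish on the first one, w₀, the question passes to v - δw₀, with `δ` inverse to the
  -- value of `β` on w₀. A relation for this vector is one for `v`; a functional `β′` for it serves
  -- `v` after subtracting the multiple of `β` that makes it vanish on w₀.
  dual : ∀ m (w : Fin m → Vector n) v → InSpan w v ⊎ Dual w v
  dual zero w v with any? (λ c → ¬? (v c ≟F 0F))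
  ... | no none = inj₁ ((λ ()) , λ c → decidable-stable (v c ≟F 0F) (λ ne → none (c , ne)))
  ... | yes (c , ne) with y , vy ← inverse (v c) ne = inj₂ ((λ d → only d c y) , (λ ()) ,
        trans (sum-single _ c (λ d d≢c → trans (cong (v d *F_) (only-≢ y d≢c)) (*F-zeroʳ (v d))))
              (trans (cong (v c *F_) (only-≡ {i = c} y refl)) vy))
  dual (suc m) w v with dual m (w ∘ Fin.suc) v
  ... | inj₁ (l , eq) = inj₁ ((0F ◂ l) , λ c → trans (eq c)
          (sym (trans (cong (_+F (l ∙ λ i → w (Fin.suc i) c)) (*F-zeroˡ (w Fin.zero c))) (+F-identityˡ _))))
  ... | inj₂ (β , zeros , one) with (w Fin.zero ∙ β) ≟F 0F
  ...   | yes z = inj₂ (β , (λ { Fin.zero → z ; (Fin.suc i) → zeros i }) , one)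
  ...   | no nz with δ , γδ ← inverse (w Fin.zero ∙ β) nz
                with dual m (w ∘ Fin.suc) (v ⊹ (-F δ) ⊛ w Fin.zero)
  ...     | inj₁ (l , eq) = inj₁ ((δ ◂ l) , λ c → trans
              (sym (trans (cong (_+F (δ *F w Fin.zero c)) (cong (v c +F_) (sym (-‿distribˡ-* δ (w Fin.zero c))))) (cancel (v c) _)))
              (trans (+F-comm _ _) (cong ((δ *F w Fin.zero c) +F_) (eq c))))
  ...     | inj₂ (β′ , zeros′ , one′) = inj₂ ((β′ ⊹ a ⊛ β) , zeros″ , one″)
    where
    open ≡-Reasoning
    x = w Fin.zero ∙ β′
    γ = w Fin.zero ∙ β
    a = -F (δ *F x)
    zeros″ : ∀ i → w i ∙ (β′ ⊹ a ⊛ β) ≡ 0F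
    zeros″ Fin.zero = begin
      w Fin.zero ∙ (β′ ⊹ a ⊛ β) ≡⟨ ∙-linearʳ (w Fin.zero) β′ a β ⟩
      x +F (a *F γ)             ≡⟨ cong (x +F_) (sym (-‿distribˡ-* (δ *F x) γ)) ⟩
      x +F (-F ((δ *F x) *F γ)) ≡⟨ cong (λ z → x +F (-F z)) (trans (*F-comm _ γ) (sym (*F-assoc γ δ x))) ⟩
      x +F (-F ((γ *F δ) *F x)) ≡⟨ cong (λ z → x +F (-F z)) (trans (cong (_*F x) γδ) (*F-identityˡ x)) ⟩
      x +F (-F x)               ≡⟨ -F-inverseʳ x ⟩
      0F ∎
    zeros″ (Fin.suc i) = begin
      w (Fin.suc i) ∙ (β′ ⊹ a ⊛ β) ≡⟨ ∙-linearʳ (w (Fin.suc i)) β′ a β ⟩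
      (w (Fin.suc i) ∙ β′) +F (a *F (w (Fin.suc i) ∙ β)) ≡⟨ cong₂ (λ y z → y +F (a *F z)) (zeros′ i) (zeros i) ⟩
      0F +F (a *F 0F) ≡⟨ trans (+F-identityˡ _) (*F-zeroʳ a) ⟩
      0F ∎
    one″ : v ∙ (β′ ⊹ a ⊛ β) ≡ 1F
    one″ = begin
      v ∙ (β′ ⊹ a ⊛ β)         ≡⟨ ∙-linearʳ v β′ a β ⟩
      (v ∙ β′) +F (a *F (v ∙ β)) ≡⟨ cong ((v ∙ β′) +F_) (trans (cong (a *F_) one) (*F-identityʳ a)) ⟩
      (v ∙ β′) +F a             ≡⟨ cong ((v ∙ β′) +F_) (-‿distribˡ-* δ x) ⟩
      (v ∙ β′) +F ((-F δ) *F x) ≡⟨ sym (∙-linearˡ v (w Fin.zero) (-F δ) β′) ⟩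
      (v ⊹ (-F δ) ⊛ w Fin.zero) ∙ β′ ≡⟨ one′ ⟩
      1F ∎

  Dual⇒¬InSpan : (w : Fin m → Vector n) (v : Vector n) → Dual w v → ¬ InSpan w v
  Dual⇒¬InSpan w v (β , zeros , one) (l , eq) = 0≢1 (begin
    0F ≡⟨ sym (sum-zero _ (λ i → trans (cong (l i *F_) (zeros i)) (*F-zeroʳ (l i)))) ⟩
    sum (λ i → l i *F (w i ∙ β)) ≡⟨ sum-cong-≗ (λ i → *-distribˡ-sum (l i) (λ c → w i c *F β c)) ⟩
    sum (λ i → sum (λ c → l i *F (w i c *F β c))) ≡⟨ sum-comm (λ i c → l i *F (w i c *F β c)) ⟩
    sum (λ c → sum (λ i → l i *F (w i c *F β c))) ≡⟨ sum-cong-≗ (λ c → trans (sum-cong-≗ (λ i → sym (*F-assoc (l i) (w i c) (β c)))) (sym (*-distribʳ-sum (β c) (λ i → l i *F w i c)))) ⟩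
    sum (λ c → (l ∙ λ i → w i c) *F β c) ≡⟨ sum-cong-≗ (λ c → cong (_*F β c) (sym (eq c))) ⟩
    v ∙ β ≡⟨ one ⟩
    1F ∎)
    where open ≡-Reasoning

  InSpan? : (w : Fin m → Vector n) (v : Vector n) → Dec (InSpan w v)
  InSpan? {m} w v with dual m w v
  ... | inj₁ p = yes p
  ... | inj₂ d = no (Dual⇒¬InSpan w v d)

  -- Linear independence of the vectors, in the form in which column coefficients will be extracted
  -- from it.
  Solvable : ∀ {m n} → (Fin m → Vector n) → Set
  Solvable {m} w = ∀ (y : Vector m) → ∃ λ β → ∀ i → w i ∙ β ≡ y i

  -- A functional that is 1 on the new vector and 0 on the old ones corrects the new equation
  -- without disturbing the others.
  Solvable-cons : (w : Fin (suc m) → Vector n) → Solvable (w ∘ Fin.suc) → ¬ InSpan (w ∘ Fin.suc) (w Fin.zero) → Solvable w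
  Solvable-cons {m} w solve fresh y = extend (dual m (w ∘ Fin.suc) (w Fin.zero)) (solve (y ∘ Fin.suc))
    where
    extend : InSpan (w ∘ Fin.suc) (w Fin.zero) ⊎ Dual (w ∘ Fin.suc) (w Fin.zero) →
      (∃ λ β → ∀ i → w (Fin.suc i) ∙ β ≡ y (Fin.suc i)) → ∃ λ β → ∀ i → w i ∙ β ≡ y i
    extend (inj₁ p) _ = contradiction p fresh
    extend (inj₂ (γ , zeros , one)) (β , sols) = (β ⊹ a ⊛ γ) , sols′
     where
     open ≡-Reasoning
     x = w Fin.zero ∙ β
     a = y Fin.zero +F (-F x)
     sols′ : ∀ i → w i ∙ (β ⊹ a ⊛ γ) ≡ y i
     sols′ Fin.zero = begin
       w Fin.zero ∙ (β ⊹ a ⊛ γ)      ≡⟨ ∙-linearʳ (w Fin.zero) β a γ ⟩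
       x +F (a *F (w Fin.zero ∙ γ)) ≡⟨ cong (λ z → x +F (a *F z)) one ⟩
       x +F (a *F 1F)               ≡⟨ cong (x +F_) (*F-identityʳ a) ⟩
       x +F a                       ≡⟨ +F-comm x a ⟩
       a +F x                       ≡⟨ cancel (y Fin.zero) x ⟩
       y Fin.zero ∎
     sols′ (Fin.suc i) = begin
       w (Fin.suc i) ∙ (β ⊹ a ⊛ γ) ≡⟨ ∙-linearʳ (w (Fin.suc i)) β a γ ⟩
       (w (Fin.suc i) ∙ β) +F (a *F (w (Fin.suc i) ∙ γ)) ≡⟨ cong₂ (λ u v → u +F (a *F v)) (sols i) (zeros i) ⟩
       y (Fin.suc i) +F (a *F 0F) ≡⟨ cong (y (Fin.suc i) +F_) (*F-zeroʳ a) ⟩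
       y (Fin.suc i) +F 0F ≡⟨ +F-identityʳ _ ⟩
       y (Fin.suc i) ∎

-- Realising a matrix in a grid of cells with many distinct rows

module GridMinor (F : FiniteField) where
  open LinearAlgebra F
  open Solving F

  μ : Carrier
  μ = -F 1F

  μ-cancel : ∀ x → x +F (μ *F x) ≡ 0F
  μ-cancel x = trans (cong (x +F_) (trans (sym (-‿distribˡ-* 1F x)) (cong -F_ (*F-identityˡ x)))) (-F-inverseʳ x)

  μ-flip : ∀ x y → 0F +F (μ *F (x +F (μ *F y))) ≡ y +F (μ *F x)
  μ-flip x y = begin
    0F +F (μ *F (x +F (μ *F y))) ≡⟨ +F-identityˡ _ ⟩
    μ *F (x +F (μ *F y)) ≡⟨ *F-distribˡ μ x (μ *F y) ⟩
    (μ *F x) +F (μ *F (μ *F y)) ≡⟨ +F-comm _ _ ⟩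
    (μ *F (μ *F y)) +F (μ *F x) ≡⟨ cong (_+F (μ *F x)) μμ ⟩
    y +F (μ *F x) ∎
    where
    open ≡-Reasoning
    μμ : μ *F (μ *F y) ≡ y
    μμ = begin
      μ *F (μ *F y) ≡⟨ sym (+F-identityʳ _) ⟩
      (μ *F (μ *F y)) +F 0F ≡⟨ cong ((μ *F (μ *F y)) +F_) (sym (trans (+F-comm (μ *F y) y) (μ-cancel y))) ⟩
      (μ *F (μ *F y)) +F ((μ *F y) +F y) ≡⟨ sym (+F-assoc _ _ _) ⟩
      ((μ *F (μ *F y)) +F (μ *F y)) +F y ≡⟨ cong (_+F y) (trans (+F-comm _ _) (μ-cancel (μ *F y))) ⟩
      0F +F y ≡⟨ +F-identityˡ y ⟩
      y ∎

  μ-injective : ∀ x y z → x +F (μ *F z) ≡ y +F (μ *F z) → x ≡ y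
  μ-injective x y z eq = begin
    x                        ≡⟨ sym (undo x) ⟩
    (x +F (μ *F z)) +F z     ≡⟨ cong (_+F z) eq ⟩
    (y +F (μ *F z)) +F z     ≡⟨ undo y ⟩
    y ∎
    where
    open ≡-Reasoning
    undo : ∀ x → (x +F (μ *F z)) +F z ≡ x
    undo x = trans (+F-assoc x _ z) (trans (cong (x +F_) (trans (+F-comm _ z) (μ-cancel z))) (+F-identityʳ x))

  InSpan-flip : ∀ (w : Fin m → Vector n) u v → InSpan w (u ⊹ μ ⊛ v) → InSpan w (v ⊹ μ ⊛ u)
  InSpan-flip w u v p = InSpan-≗ w (λ c → μ-flip (u c) (v c)) (InSpan-⊹ w (λ _ → 0F) μ _ zeroSpan p)
    where
    zeroSpan : InSpan w (λ _ → 0F)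
    zeroSpan = (λ _ → 0F) , λ c → sym (sum-zero _ (λ i → *F-zeroˡ (w i c)))

  module _ {n₀} (h : Fin n → Fin n₀) where
    mask : Fin n₀ → Vector n → Vector n
    mask j v c = only (h c) j (v c)

    mask-≡ : ∀ {j c} v → h c ≡ j → mask j v c ≡ v c
    mask-≡ {j} {c} v eq = only-≡ (v c) eq

    Apart : ∀ {Q} → Fin n₀ → (Fin Q → Vector n) → Set
    Apart j X = ∀ u u′ → u ≢ u′ → ∃ λ c → h c ≡ j × X u c ≢ X u′ c

    -- On block `j` each coset of the span of `w` contains at most `q ^ t` of the vectors, as these
    -- are determined by a representative and `t` coefficients. So `Q` distinct vectors meet at
    -- least `T` cosets.
    spread : ∀ {Q t} T (w : Fin t → Vector n) j (X : Fin Q → Vector n) → Apart j X → T * q ^ t < Q →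
      Σ (Fin T → Fin Q) λ f → ∀ a b → a ≢ b → ¬ InSpan (mask j ∘ w) (mask j (X (f a)) ⊹ μ ⊛ mask j (X (f b)))
    spread {Q} {t} T w j X apart big
      with dichotomy {P = λ _ → ⊤} (λ _ → yes tt)
             (λ u u′ → InSpan? (mask j ∘ w) (mask j (X u) ⊹ μ ⊛ mask j (X u′)))
             (λ {u} {u′} → InSpan-flip (mask j ∘ w) (mask j (X u)) (mask j (X u′))) T
    ... | inj₁ (f , _ , far) = f , far
    ... | inj₂ (k , k<T , e , _ , cover) = contradiction (pigeonhole (≤-<-trans (*-monoˡ-≤ (q ^ t) (<⇒≤ k<T)) big) key) collision
      where
      key : Fin Q → Fin (k * q ^ t)
      key u = combine (proj₁ (cover u tt)) (funToFin (index ∘ proj₁ (proj₂ (cover u tt))))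
      collision : ¬ ∃₂ λ u u′ → u Fin.< u′ × key u ≡ key u′
      collision (u , u′ , u<u′ , eq) with cover u tt | cover u′ tt | combine-injective (proj₁ (cover u tt)) _ (proj₁ (cover u′ tt)) _ eq
      ... | r , l , span | .r , l′ , span′ | refl , eq′
        with c , hc , X≢ ← apart u u′ (λ p → <⇒≢ u<u′ (cong toℕ p)) = X≢ (begin
          X u c            ≡⟨ sym (mask-≡ (X u) hc) ⟩
          mask j (X u) c   ≡⟨ μ-injective _ _ (mask j (X (e r)) c) (trans (span c) (trans same (sym (span′ c)))) ⟩
          mask j (X u′) c  ≡⟨ mask-≡ (X u′) hc ⟩
          X u′ c ∎)
        where
        open ≡-Reasoning
        same : l ∙ (λ i → mask j (w i) c) ≡ l′ ∙ (λ i → mask j (w i) c)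
        same = sum-cong-≗ (λ i → cong (_*F mask j (w i) c) (index-injective (funToFin-injective (index ∘ l) (index ∘ l′) eq′ i)))

    total : ∀ {Q} → (Fin n₀ → Fin Q → Vector n) → (Fin n₀ → Fin Q) → Vector n
    total X φ c = sum (λ j → X j (φ j) c)

    mask-total : ∀ {Q} j (X : Fin n₀ → Fin Q → Vector n) φ → mask j (total X φ) ≗ total (λ j′ → mask j ∘ X j′) φ
    mask-total j X φ c with h c ≟ᶠ j
    ... | yes _ = refl
    ... | no _  = sym (sum-zero {n₀} (λ _ → 0F) (λ _ → refl))

    -- A row taken for one cell has entries in all column blocks, so the cells cannot be treated
    -- separately; the new vector is a sum of one row per cell. With the other choices fixed,
    -- changing the choice for cell `j` alters the sum on block `j` by a vector outside the span.
    -- Hence at most one of its `suc n₀` candidates is bad, which is the hypothesis of `avoid`.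
    fresh-choice : ∀ {Q t} (w : Fin t → Vector n) (X : Fin n₀ → Fin Q → Vector n) (f : Fin n₀ → Fin (suc n₀) → Fin Q) →
      (∀ j a b → a ≢ b → ¬ InSpan (mask j ∘ w) (mask j (X j (f j a)) ⊹ μ ⊛ mask j (X j (f j b)))) →
      Σ (Fin n₀ → Fin Q) λ φ → ∀ j → ¬ InSpan (mask j ∘ w) (mask j (total X φ))
    fresh-choice {Q} {t} w X f far = (λ j → f j (ψ j)) ,
        λ j p → good j (InSpan-≗ (mask j ∘ w) {mask j (total X (λ j → f j (ψ j)))} {Y j ψ} (mask-total j X (λ j′ → f j′ (ψ j′))) p)
      where
      Y : Fin n₀ → (Fin n₀ → Fin (suc n₀)) → Vector n
      Y j ψ = total (λ j′ u → mask j (X j′ u)) (λ j′ → f j′ (ψ j′))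
      Bad : Fin n₀ → (Fin n₀ → Fin (suc n₀)) → Set
      Bad j ψ = InSpan (mask j ∘ w) (Y j ψ)
      Bad? : ∀ j ψ → Dec (Bad j ψ)
      Bad? j ψ = InSpan? (mask j ∘ w) (Y j ψ)
      unique : ∀ j φ ψ → (∀ i → i ≢ j → φ i ≡ ψ i) → Bad j φ → Bad j ψ → φ j ≡ ψ j
      unique j φ ψ off bφ bψ = decidable-stable (φ j ≟ᶠ ψ j) λ ne →
        far j (φ j) (ψ j) ne (InSpan-≗ (mask j ∘ w) {Y j φ ⊹ μ ⊛ Y j ψ} {mask j (X j (f j (φ j))) ⊹ μ ⊛ mask j (X j (f j (ψ j)))} difference (InSpan-⊹ (mask j ∘ w) (Y j φ) μ (Y j ψ) bφ bψ))
        where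
        open ≡-Reasoning
        difference : (Y j φ ⊹ μ ⊛ Y j ψ) ≗ (mask j (X j (f j (φ j))) ⊹ μ ⊛ mask j (X j (f j (ψ j))))
        difference c = begin
          sum A +F (μ *F sum B) ≡⟨ cong (sum A +F_) (*-distribˡ-sum μ B) ⟩
          sum A +F sum (λ j′ → μ *F B j′) ≡⟨ sym (∑-distrib-+ A (λ j′ → μ *F B j′)) ⟩
          sum (λ j′ → A j′ +F (μ *F B j′)) ≡⟨ sum-single (λ j′ → A j′ +F (μ *F B j′)) j vanish ⟩
          A j +F (μ *F B j) ∎
          where
          A B : Vector n₀
          A j′ = mask j (X j′ (f j′ (φ j′))) c
          B j′ = mask j (X j′ (f j′ (ψ j′))) c
          vanish : ∀ j′ → j′ ≢ j → A j′ +F (μ *F B j′) ≡ 0F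
          vanish j′ ne = trans (cong (λ z → A j′ +F (μ *F mask j (X j′ (f j′ z)) c)) (sym (off j′ ne))) (μ-cancel (A j′))
      choice : Σ (Fin n₀ → Fin (suc n₀)) λ ψ → ∀ j → ¬ Bad j ψ
      choice = avoid n₀ (suc n₀) ≤-refl Bad Bad? unique
      ψ = proj₁ choice
      good = proj₂ choice

    fresh : ∀ {Q t} (w : Fin t → Vector n) (X : Fin n₀ → Fin Q → Vector n) → (∀ j → Apart j (X j)) →
      suc n₀ * q ^ t < Q → Σ (Fin n₀ → Fin Q) λ φ → ∀ j → ¬ InSpan (mask j ∘ w) (mask j (total X φ))
    fresh {Q} w X apart big = fresh-choice w X (proj₁ ∘ spreads) (proj₂ ∘ spreads)
      where
      spreads : ∀ j → Σ (Fin (suc n₀) → Fin Q) λ f → ∀ a b → a ≢ b → ¬ InSpan (mask j ∘ w) (mask j (X j (f a)) ⊹ μ ⊛ mask j (X j (f b)))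
      spreads j = spread (suc n₀) w j (X j) (apart j) big

    choose : ∀ {Q} t (X : Fin t → Fin n₀ → Fin Q → Vector n) → (∀ i j → Apart j (X i j)) →
      (∀ t′ → t′ < t → suc n₀ * q ^ t′ < Q) →
      Σ (Fin t → Fin n₀ → Fin Q) λ φ → ∀ j → Solvable (λ i → mask j (total (X i) (φ i)))
    choose zero X apart big = (λ ()) , λ j y → (λ _ → 0F) , λ ()
    choose {Q} (suc t) X apart big = (φ₀ ◂ φ) , solve′
      where
      rest : Σ (Fin t → Fin n₀ → Fin Q) λ φ → ∀ j → Solvable (λ i → mask j (total (X (Fin.suc i)) (φ i)))
      rest = choose t (λ i → X (Fin.suc i)) (λ i → apart (Fin.suc i)) (λ t′ lt′ → big t′ (m<n⇒m<1+n lt′))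
      φ : Fin t → Fin n₀ → Fin Q
      φ = proj₁ rest
      w : Fin t → Vector n
      w i = total (X (Fin.suc i)) (φ i)
      new : Σ (Fin n₀ → Fin Q) λ φ₀ → ∀ j → ¬ InSpan (λ i → mask j (w i)) (mask j (total (X Fin.zero) φ₀))
      new = fresh w (X Fin.zero) (apart Fin.zero) (big t ≤-refl)
      φ₀ : Fin n₀ → Fin Q
      φ₀ = proj₁ new
      solve′ : ∀ j → Solvable (λ i → mask j (total (X i) ((φ₀ ◂ φ) i)))
      solve′ j = Solvable-cons (λ i → mask j (total (X i) ((φ₀ ◂ φ) i))) (proj₂ rest j) (proj₂ new j)

  grid⇒minor : ∀ {m₀ n₀} Q → 0 < m₀ → 0 < n₀ → q < Q → 1 < Q → (∀ t → t < m₀ → suc n₀ * q ^ t < Q) →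
    (M : Mat Carrier m n) (g : Fin m → Fin m₀) (h : Fin n → Fin n₀) → Monotone g → Monotone h →
    (e : Fin m₀ → Fin n₀ → Fin Q → Fin m) → (∀ i j u → g (e i j u) ≡ i) →
    (∀ i j u u′ → u ≢ u′ → ∃ λ c → h c ≡ j × M (e i j u) c ≢ M (e i j u′) c) →
    (N : Mat Carrier m₀ n₀) → LinearMinor F N M
  grid⇒minor {m} {n} {m₀} {n₀} Q 0<m₀ 0<n₀ q<Q 1<Q big M g h g-mono h-mono e ge apart N
    with φ , solve ← choose h m₀ (λ i j u → M (e i j u)) apart big =
      LinearMinor-trans (LinearMinor-transpose columns) rows
    where
    chosen : Fin m₀ → Fin n₀ → Fin m
    chosen i j = e i j (φ i j)
    v : Fin m₀ → Vector n
    v i = total h (λ j u → M (e i j u)) (φ i)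
    α : Fin m → Carrier
    -- The number of times row `x` is chosen, as a field element: several cells of a row block may
    -- choose the same row.
    α x = sum (λ j → only (chosen (g x) j) x 1F)
    rows-formula : ∀ i c → v i c ≡ comb g α (λ x → M x c) i
    rows-formula i c = sym (begin
      sum (λ x → only (g x) i (α x *F M x c)) ≡⟨ sum-cong-≗ term ⟩
      sum (λ x → sum (λ j → only (chosen i j) x (M x c))) ≡⟨ sum-comm (λ x j → only (chosen i j) x (M x c)) ⟩
      sum (λ j → sum (λ x → only (chosen i j) x (M x c)))
        ≡⟨ sum-cong-≗ (λ j → trans (sum-single (λ x → only (chosen i j) x (M x c)) (chosen i j) (λ x ne → only-≢ _ (ne ∘ sym))) (only-≡ {i = chosen i j} _ refl)) ⟩
      v i c ∎)
      where
      open ≡-Reasoning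
      term : ∀ x → only (g x) i (α x *F M x c) ≡ sum (λ j → only (chosen i j) x (M x c))
      term x with g x ≟ᶠ i
      ... | no ne = sym (sum-zero _ (λ j → only-≢ _ (λ p → ne (trans (cong g (sym p)) (ge i j (φ i j))))))
      ... | yes refl = trans (*-distribʳ-sum (M x c) (λ j → only (chosen (g x) j) x 1F)) (sum-cong-≗ scale)
        where
        scale : ∀ j → only (chosen (g x) j) x 1F *F M x c ≡ only (chosen (g x) j) x (M x c)
        scale j with chosen (g x) j ≟ᶠ x
        ... | yes _ = *F-identityˡ (M x c)
        ... | no _  = *F-zeroˡ (M x c)
    i₀ : Fin m₀
    i₀ = fromℕ< 0<m₀
    j₀ : Fin n₀
    j₀ = fromℕ< 0<n₀
    u₀ u₁ : Fin Q
    u₀ = fromℕ< (<⇒≤ 1<Q)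
    u₁ = fromℕ< 1<Q
    u₀≢u₁ : u₀ ≢ u₁
    u₀≢u₁ p = <⇒≢ (s≤s z≤n) (trans (sym (toℕ-fromℕ< (<⇒≤ 1<Q))) (trans (cong toℕ p) (toℕ-fromℕ< 1<Q)))
    row-pair : ∀ x → ∃ λ y → y ≢ x × g y ≡ g x
    row-pair x with e (g x) j₀ u₀ ≟ᶠ x
    ... | no ne = e (g x) j₀ u₀ , ne , ge _ _ _
    ... | yes p with c , _ , ne ← apart (g x) j₀ u₀ u₁ u₀≢u₁ =
      e (g x) j₀ u₁ , (λ p′ → ne (cong (λ z → M z c) (trans p (sym p′)))) , ge _ _ _
    rows : LinearMinor F v M
    rows = combine-rows m M g α g-mono (λ r → e r j₀ u₀ , ge r j₀ u₀) (inj₂ ∘ row-pair) v rows-formula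
    β : Vector n
    β c = proj₁ (solve (h c) (λ i → N i (h c))) c
    columns-formula : ∀ j i → N i j ≡ comb h β (v i) j
    columns-formula j i = sym (trans (sum-cong-≗ term) (proj₂ (solve j (λ i → N i j)) i))
      where
      term : ∀ c → only (h c) j (β c *F v i c) ≡ mask h j (v i) c *F proj₁ (solve j (λ i → N i j)) c
      term c with h c ≟ᶠ j
      ... | yes refl = *F-comm _ _
      ... | no _ = sym (*F-zeroˡ (proj₁ (solve j (λ i → N i j)) c))
    -- Rescaling a column requires a partner in its block. Of more than `q` rows two agree in column
    -- `c`; being distinct on the block, they differ in another column of it.
    column-pair : ∀ c → ∃ λ d → d ≢ c × h d ≡ h c
    column-pair c with u , u′ , u<u′ , eq ← pigeonhole q<Q (λ u → index (M (e i₀ (h c) u) c))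
      with d , hd , ne ← apart i₀ (h c) u u′ (λ p → <⇒≢ u<u′ (cong toℕ p))
      = d , (λ { refl → ne (index-injective eq) }) , hd
    columns : LinearMinor F (flip N) (flip v)
    columns = combine-rows n (flip v) h β h-mono
      (λ j → proj₁ (apart i₀ j u₀ u₁ u₀≢u₁) , proj₁ (proj₂ (apart i₀ j u₀ u₁ u₀≢u₁)))
      (inj₂ ∘ column-pair) (flip N) columns-formula

-- Contraction sequences from towers of equivalences

mergeParts : ∀ {k} (x y : Fin (suc k)) → y ≢ x → Fin (suc k) → Fin k
mergeParts x y y≢x z with y ≟ᶠ z
... | yes _   = punchOut y≢x
... | no  y≢z = punchOut y≢z

mergeParts-punchIn : ∀ {k} (x y : Fin (suc k)) (y≢x : y ≢ x) w → mergeParts x y y≢x (punchIn y w) ≡ w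
mergeParts-punchIn x y y≢x w with y ≟ᶠ punchIn y w
... | yes p   = contradiction (sym p) (punchInᵢ≢i y w)
... | no  y≢z = punchOut-punchIn y

mergeParts-kernel : ∀ {k} (x y : Fin (suc k)) (y≢x : y ≢ x) z z′ → mergeParts x y y≢x z ≡ mergeParts x y y≢x z′ →
  z ≡ z′ ⊎ (z ≡ x × z′ ≡ y) ⊎ (z ≡ y × z′ ≡ x)
mergeParts-kernel x y y≢x z z′ eq with y ≟ᶠ z | y ≟ᶠ z′
... | yes p  | yes p′ = inj₁ (trans (sym p) p′)
... | yes p  | no ne′ = inj₂ (inj₂ (sym p , sym (punchOut-injective y≢x ne′ eq)))
... | no ne  | yes p′ = inj₂ (inj₁ (punchOut-injective ne y≢x eq , sym p′))
... | no ne  | no ne′ = inj₁ (punchOut-injective ne ne′ eq)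

record DecEquivalence (A : Set) : Set₁ where
  field
    _≈_   : A → A → Set
    _≈?_  : ∀ u v → Dec (u ≈ v)
    ≈-refl  : ∀ {u} → u ≈ u
    ≈-sym   : ∀ {u v} → u ≈ v → v ≈ u
    ≈-trans : ∀ {u v w} → u ≈ v → v ≈ w → u ≈ w

module Contraction (S : Structure) (d : ℕ) where
  open Structure S using (size)

  data Chain : ∀ k → (Fin size → Fin (suc k)) → Set where
    stop : ∀ {p} → Surj S p → RedDegreeAtMost S d p → Chain 0 p
    step : ∀ {k p} → Surj S p → RedDegreeAtMost S d p →
           (f : Fin (suc (suc k)) → Fin (suc k)) → Surj S f → Chain k (f ∘ p) → Chain (suc k) p

  part : ∀ {k p} → Chain k p → ∀ j → Fin size → Fin (suc j)
  part {k} {p} c j with j ≟ k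
  part {k} {p} c j | yes refl = p
  -- Reached only for `j` beyond the length of the chain, where the values are irrelevant.
  part (stop _ _) j | no _ = λ _ → Fin.zero
  part (step _ _ _ _ c) j | no _ = part c j

  part-top : ∀ {k p} (c : Chain k p) → part c k ≡ p
  part-top {k} c with k ≟ k
  ... | yes refl = refl
  ... | no ne    = contradiction refl ne

  part-surjective : ∀ {k p} (c : Chain k p) j → j ≤ k → Surj S (part c j)
  part-surjective {k} c j j≤k with j ≟ k
  part-surjective (stop s _) j j≤k | yes refl = s
  part-surjective (step s _ _ _ _) j j≤k | yes refl = s
  part-surjective (stop _ _) .zero z≤n | no ne = contradiction refl ne
  part-surjective (step _ _ _ _ c) j j≤k | no ne = part-surjective c j (s≤s⁻¹ (≤∧≢⇒< j≤k ne))

  part-degree : ∀ {k p} (c : Chain k p) j → j ≤ k → RedDegreeAtMost S d (part c j)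
  part-degree {k} c j j≤k with j ≟ k
  part-degree (stop _ r) j j≤k | yes refl = r
  part-degree (step _ r _ _ _) j j≤k | yes refl = r
  part-degree (stop _ _) .zero z≤n | no ne = contradiction refl ne
  part-degree (step _ _ _ _ c) j j≤k | no ne = part-degree c j (s≤s⁻¹ (≤∧≢⇒< j≤k ne))

  part-merge : ∀ {k p} (c : Chain k p) j → suc j ≤ k →
    Σ (Fin (suc (suc j)) → Fin (suc j)) λ f → Surj S f × (∀ u → part c j u ≡ f (part c (suc j) u))
  part-merge {k} c j j<k with suc j ≟ k | j ≟ k
  part-merge (step _ _ f s c) j j<k | yes refl | no _ = f , s , λ u → cong (λ h → h u) (part-top c)
  part-merge c j j<k | yes refl | yes ()
  part-merge c j j<k | no _ | yes refl = contradiction j<k (<-irrefl refl)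
  part-merge (step _ _ _ _ c) j j<k | no ne | no _ = part-merge c j (s≤s⁻¹ (≤∧≢⇒< j<k ne))

  open DecEquivalence

  -- All intermediate partitions are covered, so on the way from `R` to `R′` parts may be merged
  -- pair by pair in any order.
  Sandwich : (R R′ : DecEquivalence (Fin size)) → Set
  Sandwich R R′ = ∀ {k} (p : Fin size → Fin (suc k)) → Surj S p →
    (∀ {u v} → _≈_ R u v → p u ≡ p v) → (∀ {u v} → p u ≡ p v → _≈_ R′ u v) → RedDegreeAtMost S d p

  data Tower (R : DecEquivalence (Fin size)) : Set₁ where
    last : (∀ u v → _≈_ R u v) → Tower R
    next : (R′ : DecEquivalence (Fin size)) → (∀ {u v} → _≈_ R u v → _≈_ R′ u v) →
           Sandwich R R′ → Tower R′ → Tower R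

  -- Merge two parts inside one class of `R′` as long as there are any. When none are left, `p` is
  -- the partition into these classes, and `continue` takes over.
  reach : ∀ {R R′} → Sandwich R R′ →
    (∀ k p → Surj S p → (∀ {u v} → p u ≡ p v → _≈_ R′ u v) → (∀ {u v} → _≈_ R′ u v → p u ≡ p v) → Chain k p) →
    ∀ k p → Surj S p → (∀ {u v} → _≈_ R u v → p u ≡ p v) → (∀ {u v} → p u ≡ p v → _≈_ R′ u v) → Chain k p
  reach {R} {R′} degree continue k p surj below above
    with any? (λ x → any? (λ y → ¬? (y ≟ᶠ x) ×-dec _≈?_ R′ (proj₁ (surj x)) (proj₁ (surj y))))
  ... | no none = continue k p surj above exact
    where
    exact : ∀ {u v} → _≈_ R′ u v → p u ≡ p v
    exact {u} {v} u≈v = decidable-stable (p u ≟ᶠ p v) λ ne → none (p u , p v , ne ∘ sym ,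
      ≈-trans R′ (above (proj₂ (surj (p u)))) (≈-trans R′ u≈v (≈-sym R′ (above (proj₂ (surj (p v)))))))
  reach degree continue zero p surj below above | yes (Fin.zero , Fin.zero , ne , _) = contradiction refl ne
  reach {R} {R′} degree continue (suc k) p surj below above | yes (x , y , y≢x , x≈y) =
    step surj (degree p surj below above) f f-surj (reach {R} {R′} degree continue k (f ∘ p) p′-surj (cong f ∘ below) above′)
    where
    f = mergeParts x y y≢x
    f-surj : Surj S f
    f-surj w = punchIn y w , mergeParts-punchIn x y y≢x w
    p′-surj : Surj S (f ∘ p)
    p′-surj w with u , pu ← surj (punchIn y w) = u , trans (cong f pu) (mergeParts-punchIn x y y≢x w)
    rep : ∀ {u z} → p u ≡ z → _≈_ R′ u (proj₁ (surj z))
    rep {u} {z} eq = above (trans eq (sym (proj₂ (surj z))))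
    above′ : ∀ {u v} → f (p u) ≡ f (p v) → _≈_ R′ u v
    above′ {u} {v} eq with mergeParts-kernel x y y≢x (p u) (p v) eq
    ... | inj₁ pp = above pp
    ... | inj₂ (inj₁ (px , py)) = ≈-trans R′ (rep px) (≈-trans R′ x≈y (≈-sym R′ (rep py)))
    ... | inj₂ (inj₂ (py , px)) = ≈-trans R′ (rep py) (≈-trans R′ (≈-sym R′ x≈y) (≈-sym R′ (rep px)))

  tower⇒chain : ∀ {R} → Tower R → ∀ k p → Surj S p →
    (∀ {u v} → p u ≡ p v → _≈_ R u v) → (∀ {u v} → _≈_ R u v → p u ≡ p v) → Chain k p
  tower⇒chain (last total) zero p surj above below = stop surj λ
    { Fin.zero → [] , z≤n , λ { Fin.zero (ne , _) → contradiction refl ne } }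
  tower⇒chain (last total) (suc k) p surj above below
    with u , pu ← surj Fin.zero | v , pv ← surj (Fin.suc Fin.zero)
    with () ← trans (sym pu) (trans (below (total u v)) pv)
  tower⇒chain {R} (next R′ ⊆R′ degree tower) k p surj above below =
    reach {R} {R′} degree (tower⇒chain tower) k p surj below (⊆R′ ∘ above)

open DecEquivalence

tower⇒twinWidth : ∀ (S : Structure) d (R : DecEquivalence (Fin (Structure.size S))) →
  (∀ {u v} → _≈_ R u v → u ≡ v) → Contraction.Tower S d R → TwinWidthAtMost S d
tower⇒twinWidth S@record { size = zero } d R exact tower =
  record { part = λ k () ; nonempty = λ k () ; finest = λ k () ; merge = λ k () } , λ k ()
tower⇒twinWidth S@record { size = suc n } d R exact tower =
  record
    { part     = part chain
    ; nonempty = λ k k≤ → part-surjective chain k (s≤s⁻¹ k≤)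
    ; finest   = λ { k refl u v eq → trans (sym (cong (λ h → h u) (part-top chain))) (trans eq (cong (λ h → h v) (part-top chain))) }
    ; merge    = λ k k≤ → part-merge chain k (s≤s⁻¹ k≤)
    } , λ k k≤ → part-degree chain k (s≤s⁻¹ k≤)
  where
  open Contraction S d
  chain : Chain n id
  chain = tower⇒chain tower n id (λ y → y , refl) (λ { refl → ≈-refl R }) exact

-- Divisions with few distinct rows or with rich grids

first : {P : ℕ → Set} → (∀ d → Dec (P d)) → ∀ D →
  (∀ d → d ≤ D → ¬ P d) ⊎ (∃ λ d → d ≤ D × P d × ∀ d′ → d′ < d → ¬ P d′)
first P? D with P? 0
... | yes p = inj₂ (0 , z≤n , p , λ _ ())
first P? zero | no ¬p = inj₁ λ { .zero z≤n → ¬p }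
first {P} P? (suc D) | no ¬p with first (P? ∘ suc) D
... | inj₁ none = inj₁ λ { zero _ → ¬p ; (suc d) (s≤s d≤) → none d d≤ }
... | inj₂ (d , d≤ , p , below) = inj₂ (suc d , s≤s d≤ , p , λ { zero _ → ¬p ; (suc d′) (s≤s lt′) → below d′ lt′ })

find-below : ∀ h {G W : ℕ → Set} → (∀ a → G a ⊎ W a) → (∃ λ a → a < h × G a) ⊎ (∀ a → a < h → W a)
find-below zero    f = inj₂ (λ _ ())
find-below (suc h) f with find-below h f | f h
... | inj₁ (a , a<h , g) | _ = inj₁ (a , m<n⇒m<1+n a<h , g)
... | inj₂ _ | inj₁ g = inj₁ (h , ≤-refl , g)
... | inj₂ ws | inj₂ w = inj₂ (λ a a<sh → [ (λ a<h → ws a a<h) , (λ { refl → w }) ]′ (m≤n⇒m<n∨m≡n (s≤s⁻¹ a<sh)))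

∑-extend : ∀ {h n} f → h ≤ n → ∑ h f ≤ ∑ n f
∑-extend {h} {n} f h≤n with k , refl ← m≤n⇒∃[o]m+o≡n h≤n =
  subst (∑ h f ≤_) (sym (∑-+-split h k f)) (m≤m+n _ _)

power-between : ∀ s → 2 ≤ s → ∀ r → 1 ≤ r → ∃ λ e → r ≤ s ^ e × s ^ e ≤ s * r
power-between s 2≤s (suc zero) _ = 0 , ≤-refl , subst (1 ≤_) (sym (*-identityʳ s)) (≤-trans (s≤s z≤n) 2≤s)
power-between s 2≤s (suc (suc r)) _ with e , lo , hi ← power-between s 2≤s (suc r) (s≤s z≤n)
  with suc (suc r) ≤? s ^ e
... | yes p = e , p , ≤-trans hi (*-monoʳ-≤ s (n≤1+n _))
... | no ¬p with eq ← ≤-antisym (s≤s⁻¹ (≰⇒> ¬p)) lo =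
  suc e , subst (λ z → suc (suc r) ≤ s * z) (sym eq)
            (≤-trans (subst (suc (suc r) ≤_) (cong (suc r +_) (sym (+-identityʳ (suc r)))) (s≤s (m≤n+m (suc r) r)))
                     (*-monoˡ-≤ (suc r) 2≤s)) ,
          *-monoʳ-≤ s (subst (_≤ suc (suc r)) (sym eq) (n≤1+n _))

half-bounds : ∀ r → 2 ≤ r → 1 ≤ ⌊ r /2⌋ × r ≤ 3 * ⌊ r /2⌋
half-bounds (suc zero) (s≤s ())
half-bounds (suc (suc zero)) _ = ≤-refl , s≤s (s≤s z≤n)
half-bounds (suc (suc (suc zero))) _ = ≤-refl , ≤-refl
half-bounds (suc (suc (suc (suc r)))) _ with _ , le ← half-bounds (suc (suc r)) (s≤s (s≤s z≤n)) =
  s≤s z≤n , subst (suc (suc (suc (suc r))) ≤_) (sym (*-suc 3 ⌊ suc (suc r) /2⌋)) (≤-trans (n≤1+n _) (+-monoʳ-≤ 3 le))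

half< : ∀ r a → a < ⌊ r /2⌋ → suc (2 * a) < r
half< (suc (suc r)) zero    _ = s≤s (s≤s z≤n)
half< (suc (suc r)) (suc a) (s≤s a<) = subst (λ z → suc z < suc (suc r)) (sym (*-suc 2 a)) (s≤s (s≤s (half< r a a<)))

-- Cell 0 includes everything before `p 1` and cell `l` everything from `p l` on. The block maps of
-- a linear minor are defined on all rows and columns, so the grid is extended to a division of all
-- of them.
cellOf : (ℕ → ℕ) → ℕ → ℕ → ℕ
cellOf p zero    x = 0
cellOf p (suc l) x with p (suc l) ≤? x
... | yes _ = suc l
... | no  _ = cellOf p l x

cellOf≤ : ∀ p l x → cellOf p l x ≤ l
cellOf≤ p zero    x = z≤n
cellOf≤ p (suc l) x with p (suc l) ≤? x
... | yes _ = ≤-refl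
... | no  _ = m≤n⇒m≤1+n (cellOf≤ p l x)

cellOf-mono : ∀ p l {x y} → x ≤ y → cellOf p l x ≤ cellOf p l y
cellOf-mono p zero    x≤y = z≤n
cellOf-mono p (suc l) {x} {y} x≤y with p (suc l) ≤? x | p (suc l) ≤? y
... | yes _ | yes _ = ≤-refl
... | yes a | no b  = contradiction (≤-trans a x≤y) b
... | no _  | yes _ = m≤n⇒m≤1+n (cellOf≤ p l x)
... | no _  | no _  = cellOf-mono p l x≤y

cuts-mono : ∀ (p : ℕ → ℕ) k → (∀ i → i < k → p i ≤ p (suc i)) → ∀ i j → i ≤ j → j ≤ k → p i ≤ p j
cuts-mono p k inc i zero z≤n _ = ≤-refl
cuts-mono p k inc i (suc j) i≤j j≤k with m≤n⇒m<n∨m≡n i≤j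
... | inj₂ refl = ≤-refl
... | inj₁ i<sj = ≤-trans (cuts-mono p k inc i j (s≤s⁻¹ i<sj) (<⇒≤ j≤k)) (inc j j≤k)

cellOf-≡ : ∀ p k → (∀ i → i < k → p i ≤ p (suc i)) → ∀ l i x → i ≤ l → l < k → p i ≤ x → x < p (suc i) → cellOf p l x ≡ i
cellOf-≡ p k inc zero zero x z≤n l<k pi xi = refl
cellOf-≡ p k inc (suc l) i x i≤l l<k pi xi with p (suc l) ≤? x | m≤n⇒m<n∨m≡n i≤l
... | yes le | inj₂ refl = refl
... | yes le | inj₁ i<sl = contradiction (<-≤-trans xi (cuts-mono p k inc (suc i) (suc l) i<sl (<⇒≤ l<k))) (≤⇒≯ le)
... | no nle | inj₂ refl = contradiction pi nle
... | no nle | inj₁ i<sl = cellOf-≡ p k inc l i x (s≤s⁻¹ i<sl) (<⇒≤ l<k) pi xi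

module Rows (F : FiniteField) where
  open LinearAlgebra F
  open GridMinor F

  ManyRows : ℕ → Mat Carrier m n → (Fin m → Set) → (Fin n → Set) → Set
  ManyRows {m} {n} Q M A D = Σ (Fin Q → Fin m) λ e → (∀ u → A (e u)) ×
    (∀ u v → u ≢ v → ∃ λ c → D c × M (e u) c ≢ M (e v) c)

  FewRows : ℕ → Mat Carrier m n → (Fin m → Set) → (Fin n → Set) → Set
  FewRows {m} {n} Q M A D = Σ ℕ λ k → k < Q × Σ (Fin k → Fin m) λ e → (∀ u → A (e u)) ×
    (∀ x → A x → ∃ λ u → ∀ c → D c → M x c ≡ M (e u) c)

  -- A bound on the number of distinct rows stated as a colouring, because colourings for two sets
  -- of columns combine to pairs of colours for their union.
  Classes : ℕ → Mat Carrier m n → (Fin m → Set) → (Fin n → Set) → Set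
  Classes {m} {n} K M A D = Σ (∀ x → A x → Fin K) λ f →
    ∀ x y (a : A x) (b : A y) → f x a ≡ f y b → ∀ c → D c → M x c ≡ M y c

  many-or-few : ∀ Q (M : Mat Carrier m n) {A D} → (∀ x → Dec (A x)) → (∀ c → Dec (D c)) →
    ManyRows Q M A D ⊎ FewRows Q M A D
  many-or-few Q M {A} {D} A? D? with dichotomy A? {R = λ x y → ∀ c → D c → M x c ≡ M y c}
       (λ x y → map′ (λ f c d → f c d) (λ f c d → f c d) (all? (λ c → implies? (D? c) (M x c ≟F M y c))))
       (λ eq c d → sym (eq c d)) Q
    where
    implies? : ∀ {P R : Set} → Dec P → Dec R → Dec (P → R)
    implies? (no ¬p) _ = yes (λ p → contradiction p ¬p)
    implies? (yes p) (yes r) = yes (λ _ → r)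
    implies? (yes p) (no ¬r) = no (λ f → ¬r (f p))
  ... | inj₂ few = inj₂ few
  ... | inj₁ (e , Ae , apart) = inj₁ (e , Ae , separate)
    where
    separate : ∀ u v → u ≢ v → ∃ λ c → D c × M (e u) c ≢ M (e v) c
    separate u v u≢v with any? (λ c → D? c ×-dec ¬? (M (e u) c ≟F M (e v) c))
    ... | yes p = p
    ... | no none = contradiction (λ c d → decidable-stable (M (e u) c ≟F M (e v) c) (λ ne → none (c , d , ne))) (apart u v u≢v)

  few⇒classes : ∀ {Q} {M : Mat Carrier m n} {A D} → FewRows Q M A D → Classes Q M A D
  few⇒classes {M = M} {A} {D} (k , k<Q , e , Ae , cover) =
    (λ x a → Fin.inject≤ (proj₁ (cover x a)) (<⇒≤ k<Q)) , λ x y a b eq c d →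
      trans (proj₂ (cover x a) c d) (trans (cong (λ z → M (e z) c) (inject≤-injective _ _ _ _ eq)) (sym (proj₂ (cover y b) c d)))

  classes⇒¬many : ∀ {Q K} {M : Mat Carrier m n} {A D} → K < Q → Classes K M A D → ¬ ManyRows Q M A D
  classes⇒¬many K<Q (f , same) (e , Ae , apart)
    with u , v , u<v , eq ← pigeonhole K<Q (λ u → f (e u) (Ae u))
    with c , d , ne ← apart u v (λ p → <⇒≢ u<v (cong toℕ p)) = ne (same _ _ _ _ eq c d)

  few⇒¬many : ∀ {Q} {M : Mat Carrier m n} {A D} → FewRows Q M A D → ¬ ManyRows Q M A D
  few⇒¬many {M = M} (k , k<Q , e , _ , cover) = classes⇒¬many k<Q ((λ x a → proj₁ (cover x a)) , λ x y a b eq c d →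
    trans (proj₂ (cover x a) c d) (trans (cong (λ z → M (e z) c) eq) (sym (proj₂ (cover y b) c d))))

  many? : ∀ Q (M : Mat Carrier m n) {A D} → (∀ x → Dec (A x)) → (∀ c → Dec (D c)) → Dec (ManyRows Q M A D)
  many? Q M A? D? with many-or-few Q M A? D?
  ... | inj₁ many = yes many
  ... | inj₂ few  = no (few⇒¬many few)

  ¬many⇒few : ∀ Q (M : Mat Carrier m n) {A D} → (∀ x → Dec (A x)) → (∀ c → Dec (D c)) → ¬ ManyRows Q M A D → FewRows Q M A D
  ¬many⇒few Q M A? D? ¬many with many-or-few Q M A? D?
  ... | inj₁ many = contradiction many ¬many
  ... | inj₂ few  = few

  classes⇒few : ∀ {K} {M : Mat Carrier m n} {A D} → (∀ x → Dec (A x)) → (∀ c → Dec (D c)) →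
    Classes K M A D → FewRows (suc K) M A D
  classes⇒few {K = K} {M} A? D? cl = ¬many⇒few (suc K) M A? D? (classes⇒¬many ≤-refl cl)

  many-mono : ∀ {Q} {M : Mat Carrier m n} {A A′ D D′} → (∀ {x} → A x → A′ x) → (∀ {c} → D c → D′ c) →
    ManyRows Q M A D → ManyRows Q M A′ D′
  many-mono sub sub′ (e , Ae , apart) = e , sub ∘ Ae , λ u v ne → map₂ (map₁ sub′) (apart u v ne)

  classes-mono : ∀ {K} {M : Mat Carrier m n} {A A′ D D′} → (∀ {x} → A′ x → A x) → (∀ {c} → D′ c → D c) →
    Classes K M A D → Classes K M A′ D′
  classes-mono sub sub′ (f , same) = (λ x a → f x (sub a)) , λ x y a b eq c d → same x y _ _ eq c (sub′ d)

  classes-widen : ∀ {K L} {M : Mat Carrier m n} {A D} → K ≤ L → Classes K M A D → Classes L M A D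
  classes-widen K≤L (f , same) = (λ x a → Fin.inject≤ (f x a) K≤L) , λ x y a b eq → same x y a b (inject≤-injective _ _ _ _ eq)

  classes-× : ∀ {K L} {M : Mat Carrier m n} {A D₁ D₂ D} → (∀ {c} → D c → D₁ c ⊎ D₂ c) →
    Classes K M A D₁ → Classes L M A D₂ → Classes (K * L) M A D
  classes-× {A = A} split (f , same) (g , same′) = (λ x a → combine (f x a) (g x a)) , λ x y a b eq c d →
    [ same x y a b (proj₁ (combine-injective (f x a) _ (f y b) _ eq)) c
    , same′ x y a b (proj₂ (combine-injective (f x a) _ (f y b) _ eq)) c ]′ (split d)

  -- The invariant of the merging. Its use is `complex⇒∈`: when `A` is a row part, only the parts
  -- listed in `Y` can form a complex block with it.
  Good : ℕ → ℕ → Mat Carrier m n → (Fin m → Set) → (Fin n → ℕ) → Set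
  Good t K M A κ = Σ (List ℕ) λ Y → length Y ≤ t × Classes K M A (λ c → κ c ∉ Y)

  CutPoints : ℕ → ℕ → Mat Carrier m n → (Fin m → Set) → (Fin n → ℕ) → ℕ → ℕ → Set
  CutPoints Q t M A κ C x = Σ (ℕ → Bool) λ P → (∀ b → P b ≡ true → x ≤ b × b < C) × t ≤ count C P ×
    (∀ a b → a < b → P a ≡ true → P b ≡ true → ManyRows Q M A (λ c → a ≤ κ c × κ c < b))

  -- Cut the columns greedily: as soon as the current interval of column parts has Q distinct
  -- rows, close it and throw its last part into Y; what remains of each interval has few rows.
  scan : ∀ Q → 2 ≤ Q → (M : Mat Carrier m n) {A : Fin m → Set} → (∀ x → Dec (A x)) → (κ : Fin n → ℕ) →
    ∀ C → (∀ c → κ c < C) → ∀ t x → x ≤ C →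
    CutPoints Q t M A κ C x ⊎
    (Σ (List ℕ) λ Y → length Y ≤ t × Classes (Q ^ suc t) M A (λ c → x ≤ κ c × κ c ∉ Y))
  scan Q 2≤Q M A? κ C κ<C zero x x≤C = inj₁ ((λ _ → false) , (λ _ ()) , z≤n , λ _ _ _ ())
  scan {m} {n} Q 2≤Q M {A} A? κ C κ<C (suc t) x x≤C with first Interval? (C ∸ x)
    where
    Interval : ℕ → Set
    Interval d = ManyRows Q M A (λ c → x ≤ κ c × κ c < x + d)
    Interval? : ∀ d → Dec (Interval d)
    Interval? d = many? Q M A? (λ c → (x ≤? κ c) ×-dec (κ c <? x + d))
  ... | inj₁ none = inj₂ ([] , z≤n , classes-widen widen (classes-mono id (λ {c} d → proj₁ d , subst (κ c <_) (sym (m+[n∸m]≡n x≤C)) (κ<C c)) (few⇒classes few)))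
    where
    widen : Q ≤ Q ^ suc (suc t)
    widen = subst (_≤ Q ^ suc (suc t)) (*-identityʳ Q) (*-monoʳ-≤ Q (m^n>0 Q {{>-nonZero (≤-trans (s≤s z≤n) 2≤Q)}} (suc t)))
    few : FewRows Q M A (λ c → x ≤ κ c × κ c < x + (C ∸ x))
    few = ¬many⇒few Q M A? (λ c → (x ≤? κ c) ×-dec (κ c <? x + (C ∸ x))) (none _ ≤-refl)
  ... | inj₂ (zero , _ , (e , _ , apart) , _) = contradiction (apart u₀ u₁ u₀≢u₁)
          (λ { (c , (x≤ , <x) , _) → <-irrefl refl (≤-<-trans x≤ (subst (κ c <_) (+-identityʳ x) <x)) })
    where
    u₀ u₁ : Fin Q
    u₀ = fromℕ< (<⇒≤ 2≤Q)
    u₁ = fromℕ< 2≤Q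
    u₀≢u₁ : u₀ ≢ u₁
    u₀≢u₁ p = <⇒≢ (s≤s z≤n) (trans (sym (toℕ-fromℕ< (<⇒≤ 2≤Q))) (trans (cong toℕ p) (toℕ-fromℕ< 2≤Q)))
  ... | inj₂ (suc d , d≤ , many , below) with scan Q 2≤Q M A? κ C κ<C t (suc z) z<C
    where
    z = x + d
    z<C : suc z ≤ C
    z<C = subst₂ _≤_ (+-suc x d) (m+[n∸m]≡n x≤C) (+-monoʳ-≤ x d≤)
  ...   | inj₂ (Y , lenY , cl) = inj₂ (z ∷ Y , s≤s lenY , classes-× split (few⇒classes few) cl)
    where
    z = x + d
    few : FewRows Q M A (λ c → x ≤ κ c × κ c < z)
    few = ¬many⇒few Q M A? (λ c → (x ≤? κ c) ×-dec (κ c <? z)) (below d ≤-refl)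
    split : ∀ {c} → x ≤ κ c × κ c ∉ z ∷ Y → (x ≤ κ c × κ c < z) ⊎ (suc z ≤ κ c × κ c ∉ Y)
    split {c} (x≤ , ∉) with <-cmp (κ c) z
    ... | tri< p _ _ = inj₁ (x≤ , p)
    ... | tri≈ _ p _ = contradiction (here p) ∉
    ... | tri> _ _ p = inj₂ (p , ∉ ∘ there)
  ...   | inj₁ (P , P-range , t≤ , rich) = inj₁ (P′ , range′ , count′ , rich′)
    where
    z = x + d
    z<C : suc z ≤ C
    z<C = subst₂ _≤_ (+-suc x d) (m+[n∸m]≡n x≤C) (+-monoʳ-≤ x d≤)
    x<C : x < C
    x<C = ≤-trans (s≤s (m≤m+n x d)) z<C
    P′ : ℕ → Bool
    -- The new cut point is the left end of the interval, which is rich up to `suc z`. All later cut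
    -- points lie from there on, so `x` bounds a rich interval with each of them.
    P′ b = (b ≡ᵇ x) ∨ P b
    P′-case : ∀ b → P′ b ≡ true → b ≡ x ⊎ P b ≡ true
    P′-case b eq with b ≡ᵇ x in eq′
    ... | true  = inj₁ (≡ᵇ-true b x eq′)
    ... | false = inj₂ eq
    range′ : ∀ b → P′ b ≡ true → x ≤ b × b < C
    range′ b eq with P′-case b eq
    ... | inj₁ refl = ≤-refl , x<C
    ... | inj₂ Pb with lo , hi ← P-range b Pb = ≤-trans (m≤m+n x d) (≤-trans (n≤1+n z) lo) , hi
    count′ : suc t ≤ count C P′
    count′ = begin
      suc t ≤⟨ +-mono-≤ (≤-trans (≤-reflexive (sym (cong bit (≡ᵇ-refl x)))) (∑-hit C (λ b → bit (b ≡ᵇ x)) x x<C)) t≤ ⟩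
      count C (λ b → b ≡ᵇ x) + count C P ≡⟨ sym (∑-+ C _ _) ⟩
      ∑ C (λ b → bit (b ≡ᵇ x) + bit (P b)) ≤⟨ ∑-mono C disjoint ⟩
      count C P′ ∎
      where
      open ≤-Reasoning
      disjoint : ∀ b → b < C → bit (b ≡ᵇ x) + bit (P b) ≤ bit (P′ b)
      disjoint b _ with b ≡ᵇ x in eq | P b in eq′
      ... | false | _     = ≤-refl
      ... | true  | false = ≤-refl
      ... | true  | true  = contradiction (≤-trans (s≤s (m≤m+n x d)) (proj₁ (P-range b eq′))) (≤⇒≯ (≤-reflexive (≡ᵇ-true b x eq)))
    rich′ : ∀ a b → a < b → P′ a ≡ true → P′ b ≡ true → ManyRows Q M A (λ c → a ≤ κ c × κ c < b)
    rich′ a b a<b Pa Pb with P′-case a Pa | P′-case b Pb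
    ... | inj₂ p | inj₂ p′ = rich a b a<b p p′
    ... | inj₁ refl | inj₁ refl = contradiction a<b (<-irrefl refl)
    ... | inj₂ p | inj₁ refl = contradiction (≤-trans (s≤s (m≤m+n x d)) (proj₁ (P-range a p))) (<⇒≯ a<b)
    ... | inj₁ refl | inj₂ p′ = many-mono {M = M} {A = A} {A′ = A} id (λ {c} → map₂ (λ lt′ → <-≤-trans lt′ (subst (_≤ b) (sym (+-suc x d)) (proj₁ (P-range b p′))))) many

  -- Row `a` of `B` represents the row parts `2 * a` and `2 * a + 1` together, hence the doubled row
  -- cuts. The two points of a cell bound an interval of column parts inside that cell, on which
  -- this pair has `Q` distinct rows.
  rich-grid⇒minor : ∀ {m₀ n₀} Q → q < Q → 1 < Q → (∀ t → t < suc m₀ → suc (suc n₀) * q ^ t < Q) →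
    ∀ k → m₀ < k → n₀ < k → (M : Mat Carrier m n) (ρ : Fin m → ℕ) (κ : Fin n → ℕ) →
    (∀ {x y} → x Fin.≤ y → ρ x ≤ ρ y) → (∀ {x y} → x Fin.≤ y → κ x ≤ κ y) → (B : ℕ → ℕ → Bool) →
    (∀ a x y → x < y → B a x ≡ true → B a y ≡ true →
      ManyRows Q M (λ i → 2 * a ≤ ρ i × ρ i ≤ suc (2 * a)) (λ c → x ≤ κ c × κ c < y)) →
    DoubleGrid k B → (N : Mat Carrier (suc m₀) (suc n₀)) → LinearMinor F N M
  rich-grid⇒minor {m} {n} {m₀} {n₀} Q q<Q 1<Q big k m₀<k n₀<k M ρ κ ρ-mono κ-mono B rich (doubleGrid p r cell) N =
    grid⇒minor Q (s≤s z≤n) (s≤s z≤n) q<Q 1<Q big M g h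
      (λ {x} {y} x≤y → subst₂ _≤_ (sym (toℕ-g x)) (sym (toℕ-g y)) (cellOf-mono P m₀ (ρ-mono x≤y)))
      (λ {x} {y} x≤y → subst₂ _≤_ (sym (toℕ-h x)) (sym (toℕ-h y)) (cellOf-mono r n₀ (κ-mono x≤y)))
      (λ i j → proj₁ (rows i j)) (λ i j → proj₁ (proj₂ (rows i j))) (λ i j → proj₂ (proj₂ (rows i j))) N
    where
    0<k : 0 < k
    0<k = ≤-trans (s≤s z≤n) m₀<k
    P : ℕ → ℕ
    P i = 2 * p i
    P-inc : ∀ i → i < k → P i ≤ P (suc i)
    P-inc i i<k with _ , _ , _ , lo , hi , _ ← cell i 0 i<k 0<k = *-monoʳ-≤ 2 (≤-trans lo (<⇒≤ hi))
    r-inc : ∀ j → j < k → r j ≤ r (suc j)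
    r-inc j j<k with _ , _ , _ , _ , _ , lo , mid , hi , _ ← cell 0 j 0<k j<k = ≤-trans lo (≤-trans (<⇒≤ mid) (<⇒≤ hi))
    g : Fin m → Fin (suc m₀)
    g i = fromℕ< (s≤s (cellOf≤ P m₀ (ρ i)))
    h : Fin n → Fin (suc n₀)
    h j = fromℕ< (s≤s (cellOf≤ r n₀ (κ j)))
    toℕ-g : ∀ i → toℕ (g i) ≡ cellOf P m₀ (ρ i)
    toℕ-g i = toℕ-fromℕ< _
    toℕ-h : ∀ j → toℕ (h j) ≡ cellOf r n₀ (κ j)
    toℕ-h j = toℕ-fromℕ< _
    g-≡ : ∀ {x} (i : Fin (suc m₀)) → P (toℕ i) ≤ ρ x → ρ x < P (suc (toℕ i)) → g x ≡ i
    g-≡ {x} i lo hi = toℕ-injective (trans (toℕ-g x) (cellOf-≡ P k P-inc m₀ (toℕ i) (ρ x) (s≤s⁻¹ (toℕ<n i)) m₀<k lo hi))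
    h-≡ : ∀ {c} (j : Fin (suc n₀)) → r (toℕ j) ≤ κ c → κ c < r (suc (toℕ j)) → h c ≡ j
    h-≡ {c} j lo hi = toℕ-injective (trans (toℕ-h c) (cellOf-≡ r k r-inc n₀ (toℕ j) (κ c) (s≤s⁻¹ (toℕ<n j)) n₀<k lo hi))
    rows : ∀ (i : Fin (suc m₀)) (j : Fin (suc n₀)) → Σ (Fin Q → Fin m) λ e → (∀ u → g (e u) ≡ i) ×
      (∀ u v → u ≢ v → ∃ λ c → h c ≡ j × M (e u) c ≢ M (e v) c)
    rows i j with a , x , y , pa , ap , rx , xy , yr , Bx , By ← cell (toℕ i) (toℕ j) (<-≤-trans (toℕ<n i) m₀<k) (<-≤-trans (toℕ<n j) n₀<k)
      = many-mono {M = M} {A = λ z → 2 * a ≤ ρ z × ρ z ≤ suc (2 * a)} {A′ = λ z → g z ≡ i}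
          (λ {x} (lo , hi) → g-≡ i (≤-trans (*-monoʳ-≤ 2 pa) lo) (≤-trans (s≤s hi) (subst (_≤ P (suc (toℕ i))) (*-suc 2 a) (*-monoʳ-≤ 2 ap))))
          (λ {c} (lo , hi) → h-≡ j (≤-trans rx lo) (<-trans hi yr)) (rich a x y xy Bx By)

-- Complex blocks and rows that agree outside them

∈-collect : ∀ {A X : Set} (f : A → List X) {a x} Y → a ∈ Y → x ∈ f a → x ∈ concatMap f Y
∈-collect f Y a∈Y x∈ = ∈-concatMap⁺ f (Any.map (λ { refl → x∈ }) a∈Y)

length-concatMap : ∀ {A X : Set} (f : A → List X) b → (∀ a → length (f a) ≤ b) → ∀ Y → length (concatMap f Y) ≤ length Y * b
length-concatMap f b le []      = z≤n
length-concatMap f b le (a ∷ Y) = subst (_≤ b + length Y * b) (sym (length-++ (f a))) (+-mono-≤ (le a) (length-concatMap f b le Y))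

record Coarser {n : ℕ} (φ φ′ : Fin n → ℕ) : Set where
  field
    coarser : ∀ {i j} → φ i ≡ φ j → φ′ i ≡ φ′ j
    fibre   : ∀ a → Σ (List ℕ) λ L → length L ≤ 2 × (∀ i → φ′ i ≡ a → φ i ∈ L)

module Parts (F : FiniteField) (t K : ℕ) where
  open LinearAlgebra F
  open Rows F

  0<q : 0 < q
  0<q = ≤-trans (s≤s z≤n) (toℕ<n (index 0F))

  -- A block with at most `K` distinct rows has at most `q ^ K` distinct columns. The threshold
  -- exceeds both numbers, so such a block is not complex.
  T₀ : ℕ
  T₀ = suc (K + q ^ K)

  RowsGood : Mat Carrier m n → (Fin m → ℕ) → (Fin n → ℕ) → Set
  RowsGood M ρ κ = ∀ a → Good t K M (λ i → ρ i ≡ a) κ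

  -- Determined by the block itself rather than by the exceptional lists, which may change in a
  -- merge. It treats rows and columns alike, so that a red pair in the block can be charged to the
  -- row part or to the column part.
  Complex : Mat Carrier m n → (Fin m → ℕ) → (Fin n → ℕ) → ℕ → ℕ → Set
  Complex M ρ κ a b = ManyRows T₀ M (λ i → ρ i ≡ a) (λ j → κ j ≡ b) ⊎ ManyRows T₀ (flip M) (λ j → κ j ≡ b) (λ i → ρ i ≡ a)

  Complex? : ∀ (M : Mat Carrier m n) ρ κ a b → Dec (Complex M ρ κ a b)
  Complex? M ρ κ a b = many? T₀ M (λ i → ρ i ≟ a) (λ j → κ j ≟ b) ⊎-dec many? T₀ (flip M) (λ j → κ j ≟ b) (λ i → ρ i ≟ a)

  Complex-coarser : ∀ (M : Mat Carrier m n) {ρ κ ρ′ κ′} → Coarser ρ ρ′ → Coarser κ κ′ → ∀ i j →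
    Complex M ρ κ (ρ i) (κ j) → Complex M ρ′ κ′ (ρ′ i) (κ′ j)
  Complex-coarser M {ρ} {κ} {ρ′} {κ′} R C i j (inj₁ p) = inj₁ (many-mono {M = M} {A = λ x → ρ x ≡ ρ i} {A′ = λ x → ρ′ x ≡ ρ′ i} {D = λ y → κ y ≡ κ j} {D′ = λ y → κ′ y ≡ κ′ j} (Coarser.coarser R) (Coarser.coarser C) p)
  Complex-coarser M {ρ} {κ} {ρ′} {κ′} R C i j (inj₂ p) = inj₂ (many-mono {M = flip M} {A = λ y → κ y ≡ κ j} {A′ = λ y → κ′ y ≡ κ′ j} {D = λ x → ρ x ≡ ρ i} {D′ = λ x → ρ′ x ≡ ρ′ i} (Coarser.coarser C) (Coarser.coarser R) p)

  classes⇒¬many-columns : ∀ {M : Mat Carrier m n} {A D} → (∀ x → Dec (A x)) → (∀ c → Dec (D c)) →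
    Classes K M A D → ¬ ManyRows T₀ (flip M) D A
  classes⇒¬many-columns {M = M} {A} {D} A? D? cl (e , De , apart)
    with k , k≤K , r , Ar , cover ← classes⇒few {M = M} A? D? cl
    with u , v , u<v , eq ← pigeonhole (s≤s (≤-trans (^-monoʳ-≤ q {{>-nonZero 0<q}} (s≤s⁻¹ k≤K)) (m≤n+m (q ^ K) K)))
           (λ u → funToFin (λ z → index (M (r z) (e u))))
    with x , Ax , ne ← apart u v (λ p → <⇒≢ u<v (cong toℕ p))
    with z , same ← cover x Ax
    = ne (trans (same (e u) (De u)) (trans (index-injective (funToFin-injective (λ z → index (M (r z) (e u))) (λ z → index (M (r z) (e v))) eq z)) (sym (same (e v) (De v)))))

  complex⇒∈ : ∀ (M : Mat Carrier m n) ρ κ a b ((Y , _) : Good t K M (λ i → ρ i ≡ a) κ) → Complex M ρ κ a b → b ∈ Y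
  complex⇒∈ M ρ κ a b (Y , _ , cl) complex = decidable-stable (b ∈? Y) λ b∉Y →
    let cl′ = classes-mono {M = M} {A = λ i → ρ i ≡ a} {A′ = λ i → ρ i ≡ a} {D = λ c → κ c ∉ Y} {D′ = λ c → κ c ≡ b} id (λ { refl → b∉Y }) cl
    in [ classes⇒¬many {M = M} (s≤s (m≤m+n K _)) cl′ , classes⇒¬many-columns {M = M} (λ i → ρ i ≟ a) (λ j → κ j ≟ b) cl′ ]′ complex

  -- Complex blocks stay complex when parts are merged, so these equivalences only get coarser.
  infix 3 _&_
  record RowEq (M : Mat Carrier m n) (ρ : Fin m → ℕ) (κ : Fin n → ℕ) (i i′ : Fin m) : Set where
    constructor _&_
    field
      same-part : ρ i ≡ ρ i′
      same-entries : ∀ j → ¬ Complex M ρ κ (ρ i) (κ j) → M i j ≡ M i′ j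

  open RowEq public

  RowEq-refl : ∀ (M : Mat Carrier m n) {ρ κ i} → RowEq M ρ κ i i
  RowEq-refl M = refl & λ _ _ → refl

  RowEq-sym : ∀ (M : Mat Carrier m n) {ρ κ i i′} → RowEq M ρ κ i i′ → RowEq M ρ κ i′ i
  RowEq-sym M {ρ} {κ} (eq & same) = sym eq & λ j ¬c → sym (same j (subst (λ a → ¬ Complex M ρ κ a (κ j)) (sym eq) ¬c))

  RowEq-trans : ∀ (M : Mat Carrier m n) {ρ κ i i′ i″} → RowEq M ρ κ i i′ → RowEq M ρ κ i′ i″ → RowEq M ρ κ i i″
  RowEq-trans M {ρ} {κ} (eq & same) (eq′ & same′) = trans eq eq′ &
    λ j ¬c → trans (same j ¬c) (same′ j (subst (λ a → ¬ Complex M ρ κ a (κ j)) eq ¬c))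

  RowEq? : ∀ (M : Mat Carrier m n) ρ κ i i′ → Dec (RowEq M ρ κ i i′)
  RowEq? M ρ κ i i′ = map′ (λ (eq , same) → eq & same) (λ e → same-part e , same-entries e)
    ((ρ i ≟ ρ i′) ×-dec all? (λ j → implies? (Complex? M ρ κ (ρ i) (κ j)) (M i j ≟F M i′ j)))
    where
    implies? : ∀ {P R : Set} → Dec P → Dec R → Dec (¬ P → R)
    implies? (yes p) _       = yes (contradiction p)
    implies? (no ¬p) (yes r) = yes (λ _ → r)
    implies? (no ¬p) (no ¬r) = no (λ f → ¬r (f ¬p))

  RowEq-coarser : ∀ (M : Mat Carrier m n) {ρ κ ρ′ κ′} → Coarser ρ ρ′ → Coarser κ κ′ → ∀ {i i′} →
    RowEq M ρ κ i i′ → RowEq M ρ′ κ′ i i′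
  RowEq-coarser M R C {i} (eq & same) = Coarser.coarser R eq & λ j ¬c → same j (¬c ∘ Complex-coarser M R C i j)

  -- Bounds the classes of `RowEq` within one part: `K` patterns outside the exceptional parts, and
  -- a factor `T₀` for each of the at most `t` exceptional parts, where a complex block imposes no
  -- condition.
  L₀ : ℕ
  L₀ = K * T₀ ^ t

  simple-classes : ∀ (M : Mat Carrier m n) ρ κ a Y →
    Classes (T₀ ^ length Y) M (λ i → ρ i ≡ a) (λ j → κ j ∈ Y × ¬ Complex M ρ κ a (κ j))
  simple-classes M ρ κ a [] = (λ _ _ → Fin.zero) , λ _ _ _ _ _ _ ()
  simple-classes M ρ κ a (b ∷ Y) = classes-× {M = M} {A = λ i → ρ i ≡ a} {D₁ = λ j → κ j ≡ b × ¬ Complex M ρ κ a b} split head (simple-classes M ρ κ a Y)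
    where
    split : ∀ {j} → κ j ∈ b ∷ Y × ¬ Complex M ρ κ a (κ j) → (κ j ≡ b × ¬ Complex M ρ κ a b) ⊎ (κ j ∈ Y × ¬ Complex M ρ κ a (κ j))
    split (here refl , ¬c) = inj₁ (refl , ¬c)
    split (there ∈Y , ¬c)  = inj₂ (∈Y , ¬c)
    head : Classes T₀ M (λ i → ρ i ≡ a) (λ j → κ j ≡ b × ¬ Complex M ρ κ a b)
    head with Complex? M ρ κ a b
    ... | yes c = (λ _ _ → Fin.zero) , λ { _ _ _ _ _ _ (_ , ¬c) → contradiction c ¬c }
    ... | no ¬c = classes-mono {M = M} {A = λ i → ρ i ≡ a} {A′ = λ i → ρ i ≡ a} id proj₁
                    (few⇒classes {M = M} (¬many⇒few T₀ M (λ i → ρ i ≟ a) (λ j → κ j ≟ b) (¬c ∘ inj₁)))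

  Representatives : Mat Carrier m n → (Fin m → ℕ) → (Fin n → ℕ) → ℕ → Set
  Representatives {m} M ρ κ a =
    Σ (List (Fin m)) λ L → length L ≤ L₀ × (∀ i → ρ i ≡ a → ∃ λ i′ → i′ ∈ L × RowEq M ρ κ i i′)

  representatives : ∀ (M : Mat Carrier m n) ρ κ → RowsGood M ρ κ → ∀ a → Representatives M ρ κ a
  representatives {m} M ρ κ good a
    with Y , lenY , cl ← good a
    with k , k≤ , e , ρe , cover ← classes⇒few {M = M} {A = λ i → ρ i ≡ a} {D = λ j → ¬ Complex M ρ κ a (κ j)} (λ i → ρ i ≟ a) (λ j → ¬? (Complex? M ρ κ a (κ j)))
           (classes-× {M = M} {A = λ i → ρ i ≡ a} (λ {j} ¬c → case κ j ∈? Y of λ { (yes p) → inj₂ (p , ¬c) ; (no p) → inj₁ p }) cl (simple-classes M ρ κ a Y))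
    = tabulate e ,
      ≤-trans (≤-reflexive (length-tabulate e)) (≤-trans (s≤s⁻¹ k≤) (*-monoʳ-≤ K (^-monoʳ-≤ T₀ lenY))) ,
      λ { i refl → e (proj₁ (cover i refl)) , ∈-tabulate⁺ (proj₁ (cover i refl)) ,
                   (sym (ρe (proj₁ (cover i refl))) & proj₂ (cover i refl)) }

  -- The map `f` will send a row to its part in an intermediate partition. A part of `ρ′` is the
  -- union of at most two parts of `ρ`, each with at most `L₀` classes.
  part-cover′ : ∀ {X : Set} (M : Mat Carrier m n) {ρ κ ρ′} → (∀ a → Representatives M ρ κ a) → Coarser ρ ρ′ → (f : Fin m → X) →
    (∀ {i i′} → RowEq M ρ κ i i′ → f i ≡ f i′) → ∀ a →
    Σ (List X) λ N → length N ≤ 2 * L₀ × (∀ i → ρ′ i ≡ a → f i ∈ N)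
  part-cover′ {m = m} {X = X} M {ρ} {κ} {ρ′} reps R f f-cong a = concatMap images L ,
    ≤-trans (length-concatMap images L₀ (λ b → ≤-trans (≤-reflexive (length-map f (proj₁ (reps b)))) (proj₁ (proj₂ (reps b)))) L) (*-monoˡ-≤ L₀ (proj₁ (proj₂ (Coarser.fibre R a)))) ,
    covered
    where
    L : List ℕ
    L = proj₁ (Coarser.fibre R a)
    images : ℕ → List X
    images b = map f (proj₁ (reps b))
    image : ∀ i → (∃ λ i′ → i′ ∈ proj₁ (reps (ρ i)) × RowEq M ρ κ i i′) → f i ∈ images (ρ i)
    image i (i′ , i′∈ , i~i′) = subst (_∈ images (ρ i)) (sym (f-cong {i} {i′} i~i′)) (∈-map⁺ f i′∈)
    covered : ∀ i → ρ′ i ≡ a → f i ∈ concatMap images L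
    covered i eq = ∈-collect images L (proj₂ (proj₂ (Coarser.fibre R a)) i eq) (image i (proj₂ (proj₂ (reps (ρ i))) i refl))

  part-cover : ∀ {X : Set} (M : Mat Carrier m n) {ρ κ ρ′} → RowsGood M ρ κ → Coarser ρ ρ′ → (f : Fin m → X) →
    (∀ {i i′} → RowEq M ρ κ i i′ → f i ≡ f i′) → ∀ a →
    Σ (List X) λ N → length N ≤ 2 * L₀ × (∀ i → ρ′ i ≡ a → f i ∈ N)
  part-cover M {ρ} {κ} good = part-cover′ M (representatives M ρ κ good)

  -- One summand for the parts within the same part of the division, the other for those in the at
  -- most `t` parts that form a complex block with it.
  bound : ℕ
  bound = 2 * L₀ + t * (2 * L₀)

  neighbours : ∀ {X : Set} (M : Mat Carrier m n) {ρ κ ρ′ κ′} → RowsGood M ρ κ → RowsGood (flip M) κ ρ →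
    RowsGood M ρ′ κ′ → Coarser ρ ρ′ → Coarser κ κ′ → (f : Fin m → X) (g : Fin n → X) →
    (∀ {i i′} → RowEq M ρ κ i i′ → f i ≡ f i′) → (∀ {j j′} → RowEq (flip M) κ ρ j j′ → g j ≡ g j′) → ∀ a →
    Σ (List X) λ N → length N ≤ bound × (∀ i → ρ′ i ≡ a → f i ∈ N) × (∀ j → Complex M ρ′ κ′ a (κ′ j) → g j ∈ N)
  neighbours {X = X} M {ρ} {κ} {ρ′} {κ′} rows cols rows′ R C f g f-cong g-cong a =
    rowPart ++ concatMap colPart Y ,
    ≤-trans (≤-reflexive (length-++ rowPart))
      (+-mono-≤ (proj₁ (proj₂ covers)) (≤-trans (length-concatMap colPart (2 * L₀) (λ b → proj₁ (proj₂ (colCover b))) Y) (*-monoˡ-≤ (2 * L₀) (proj₁ (proj₂ (rows′ a)))))) ,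
    (λ i eq → ∈-++⁺ˡ (proj₂ (proj₂ covers) i eq)) ,
    (λ j c → ∈-++⁺ʳ rowPart (∈-collect colPart Y (complex⇒∈ M ρ′ κ′ a (κ′ j) (rows′ a) c) (proj₂ (proj₂ (colCover (κ′ j))) j refl)))
    where
    covers = part-cover M rows R f f-cong a
    rowPart = proj₁ covers
    Y = proj₁ (rows′ a)
    colCover : ∀ b → Σ (List X) λ N → length N ≤ 2 * L₀ × (∀ j → κ′ j ≡ b → g j ∈ N)
    colCover = part-cover (flip M) cols C g g-cong
    colPart : ℕ → List X
    colPart b = proj₁ (colCover b)

-- Partitions refining a division

↑ˡ≢↑ʳ : ∀ (r : Fin m) (c : Fin n) → r ↑ˡ n ≢ m ↑ʳ c
↑ˡ≢↑ʳ {m} {n} r c eq with trans (sym (splitAt-↑ˡ m r n)) (trans (cong (splitAt m) eq) (splitAt-↑ʳ m n c))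
... | ()

SameType-swap : ∀ {S u v u′ v′} → SameType S u v u′ v′ → SameType S v u v′ u′
SameType-swap (a , b , c , d) = b , a , d , c

Same< : ∀ {k} (u v u′ v′ : Fin k) → Set
Same< u v u′ v′ = (u Fin.< v ⇔ u′ Fin.< v′) × (v Fin.< u ⇔ v′ Fin.< u′)

RedAdj-sym : ∀ S {k} {p : Fin (Structure.size S) → Fin k} {X Y} → RedAdj S p X Y → RedAdj S p Y X
RedAdj-sym S (X≢Y , u , u′ , v , v′ , pu , pu′ , pv , pv′ , diff) =
  X≢Y ∘ sym , v , v′ , u , u′ , pv , pv′ , pu , pu′ , λ { (a , b , c , d) → diff (b , a , d , c) }

module SameTypes {Carrier : Set} (M : Mat Carrier m n) where
  S : Structure
  S = matStructure M

  bothRows : ∀ (i i′ : Fin m) s → Structure.U S s (i ↑ˡ n) ⇔ Structure.U S s (i′ ↑ˡ n)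
  bothRows i i′ s = mk⇔ (λ _ → i′ , refl) (λ _ → i , refl)

  bothColumns : ∀ (j j′ : Fin n) s → Structure.U S s (m ↑ʳ j) ⇔ Structure.U S s (m ↑ʳ j′)
  bothColumns j j′ s = mk⇔ (λ { (r , eq) → contradiction (sym eq) (↑ˡ≢↑ʳ r j) }) (λ { (r , eq) → contradiction (sym eq) (↑ˡ≢↑ʳ r j′) })

  rows : ∀ (i v i′ v′ : Fin m) → Same< (i ↑ˡ n) (v ↑ˡ n) (i′ ↑ˡ n) (v′ ↑ˡ n) →
    SameType S (i ↑ˡ n) (v ↑ˡ n) (i′ ↑ˡ n) (v′ ↑ˡ n)
  rows i v i′ v′ (lt⇔ , gt⇔) = bothRows i i′ , bothRows v v′ ,
    (λ { lt → lt⇔ ; (E a) → mk⇔ (none i v) (none i′ v′) }) , (λ { lt → gt⇔ ; (E a) → mk⇔ (none v i) (none v′ i′) })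
    where
    none : ∀ {X : Set} {a} (x y : Fin m) → Structure.B S (E a) (x ↑ˡ n) (y ↑ˡ n) → X
    none x y (_ , c , _ , eq , _) = contradiction eq (↑ˡ≢↑ʳ y c)

  columns : ∀ (i v i′ v′ : Fin n) → Same< (m ↑ʳ i) (m ↑ʳ v) (m ↑ʳ i′) (m ↑ʳ v′) →
    SameType S (m ↑ʳ i) (m ↑ʳ v) (m ↑ʳ i′) (m ↑ʳ v′)
  columns i v i′ v′ (lt⇔ , gt⇔) = bothColumns i i′ , bothColumns v v′ ,
    (λ { lt → lt⇔ ; (E a) → mk⇔ (none i v) (none i′ v′) }) , (λ { lt → gt⇔ ; (E a) → mk⇔ (none v i) (none v′ i′) })
    where
    none : ∀ {X : Set} {a} (x y : Fin n) → Structure.B S (E a) (m ↑ʳ x) (m ↑ʳ y) → X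
    none x y (r , _ , eq , _) = contradiction (sym eq) (↑ˡ≢↑ʳ r x)

  row<column : ∀ (i : Fin m) (j : Fin n) → (i ↑ˡ n) Fin.< (m ↑ʳ j)
  row<column i j = subst₂ _<_ (sym (toℕ-↑ˡ i n)) (sym (toℕ-↑ʳ m j)) (<-≤-trans (toℕ<n i) (m≤m+n m (toℕ j)))

  entry : ∀ {i : Fin m} {j : Fin n} {a} → Structure.B S (E a) (i ↑ˡ n) (m ↑ʳ j) → M i j ≡ a
  entry {i} {j} (r , c , eq , eq′ , Mrc) = trans (cong₂ M (↑ˡ-injective n i r eq) (↑ʳ-injective m j c eq′)) Mrc

  rowColumn : ∀ (i i′ : Fin m) (j j′ : Fin n) → M i j ≡ M i′ j′ → SameType S (i ↑ˡ n) (m ↑ʳ j) (i′ ↑ˡ n) (m ↑ʳ j′)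
  rowColumn i i′ j j′ eq = bothRows i i′ , bothColumns j j′ ,
    (λ { lt → mk⇔ (λ _ → row<column i′ j′) (λ _ → row<column i j)
       ; (E a) → mk⇔ (λ p → i′ , j′ , refl , refl , trans (sym eq) (entry p)) (λ p → i , j , refl , refl , trans eq (entry p)) }) ,
    (λ { lt → mk⇔ (λ p → contradiction p (<⇒≯ (row<column i j))) (λ p → contradiction p (<⇒≯ (row<column i′ j′)))
       ; (E a) → mk⇔ (λ { (r , _ , eq′ , _) → contradiction (sym eq′) (↑ˡ≢↑ʳ r j) }) (λ { (r , _ , eq′ , _) → contradiction (sym eq′) (↑ˡ≢↑ʳ r j′) }) })

  rowColumn⁻¹ : ∀ {i i′ : Fin m} {j j′ : Fin n} → SameType S (i ↑ˡ n) (m ↑ʳ j) (i′ ↑ˡ n) (m ↑ʳ j′) → M i j ≡ M i′ j′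
  rowColumn⁻¹ {i} {i′} {j} {j′} (_ , _ , same , _) =
    sym (entry (Equivalence.to (same (E (M i j))) (i , j , refl , refl , refl)))

mono-reflects-< : ∀ {k} (φ : Fin k → ℕ) → (∀ {x y} → x Fin.≤ y → φ x ≤ φ y) → ∀ x y → φ x < φ y → x Fin.< y
mono-reflects-< φ mono x y lt′ with toℕ x <? toℕ y
... | yes p = p
... | no ¬p = contradiction (mono (≮⇒≥ ¬p)) (<⇒≱ lt′)

module _ {k l : ℕ} (h : Fin k → Fin l) (h-< : ∀ {x y} → x Fin.< y ⇔ h x Fin.< h y)
         (φ : Fin k → ℕ) (φ-mono : ∀ {x y} → x Fin.≤ y → φ x ≤ φ y) where
  private
    lift : ∀ x y → φ x < φ y → h x Fin.< h y
    lift x y p = Equivalence.to h-< (mono-reflects-< φ φ-mono x y p)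

  -- Parts of a division are intervals, so elements of different parts are ordered as these parts
  -- are. Hence among rows, and among columns, the order causes red pairs only inside one part of
  -- the division.
  same-parts⇒Same< : ∀ x y x′ y′ → φ x ≢ φ y → φ x ≡ φ x′ → φ y ≡ φ y′ → Same< (h x) (h y) (h x′) (h y′)
  same-parts⇒Same< x y x′ y′ ne eq eq′ with <-cmp (φ x) (φ y)
  ... | tri< p _ _ = mk⇔ (λ _ → lift x′ y′ p′) (λ _ → lift x y p) ,
        mk⇔ (λ gt → contradiction gt (<⇒≯ (lift x y p))) (λ gt → contradiction gt (<⇒≯ (lift x′ y′ p′)))
    where p′ = subst₂ _<_ eq eq′ p
  ... | tri≈ _ p _ = contradiction p ne
  ... | tri> _ _ p = mk⇔ (λ gt → contradiction gt (<⇒≯ (lift y x p))) (λ gt → contradiction gt (<⇒≯ (lift y′ x′ p′))) ,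
        mk⇔ (λ _ → lift y′ x′ p′) (λ _ → lift y x p)
    where p′ = subst₂ _<_ eq′ eq p

-- The renumbering that merges the parts `a` and `a + 1`.
shrink : ℕ → ℕ → ℕ
shrink a x with x ≤? a
... | yes _ = x
... | no  _ = pred x

shrink-mono : ∀ a {x y} → x ≤ y → shrink a x ≤ shrink a y
shrink-mono a {x} {y} x≤y with x ≤? a | y ≤? a
... | yes _ | yes _ = x≤y
... | yes p | no q  = ≤-trans p (pred-mono-≤ (≰⇒> q))
... | no p  | yes q = contradiction (≤-trans x≤y q) p
... | no _  | no _  = pred-mono-≤ x≤y

shrink< : ∀ a {x r} → suc a < r → x < r → shrink a x < pred r
shrink< a {x} {suc r} a<r x<r with x ≤? a
... | yes p = ≤-<-trans p (s≤s⁻¹ a<r)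
shrink< a {zero} {suc r} a<r x<r | no p = contradiction z≤n p
shrink< a {suc x} {suc r} a<r x<r | no p = s≤s⁻¹ x<r

shrink-fibre : ∀ a x → x ≡ shrink a x ⊎ x ≡ suc (shrink a x)
shrink-fibre a x with x ≤? a
... | yes _ = inj₁ refl
shrink-fibre a zero | no p = contradiction z≤n p
shrink-fibre a (suc x) | no _ = inj₂ refl

shrink-low : ∀ a x → shrink a x < a → x ≡ shrink a x
shrink-low a x p with x ≤? a
... | yes _ = refl
shrink-low a zero p | no _ = refl
shrink-low a (suc x) p | no q = contradiction p q

shrink-high : ∀ a x → a < shrink a x → x ≡ suc (shrink a x)
shrink-high a x p with x ≤? a
... | yes q = contradiction q (<⇒≱ p)
shrink-high a zero p | no q = contradiction z≤n q
shrink-high a (suc x) p | no _ = refl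

Coarser-refl : ∀ (φ : Fin n → ℕ) → Coarser φ φ
Coarser-refl φ = record { coarser = id ; fibre = λ a → (a ∷ []) , s≤s z≤n , λ { i refl → here refl } }

Coarser-shrink : ∀ (φ : Fin n → ℕ) a → Coarser φ (shrink a ∘ φ)
Coarser-shrink φ a = record
  { coarser = cong (shrink a)
  ; fibre   = λ b → (b ∷ suc b ∷ []) , s≤s (s≤s z≤n) , λ { i refl → [ here , (λ p → there (here p)) ]′ (shrink-fibre a (φ i)) } }

-- The factor 3 comes from `r ≤ 3 * ⌊ r /2⌋`, the factor `s` from rounding `r` up to a power of `s`.
points : ℕ → ℕ
points k = suc (MarcusTardos.density k * (MarcusTardos.s k * 3))

-- Many points are guaranteed only in the ⌊r/2⌋ rows that stand for pairs. As `c ≤ r`, everything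
-- fits into a square whose side is a power of `s` and at most `s * (3 * ⌊ r /2⌋)`, so constantly
-- many points in each of these rows exceed the bound of `double-grid`.
dense-grid : ∀ k → 1 ≤ k → ∀ r c B → 2 ≤ r → c ≤ r → (∀ a → a < ⌊ r /2⌋ → points k ≤ count c (B a)) → DoubleGrid k B
dense-grid (suc k) _ r c B 2≤r c≤r dense with half≥1 , r≤ ← half-bounds r 2≤r
  with e , lo , hi ← power-between (MarcusTardos.s (suc k)) (s≤s (s≤s z≤n)) r (≤-trans (s≤s z≤n) 2≤r)
  with MarcusTardos.double-grid (suc k) e B
... | inj₁ grid = grid
... | inj₂ few = contradiction (begin-strict
    H * (density * (s * 3)) <⟨ m<n+m _ half≥1 ⟩
    H + H * (density * (s * 3)) ≡⟨ sym (*-suc H _) ⟩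
    H * points (suc k) ≡⟨ sym (∑-const H _) ⟩
    ∑ H (λ _ → points (suc k)) ≤⟨ ∑-mono H (λ a a<H → ≤-trans (dense a a<H) (∑-extend (bit ∘ B a) (≤-trans c≤r lo))) ⟩
    ∑ H (λ a → count (s ^ e) (B a)) ≤⟨ ∑-extend _ (≤-trans (⌊n/2⌋≤n r) lo) ⟩
    ∑ (s ^ e) (λ a → count (s ^ e) (B a)) ≤⟨ few ⟩
    density * s ^ e ≤⟨ *-monoʳ-≤ density (≤-trans hi (*-monoʳ-≤ s r≤)) ⟩
    density * (s * (3 * H)) ≡⟨ solve 3 (λ d s h → d :* (s :* (con 3 :* h)) := h :* (d :* (s :* con 3))) refl density s H ⟩
    H * (density * (s * 3)) ∎) (<-irrefl refl)
  where
  open ≤-Reasoning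
  open +-*-Solver
  open MarcusTardos (suc k)
  H = ⌊ r /2⌋

data View (m n : ℕ) : Fin (m + n) → Set where
  row    : (i : Fin m) → View m n (i ↑ˡ n)
  column : (j : Fin n) → View m n (m ↑ʳ j)

view : ∀ m n (u : Fin (m + n)) → View m n u
view m n u with splitAt m u in eq
... | inj₁ i with refl ← splitAt⁻¹-↑ˡ {m} {n} {u} eq = row i
... | inj₂ j with refl ← splitAt⁻¹-↑ʳ {m} {n} {u} eq = column j

-- Red degrees of partitions between consecutive divisions

module Divisions (F : FiniteField) (t K : ℕ) (1≤K : 1 ≤ K) where
  open LinearAlgebra F
  open Rows F
  open Parts F t K

  record Division (M : Mat Carrier m n) (r c : ℕ) : Set where
    field
      ρ : Fin m → ℕ
      κ : Fin n → ℕ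
      ρ-mono : ∀ {x y} → x Fin.≤ y → ρ x ≤ ρ y
      κ-mono : ∀ {x y} → x Fin.≤ y → κ x ≤ κ y
      ρ< : ∀ i → ρ i < r
      κ< : ∀ j → κ j < c
      rows-good    : RowsGood M ρ κ
      columns-good : RowsGood (flip M) κ ρ

  open Division

  transpose : ∀ {M : Mat Carrier m n} {r c} → Division M r c → Division (flip M) c r
  transpose D = record
    { ρ = κ D ; κ = ρ D ; ρ-mono = κ-mono D ; κ-mono = ρ-mono D ; ρ< = κ< D ; κ< = ρ< D
    ; rows-good = columns-good D ; columns-good = rows-good D }

  toℕ-good : ∀ (M : Mat Carrier m n) κ → RowsGood M toℕ κ
  toℕ-good M κ a = [] , z≤n , (λ _ _ → Fin.inject≤ Fin.zero 1≤K) ,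
    λ x y xa ya _ c _ → cong (λ z → M z c) (toℕ-injective (trans xa (sym ya)))

  finest : ∀ (M : Mat Carrier m n) → Division M m n
  finest M = record
    { ρ = toℕ ; κ = toℕ ; ρ-mono = id ; κ-mono = id ; ρ< = toℕ<n ; κ< = toℕ<n
    ; rows-good = toℕ-good M toℕ ; columns-good = toℕ-good (flip M) toℕ }

  open DecEquivalence

  module Relation (M : Mat Carrier m n) where
    Rel : (Fin m → ℕ) → (Fin n → ℕ) → Fin m ⊎ Fin n → Fin m ⊎ Fin n → Set
    Rel ρ κ (inj₁ i) (inj₁ i′) = RowEq M ρ κ i i′
    Rel ρ κ (inj₁ i) (inj₂ j′) = ⊥
    Rel ρ κ (inj₂ j) (inj₁ i′) = ⊥
    Rel ρ κ (inj₂ j) (inj₂ j′) = RowEq (flip M) κ ρ j j′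

    Rel? : ∀ ρ κ x y → Dec (Rel ρ κ x y)
    Rel? ρ κ (inj₁ i) (inj₁ i′) = RowEq? M ρ κ i i′
    Rel? ρ κ (inj₁ i) (inj₂ j′) = no id
    Rel? ρ κ (inj₂ j) (inj₁ i′) = no id
    Rel? ρ κ (inj₂ j) (inj₂ j′) = RowEq? (flip M) κ ρ j j′

    Rel-refl : ∀ ρ κ x → Rel ρ κ x x
    Rel-refl ρ κ (inj₁ i) = RowEq-refl M
    Rel-refl ρ κ (inj₂ j) = RowEq-refl (flip M)

    Rel-sym : ∀ ρ κ x y → Rel ρ κ x y → Rel ρ κ y x
    Rel-sym ρ κ (inj₁ i) (inj₁ i′) = RowEq-sym M
    Rel-sym ρ κ (inj₂ j) (inj₂ j′) = RowEq-sym (flip M)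

    Rel-trans : ∀ ρ κ x y z → Rel ρ κ x y → Rel ρ κ y z → Rel ρ κ x z
    Rel-trans ρ κ (inj₁ i) (inj₁ i′) (inj₁ i″) = RowEq-trans M
    Rel-trans ρ κ (inj₂ j) (inj₂ j′) (inj₂ j″) = RowEq-trans (flip M)

    equivalence : (Fin m → ℕ) → (Fin n → ℕ) → DecEquivalence (Fin (m + n))
    equivalence ρ κ = record
      { _≈_ = λ u v → Rel ρ κ (splitAt m u) (splitAt m v)
      ; _≈?_ = λ u v → Rel? ρ κ (splitAt m u) (splitAt m v)
      ; ≈-refl = λ {u} → Rel-refl ρ κ (splitAt m u)
      ; ≈-sym = λ {u} {v} → Rel-sym ρ κ (splitAt m u) (splitAt m v)
      ; ≈-trans = λ {u} {v} {w} → Rel-trans ρ κ (splitAt m u) (splitAt m v) (splitAt m w) }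

    total : DecEquivalence (Fin (m + n))
    total = record
      { _≈_ = λ _ _ → ⊤ ; _≈?_ = λ _ _ → yes tt ; ≈-refl = tt ; ≈-sym = λ _ → tt ; ≈-trans = λ _ _ → tt }

    module _ (ρ : Fin m → ℕ) (κ : Fin n → ℕ) where
      row-≈ : ∀ {i i′} → RowEq M ρ κ i i′ → _≈_ (equivalence ρ κ) (i ↑ˡ n) (i′ ↑ˡ n)
      row-≈ {i} {i′} = subst₂ (Rel ρ κ) (sym (splitAt-↑ˡ m i n)) (sym (splitAt-↑ˡ m i′ n))

      column-≈ : ∀ {j j′} → RowEq (flip M) κ ρ j j′ → _≈_ (equivalence ρ κ) (m ↑ʳ j) (m ↑ʳ j′)
      column-≈ {j} {j′} = subst₂ (Rel ρ κ) (sym (splitAt-↑ʳ m n j)) (sym (splitAt-↑ʳ m n j′))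

      ≈-row : ∀ {u i} → _≈_ (equivalence ρ κ) u (i ↑ˡ n) → ∃ λ i′ → u ≡ i′ ↑ˡ n × RowEq M ρ κ i′ i
      ≈-row {u} {i} u≈ with view m n u
      ... | row i′ = i′ , refl , subst₂ (Rel ρ κ) (splitAt-↑ˡ m i′ n) (splitAt-↑ˡ m i n) u≈
      ... | column j with () ← subst₂ (Rel ρ κ) (splitAt-↑ʳ m n j) (splitAt-↑ˡ m i n) u≈

      ≈-column : ∀ {u j} → _≈_ (equivalence ρ κ) u (m ↑ʳ j) → ∃ λ j′ → u ≡ m ↑ʳ j′ × RowEq (flip M) κ ρ j′ j
      ≈-column {u} {j} u≈ with view m n u
      ... | column j′ = j′ , refl , subst₂ (Rel ρ κ) (splitAt-↑ʳ m n j′) (splitAt-↑ʳ m n j) u≈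
      ... | row i with () ← subst₂ (Rel ρ κ) (splitAt-↑ˡ m i n) (splitAt-↑ʳ m n j) u≈

    equivalence-coarser : ∀ {ρ κ ρ′ κ′} → Coarser ρ ρ′ → Coarser κ κ′ → ∀ {u v} →
      _≈_ (equivalence ρ κ) u v → _≈_ (equivalence ρ′ κ′) u v
    equivalence-coarser R C {u} {v} = go (splitAt m u) (splitAt m v)
      where
      go : ∀ x y → Rel _ _ x y → Rel _ _ x y
      go (inj₁ i) (inj₁ i′) = RowEq-coarser M R C
      go (inj₂ j) (inj₂ j′) = RowEq-coarser (flip M) C R

    -- Exchange the row and then the column; both steps stay in the same block. So a part of rows
    -- and a part of columns can be red-adjacent only in a complex block.
    equal-entries : ∀ {ρ κ i i′ j j′} → RowEq M ρ κ i i′ → RowEq (flip M) κ ρ j j′ → ¬ Complex M ρ κ (ρ i) (κ j) → M i j ≡ M i′ j′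
    equal-entries {ρ} {κ} {i} {i′} {j} (eq & same) (_ & same′) ¬c =
      trans (same j ¬c) (same′ i′ (¬c ∘ subst (λ a → Complex M ρ κ a (κ j)) (sym eq) ∘ swap))

    open SameTypes M hiding (S)
    S = matStructure M
    open Contraction S bound

    module _ {r c : ℕ} (D : Division M r c) {k : ℕ} (p : Fin (m + n) → Fin k)
             (above : ∀ {u v} → p u ≡ p v → _≈_ (equivalence (ρ D) (κ D)) u v) where
      p-row : ∀ {u i} → p u ≡ p (i ↑ˡ n) → ∃ λ i′ → u ≡ i′ ↑ˡ n × RowEq M (ρ D) (κ D) i′ i
      p-row {u} {i} eq = ≈-row (ρ D) (κ D) {u} {i} (above {u} {i ↑ˡ n} eq)

      p-column : ∀ {u j} → p u ≡ p (m ↑ʳ j) → ∃ λ j′ → u ≡ m ↑ʳ j′ × RowEq (flip M) (κ D) (ρ D) j′ j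
      p-column {u} {j} eq = ≈-column (ρ D) (κ D) {u} {j} (above {u} {m ↑ʳ j} eq)

      red-row-row : ∀ {X Y} i x → p (i ↑ˡ n) ≡ X → p (x ↑ˡ n) ≡ Y → RedAdj S p X Y → ρ D x ≡ ρ D i
      red-row-row i₀ x₀ pi px (_ , u , u′ , v , v′ , pu , pu′ , pv , pv′ , diff)
        with i , refl , i≈ ← p-row {u} {i₀} (trans pu (sym pi)) | i′ , refl , i′≈ ← p-row {u′} {i₀} (trans pu′ (sym pi))
        with x , refl , x≈ ← p-row {v} {x₀} (trans pv (sym px)) | x′ , refl , x′≈ ← p-row {v′} {x₀} (trans pv′ (sym px))
        = decidable-stable (ρ D x₀ ≟ ρ D i₀) λ ne → diff (rows i x i′ x′ (same-parts⇒Same< (_↑ˡ n)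
            (λ {x} {y} → mk⇔ (subst₂ _<_ (sym (toℕ-↑ˡ x n)) (sym (toℕ-↑ˡ y n))) (subst₂ _<_ (toℕ-↑ˡ x n) (toℕ-↑ˡ y n)))
            (ρ D) (ρ-mono D) i x i′ x′ (λ eq → ne (trans (sym (same-part x≈)) (trans (sym eq) (same-part i≈))))
            (trans (same-part i≈) (sym (same-part i′≈))) (trans (same-part x≈) (sym (same-part x′≈)))))

      red-column-column : ∀ {X Y} j y → p (m ↑ʳ j) ≡ X → p (m ↑ʳ y) ≡ Y → RedAdj S p X Y → κ D y ≡ κ D j
      red-column-column j₀ y₀ pj py (_ , u , u′ , v , v′ , pu , pu′ , pv , pv′ , diff)
        with j , refl , j≈ ← p-column {u} {j₀} (trans pu (sym pj)) | j′ , refl , j′≈ ← p-column {u′} {j₀} (trans pu′ (sym pj))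
        with y , refl , y≈ ← p-column {v} {y₀} (trans pv (sym py)) | y′ , refl , y′≈ ← p-column {v′} {y₀} (trans pv′ (sym py))
        = decidable-stable (κ D y₀ ≟ κ D j₀) λ ne → diff (columns j y j′ y′ (same-parts⇒Same< (m ↑ʳ_)
            (λ {x} {y} → mk⇔ (λ p → subst₂ _<_ (sym (toℕ-↑ʳ m x)) (sym (toℕ-↑ʳ m y)) (+-monoʳ-< m p))
                             (λ p → +-cancelˡ-< m _ _ (subst₂ _<_ (toℕ-↑ʳ m x) (toℕ-↑ʳ m y) p)))
            (κ D) (κ-mono D) j y j′ y′ (λ eq → ne (trans (sym (same-part y≈)) (trans (sym eq) (same-part j≈))))
            (trans (same-part j≈) (sym (same-part j′≈))) (trans (same-part y≈) (sym (same-part y′≈)))))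

      red-row-column : ∀ {X Y} i y → p (i ↑ˡ n) ≡ X → p (m ↑ʳ y) ≡ Y → RedAdj S p X Y → Complex M (ρ D) (κ D) (ρ D i) (κ D y)
      red-row-column i₀ y₀ pi py (_ , u , u′ , v , v′ , pu , pu′ , pv , pv′ , diff)
        with i , refl , i≈ ← p-row {u} {i₀} (trans pu (sym pi)) | i′ , refl , i′≈ ← p-row {u′} {i₀} (trans pu′ (sym pi))
        with y , refl , y≈ ← p-column {v} {y₀} (trans pv (sym py)) | y′ , refl , y′≈ ← p-column {v′} {y₀} (trans pv′ (sym py))
        = decidable-stable (Complex? M (ρ D) (κ D) (ρ D i₀) (κ D y₀)) λ simple → diff (rowColumn i i′ y y′
            (trans (equal-entries {ρ D} {κ D} (RowEq-trans M i≈ (RowEq-sym M i′≈)) (RowEq-trans (flip M) y≈ (RowEq-sym (flip M) y′≈))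
              (simple ∘ subst₂ (Complex M (ρ D) (κ D)) (same-part i≈) (same-part y≈))) refl))

    module _ {r c r′ c′ : ℕ} (D : Division M r c) (D′ : Division M r′ c′)
             (R : Coarser (ρ D) (ρ D′)) (C : Coarser (κ D) (κ D′)) where
      -- The two divisions play different roles. Each part of `p` lies in one class of `D′`, which
      -- confines its red neighbours to the same part of `D′` and to the parts forming complex
      -- blocks with it. Each part of `p` is also a union of classes of `D`, which limits how many
      -- of them fit into one part of `D′`.
      sandwich : Sandwich (equivalence (ρ D) (κ D)) (equivalence (ρ D′) (κ D′))
      sandwich {k} p surj below above X with u₀ , pu₀ ← surj X = near u₀ pu₀ (view m n u₀)
        where
        f : Fin m → Fin (suc k)
        f i = p (i ↑ˡ n)
        g : Fin n → Fin (suc k)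
        g j = p (m ↑ʳ j)
        f-cong : ∀ {i i′} → RowEq M (ρ D) (κ D) i i′ → f i ≡ f i′
        f-cong {i} {i′} e = below {i ↑ˡ n} {i′ ↑ˡ n} (row-≈ (ρ D) (κ D) {i} {i′} e)
        g-cong : ∀ {j j′} → RowEq (flip M) (κ D) (ρ D) j j′ → g j ≡ g j′
        g-cong {j} {j′} e = below {m ↑ʳ j} {m ↑ʳ j′} (column-≈ (ρ D) (κ D) {j} {j′} e)
        Goal : Set
        Goal = Σ (List (Fin (suc k))) λ L → length L ≤ bound × (∀ Y → RedAdj S p X Y → Y ∈ L)
        near-row : ∀ i → f i ≡ X → (Σ (List (Fin (suc k))) λ N → length N ≤ bound ×
          (∀ x → ρ D′ x ≡ ρ D′ i → f x ∈ N) × (∀ y → Complex M (ρ D′) (κ D′) (ρ D′ i) (κ D′ y) → g y ∈ N)) → Goal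
        near-row i pu (N , len , rows∈ , columns∈) = N , len , member
          where
          member : ∀ Y → RedAdj S p X Y → Y ∈ N
          member Y red with v , pv ← surj Y with view m n v
          ... | row x    = subst (_∈ N) pv (rows∈ x (red-row-row D′ p (λ {u} {v} → above {u} {v}) i x pu pv red))
          ... | column y = subst (_∈ N) pv (columns∈ y (red-row-column D′ p (λ {u} {v} → above {u} {v}) i y pu pv red))
        near-column : ∀ j → g j ≡ X → (Σ (List (Fin (suc k))) λ N → length N ≤ bound ×
          (∀ y → κ D′ y ≡ κ D′ j → g y ∈ N) × (∀ x → Complex (flip M) (κ D′) (ρ D′) (κ D′ j) (ρ D′ x) → f x ∈ N)) → Goal
        near-column j pu (N , len , columns∈ , rows∈) = N , len , member
          where
          member : ∀ Y → RedAdj S p X Y → Y ∈ N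
          member Y red with v , pv ← surj Y with view m n v
          ... | column y = subst (_∈ N) pv (columns∈ y (red-column-column D′ p (λ {u} {v} → above {u} {v}) j y pu pv red))
          ... | row x    = subst (_∈ N) pv (rows∈ x (swap (red-row-column D′ p (λ {u} {v} → above {u} {v}) x j pv pu (RedAdj-sym S {p = p} red))))
        near : ∀ u → p u ≡ X → View m n u → Goal
        near _ pu (row i) = near-row i pu (neighbours M (rows-good D) (columns-good D) (rows-good D′) R C f g
          (λ {i} {i′} → f-cong {i} {i′}) (λ {j} {j′} → g-cong {j} {j′}) (ρ D′ i))
        near _ pu (column j) = near-column j pu (neighbours (flip M) (columns-good D) (rows-good D) (columns-good D′) C R g f
          (λ {j} {j′} → g-cong {j} {j′}) (λ {i} {i′} → f-cong {i} {i′}) (κ D′ j))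

    -- With at most one row part and one column part, `p` has at most `2 * L₀` parts in all, so they
    -- can simply all be listed.
    top-sandwich : ∀ {r c} (D : Division M r c) → r ≤ 1 → c ≤ 1 → Sandwich (equivalence (ρ D) (κ D)) total
    top-sandwich D r≤1 c≤1 {k} p surj below above X =
      cover (representatives M (ρ D) (κ D) (rows-good D) 0) (representatives (flip M) (κ D) (ρ D) (columns-good D) 0)
      where
      zero-part : ∀ {k x} → k ≤ 1 → x < k → x ≡ 0
      zero-part k≤1 x<k = n≤0⇒n≡0 (s≤s⁻¹ (≤-trans x<k k≤1))
      f : Fin m → Fin (suc k)
      f i = p (i ↑ˡ n)
      g : Fin n → Fin (suc k)
      g j = p (m ↑ʳ j)
      cover : (Σ (List (Fin m)) λ L → length L ≤ L₀ × (∀ i → ρ D i ≡ 0 → ∃ λ i′ → i′ ∈ L × RowEq M (ρ D) (κ D) i i′)) →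
              (Σ (List (Fin n)) λ L → length L ≤ L₀ × (∀ j → κ D j ≡ 0 → ∃ λ j′ → j′ ∈ L × RowEq (flip M) (κ D) (ρ D) j j′)) →
              Σ (List (Fin (suc k))) λ L → length L ≤ bound × (∀ Y → RedAdj S p X Y → Y ∈ L)
      cover (L , lenL , L-covers) (L′ , lenL′ , L′-covers) = map f L ++ map g L′ ,
        ≤-trans (≤-reflexive (trans (length-++ (map f L)) (cong₂ _+_ (length-map f L) (length-map g L′))))
          (≤-trans (+-mono-≤ lenL lenL′) (≤-trans (≤-reflexive (cong (L₀ +_) (sym (+-identityʳ L₀)))) (m≤m+n (2 * L₀) (t * (2 * L₀))))) ,
        member
        where
        member : ∀ Y → RedAdj S p X Y → Y ∈ map f L ++ map g L′
        member Y _ with v , pv ← surj Y with view m n v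
        ... | row x with x′ , x′∈ , x~ ← L-covers x (zero-part r≤1 (ρ< D x)) =
          ∈-++⁺ˡ (subst (_∈ map f L) (trans (sym (below {x ↑ˡ n} {x′ ↑ˡ n} (row-≈ (ρ D) (κ D) {x} {x′} x~))) pv) (∈-map⁺ f x′∈))
        ... | column y with y′ , y′∈ , y~ ← L′-covers y (zero-part c≤1 (κ< D y)) =
          ∈-++⁺ʳ (map f L) (subst (_∈ map g L′) (trans (sym (below {m ↑ʳ y} {m ↑ʳ y′} (column-≈ (ρ D) (κ D) {y} {y′} y~))) pv) (∈-map⁺ g y′∈))

-- Greedy merging of row and column parts

-- The side to be merged must have at least as many parts as the other one: `dense-grid` relies on
-- this when the merging is stuck.
data Shape (r c : ℕ) : Set where
  small        : r ≤ 1 → c ≤ 1 → Shape r c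
  more-rows    : c ≤ r → 2 ≤ r → Shape r c
  more-columns : r ≤ c → 2 ≤ c → Shape r c

shape : ∀ r c → Shape r c
shape r c with ≤-total c r
... | inj₁ c≤r with 2 ≤? r
...   | yes 2≤r = more-rows c≤r 2≤r
...   | no 2≰r  = small (s≤s⁻¹ (≰⇒> 2≰r)) (≤-trans c≤r (s≤s⁻¹ (≰⇒> 2≰r)))
shape r c | inj₂ r≤c with 2 ≤? c
...   | yes 2≤c = more-columns r≤c 2≤c
...   | no 2≰c  = small (≤-trans r≤c (s≤s⁻¹ (≰⇒> 2≰c))) (s≤s⁻¹ (≰⇒> 2≰c))

module Greedy (F : FiniteField) (k Q : ℕ) (1≤k : 1 ≤ k) (2≤Q : 2 ≤ Q) where
  open LinearAlgebra F
  open Rows F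

  t K : ℕ
  t = points k
  -- The bound delivered by `scan`, where every interval of column parts contributes a factor `Q`.
  K = Q ^ suc t

  1≤K : 1 ≤ K
  1≤K = m^n>0 Q {{>-nonZero (≤-trans (s≤s z≤n) 2≤Q)}} (suc t)

  open Parts F t K
  open Divisions F t K 1≤K
  open Division
  open DecEquivalence

  -- A k × k grid of cells with Q distinct rows each realises every matrix with m₁ + 1 rows and n₁ + 1 columns.
  Fits : ℕ → ℕ → Set
  Fits m₁ n₁ = m₁ < k × n₁ < k × (∀ e → e < suc m₁ → suc (suc n₁) * q ^ e < Q)

  module _ {m₁ n₁} (fits : Fits m₁ n₁) (q<Q : q < Q) (N : Mat Carrier (suc m₁) (suc n₁)) (M : Mat Carrier m n)
           {r c} (D : Division M r c) (c≤r : c ≤ r) (2≤r : 2 ≤ r) where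
    Pair : ℕ → Fin m → Set
    Pair a i = 2 * a ≤ ρ D i × ρ D i ≤ suc (2 * a)

    Pair? : ∀ a i → Dec (Pair a i)
    Pair? a i = (2 * a ≤? ρ D i) ×-dec (ρ D i ≤? suc (2 * a))

    scan-pair : ∀ a → Good t K M (Pair a) (κ D) ⊎ CutPoints Q t M (Pair a) (κ D) c 0
    scan-pair a with scan Q 2≤Q M (Pair? a) (κ D) c (κ< D) t 0 z≤n
    ... | inj₁ cuts = inj₂ cuts
    ... | inj₂ (Y , len , cl) = inj₁ (Y , len , classes-mono {M = M} {A = Pair a} {A′ = Pair a} {D = λ j → 0 ≤ κ D j × κ D j ∉ Y} {D′ = λ j → κ D j ∉ Y} id (z≤n ,_) cl)

    merge-pair : ∀ a → a < ⌊ r /2⌋ → Good t K M (Pair a) (κ D) →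
      Σ (Division M (pred r) c) λ D′ → Coarser (ρ D) (ρ D′) × Coarser (κ D) (κ D′)
    merge-pair a a< (Y , len , cl) = record
      { ρ = ρ′ ; κ = κ D ; ρ-mono = λ x≤y → shrink-mono (2 * a) (ρ-mono D x≤y) ; κ-mono = κ-mono D
      ; ρ< = λ i → shrink< (2 * a) (half< r a a<) (ρ< D i) ; κ< = κ< D
      ; rows-good = rows ; columns-good = columns } , Coarser-shrink (ρ D) (2 * a) , Coarser-refl (κ D)
      where
      ρ′ : Fin m → ℕ
      ρ′ i = shrink (2 * a) (ρ D i)
      restrict : ∀ {A A′ : Fin m → Set} → (∀ {x} → A′ x → A x) → Good t K M A (κ D) → Good t K M A′ (κ D)
      restrict {A} {A′} sub (Y , len , cl) = Y , len , classes-mono {M = M} {A = A} {A′ = A′} {D = λ j → κ D j ∉ Y} {D′ = λ j → κ D j ∉ Y} sub id cl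
      rows : RowsGood M ρ′ (κ D)
      rows b with <-cmp b (2 * a)
      ... | tri< p _ _ = restrict {λ i → ρ D i ≡ b} {λ i → ρ′ i ≡ b} (λ {i} → λ { refl → shrink-low (2 * a) (ρ D i) p }) (rows-good D b)
      ... | tri> _ _ p = restrict {λ i → ρ D i ≡ suc b} {λ i → ρ′ i ≡ b} (λ {i} → λ { refl → shrink-high (2 * a) (ρ D i) p }) (rows-good D (suc b))
      ... | tri≈ _ refl _ = restrict {Pair a} {λ i → ρ′ i ≡ 2 * a} pair (Y , len , cl)
        where
        pair : ∀ {i} → ρ′ i ≡ 2 * a → Pair a i
        pair {i} eq with shrink-fibre (2 * a) (ρ D i)
        ... | inj₁ p = ≤-reflexive (sym (trans p eq)) , ≤-trans (≤-reflexive (trans p eq)) (n≤1+n _)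
        ... | inj₂ p = ≤-trans (n≤1+n _) (≤-reflexive (sym (trans p (cong suc eq)))) , ≤-reflexive (trans p (cong suc eq))
      columns : RowsGood (flip M) (κ D) ρ′
      -- Merging row parts does not harm the columns: the renamed list is no longer than `Y′`, and
      -- every row outside it was outside `Y′` before.
      columns b with Y′ , len′ , cl′ ← columns-good D b =
        map (shrink (2 * a)) Y′ , ≤-trans (≤-reflexive (length-map (shrink (2 * a)) Y′)) len′ ,
        classes-mono {M = flip M} {A = λ j → κ D j ≡ b} {A′ = λ j → κ D j ≡ b} {D = λ i → ρ D i ∉ Y′} {D′ = λ i → ρ′ i ∉ map (shrink (2 * a)) Y′}
          id (λ ∉ ∈ → ∉ (∈-map⁺ (shrink (2 * a)) ∈)) cl′

    stuck⇒minor : (∀ a → a < ⌊ r /2⌋ → CutPoints Q t M (Pair a) (κ D) c 0) → LinearMinor F N M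
    stuck⇒minor cuts = rich-grid⇒minor Q q<Q 2≤Q (proj₂ (proj₂ fits)) k (proj₁ fits) (proj₁ (proj₂ fits)) M (ρ D) (κ D) (ρ-mono D) (κ-mono D) B rich
      (dense-grid k 1≤k r c B 2≤r c≤r dense) N
      where
      B : ℕ → ℕ → Bool
      B a b with a <? ⌊ r /2⌋
      ... | yes a< = proj₁ (cuts a a<) b
      ... | no _   = false
      dense : ∀ a → a < ⌊ r /2⌋ → t ≤ count c (B a)
      dense a a< with a <? ⌊ r /2⌋
      ... | yes p = proj₁ (proj₂ (proj₂ (cuts a p)))
      ... | no ¬p = contradiction a< ¬p
      rich : ∀ a x y → x < y → B a x ≡ true → B a y ≡ true → ManyRows Q M (Pair a) (λ j → x ≤ κ D j × κ D j < y)
      rich a x y x<y Bx By with a <? ⌊ r /2⌋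
      ... | yes p = proj₂ (proj₂ (proj₂ (cuts a p))) x y x<y Bx By

    row-step : LinearMinor F N M ⊎ Σ (Division M (pred r) c) λ D′ → Coarser (ρ D) (ρ D′) × Coarser (κ D) (κ D′)
    row-step with find-below ⌊ r /2⌋ scan-pair
    ... | inj₁ (a , a< , good) = inj₂ (merge-pair a a< good)
    ... | inj₂ cuts = inj₁ (stuck⇒minor cuts)

  module _ {m₁ n₁} (fits : Fits m₁ n₁) (fits′ : Fits n₁ m₁) (q<Q : q < Q) (N : Mat Carrier (suc m₁) (suc n₁)) (M : Mat Carrier m n) where
    open Relation M
    open Contraction (matStructure M) bound

    Outcome : ∀ {r c} → Division M r c → Set₁
    Outcome D = LinearMinor F N M ⊎ Tower (equivalence (ρ D) (κ D))

    Refinement : ∀ {r c} → Division M r c → ℕ → ℕ → Set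
    Refinement D r′ c′ = LinearMinor F N M ⊎ (Σ (Division M r′ c′) λ D′ → Coarser (ρ D) (ρ D′) × Coarser (κ D) (κ D′))

    transposed : ∀ {r c} (D : Division M r c) {r′ c′} →
      (LinearMinor F (flip N) (flip M) ⊎ Σ (Division (flip M) c′ r′) λ D′ → Coarser (κ D) (ρ D′) × Coarser (ρ D) (κ D′)) →
      Refinement D r′ c′
    transposed D (inj₁ minor) = inj₁ (LinearMinor-transpose minor)
    transposed D (inj₂ (D′ , C , R)) = inj₂ (transpose D′ , R , C)

    extend : ∀ {r c r′ c′} (D : Division M r c) (D′ : Division M r′ c′) → Coarser (ρ D) (ρ D′) → Coarser (κ D) (κ D′) →
      Outcome D′ → Outcome D
    extend D D′ R C (inj₁ minor) = inj₁ minor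
    extend D D′ R C (inj₂ rest)  = inj₂ (next (equivalence (ρ D′) (κ D′))
      (λ {u} {v} → equivalence-coarser {ρ D} {κ D} {ρ D′} {κ D′} R C {u} {v}) (sandwich D D′ R C) rest)

    tower : ∀ fuel {r c} (D : Division M r c) → r + c ≤ fuel → Shape r c → Outcome D
    advance : ∀ fuel {r c r′ c′} (D : Division M r c) → r′ + c′ < r + c → r + c ≤ suc fuel → Refinement D r′ c′ → Outcome D

    tower fuel D r+c≤ (small r≤1 c≤1) = inj₂ (next total (λ _ → tt) (top-sandwich D r≤1 c≤1) (last (λ _ _ → tt)))
    tower (suc fuel) {suc r} D r+c≤ (more-rows c≤r 2≤r) = advance fuel D ≤-refl r+c≤ (row-step fits q<Q N M D c≤r 2≤r)
    tower (suc fuel) {r} {suc c} D r+c≤ (more-columns r≤c 2≤c) = advance fuel D (+-monoʳ-< r ≤-refl) r+c≤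
      (transposed D (row-step fits′ q<Q (flip N) (flip M) (transpose D) r≤c 2≤c))
    tower zero {suc r} D () (more-rows _ _)
    tower zero {r} {suc c} D r+c≤ (more-columns _ _) = contradiction (≤-trans (m≤n+m (suc c) r) r+c≤) (λ ())

    advance fuel D dec r+c≤ (inj₁ minor) = inj₁ minor
    advance fuel {r′ = r′} {c′} D dec r+c≤ (inj₂ (D′ , R , C)) = extend D D′ R C (tower fuel D′ (s≤s⁻¹ (≤-trans dec r+c≤)) (shape r′ c′))

    finest-exact : ∀ {u v} → _≈_ (equivalence toℕ toℕ) u v → u ≡ v
    finest-exact {u} {v} u≈v with view m n v
    ... | row i with i′ , refl , e ← ≈-row toℕ toℕ {u} {i} u≈v = cong (_↑ˡ n) (toℕ-injective (same-part e))
    ... | column j with j′ , refl , e ← ≈-column toℕ toℕ {u} {j} u≈v = cong (m ↑ʳ_) (toℕ-injective (same-part e))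

    minor-free⇒twinWidth : ¬ LinearMinor F N M → TwinWidthAtMost (matStructure M) bound
    minor-free⇒twinWidth ¬minor = conclude (tower (m + n) (finest M) ≤-refl (shape m n))
      where
      conclude : Outcome (finest M) → TwinWidthAtMost (matStructure M) bound
      conclude (inj₁ minor) = contradiction minor ¬minor
      conclude (inj₂ tw) = tower⇒twinWidth (matStructure M) bound (equivalence toℕ toℕ) (λ {u} {v} → finest-exact {u} {v}) tw

  fitting-minor-free⇒bounded : ∀ {m₁ n₁} → Fits m₁ n₁ → Fits n₁ m₁ → q < Q → (N : Mat Carrier (suc m₁) (suc n₁)) (𝓜 : MatrixClass Carrier) →
    (∀ {m n} (M : Mat Carrier m n) → MatrixClass.member 𝓜 M → ¬ LinearMinor F N M) → BoundedTwinWidth 𝓜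
  fitting-minor-free⇒bounded fits fits′ q<Q N 𝓜 free = bound , λ M M∈ → minor-free⇒twinWidth fits fits′ q<Q N M (free M M∈)

module _ (F : FiniteField) where
  open LinearAlgebra F

  minor-free⇒bounded : ∀ {m₁ n₁} (N : Mat Carrier (suc m₁) (suc n₁)) (𝓜 : MatrixClass Carrier) →
    (∀ {m n} (M : Mat Carrier m n) → MatrixClass.member 𝓜 M → ¬ LinearMinor F N M) → BoundedTwinWidth 𝓜
  minor-free⇒bounded {m₁} {n₁} N = fitting-minor-free⇒bounded fits fits′ q<Q N
    where
    k Q A B : ℕ
    k = suc (m₁ ⊔ n₁)
    A = suc (suc n₁) * q ^ m₁
    B = suc (suc m₁) * q ^ n₁
    -- Large enough for `N` and for its transpose, since the merging may get stuck on either side;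
    -- above `q` for the sake of `column-pair`, and at least 2.
    Q = suc (suc (q + (A + B)))
    open Greedy F k Q (s≤s z≤n) (s≤s (s≤s z≤n))
    0<q : 0 < q
    0<q = ≤-trans (s≤s z≤n) (toℕ<n (index 0F))
    q<Q : q < Q
    q<Q = s≤s (≤-trans (m≤m+n q _) (n≤1+n _))
    below : ∀ C x y e → e < suc x → C ≤ A + B → C ≡ suc (suc y) * q ^ x → suc (suc y) * q ^ e < Q
    below C x y e e< C≤ refl = s≤s (≤-trans (*-monoʳ-≤ (suc (suc y)) (^-monoʳ-≤ q {{>-nonZero 0<q}} (s≤s⁻¹ e<))) (≤-trans C≤ (≤-trans (m≤n+m _ q) (n≤1+n _))))
    fits : Fits m₁ n₁
    fits = s≤s (m≤m⊔n m₁ n₁) , s≤s (m≤n⊔m m₁ n₁) , λ e e< → below A m₁ n₁ e e< (m≤m+n A B) refl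
    fits′ : Fits n₁ m₁
    fits′ = s≤s (m≤n⊔m m₁ n₁) , s≤s (m≤m⊔n m₁ n₁) , λ e e< → below B n₁ m₁ e e< (m≤n+m B A) refl

-- Matrices excluded by bounded twin-width

escape : ∀ (L : List ℕ) k off → length L < k → ∃ λ (y : Fin k) → off + toℕ y ∉ L
escape L k off short with any? (λ y → ¬? (off + toℕ y ∈? L))
... | yes p = p
... | no all∈ = contradiction (pigeonhole short (λ y → Any.index (mem y))) λ
    { (y , y′ , y<y′ , eq) → <⇒≢ y<y′ (+-cancelˡ-≡ off (toℕ y) (toℕ y′)
        (trans (lookup-index (mem y)) (trans (cong (lookup L) eq) (sym (lookup-index (mem y′)))))) }
  where
  mem : ∀ y → off + toℕ y ∈ L
  mem y = decidable-stable (off + toℕ y ∈? L) (λ ∉ → all∈ (y , ∉))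

-- At most one element lies outside the set of chosen preimages: two such elements together with
-- these would be `k + 2` distinct elements. So a fibre has at most one element besides its chosen
-- one.
surjection-fibre : ∀ {k} (f : Fin (suc k) → Fin k) → (∀ y → ∃ λ x → f x ≡ y) →
  ∀ y → Σ (List (Fin (suc k))) λ L → length L ≤ 2 × (∀ x → f x ≡ y → x ∈ L)
surjection-fibre {k} f surj y with any? (λ x → ¬? (any? (λ y → proj₁ (surj y) ≟ᶠ x)))
... | no none = proj₁ (surj y) ∷ [] , s≤s z≤n , λ x fx → here (sym (in-image x fx))
  where
  in-image : ∀ x → f x ≡ y → proj₁ (surj y) ≡ x
  in-image x fx with any? (λ y → proj₁ (surj y) ≟ᶠ x)
  ... | no ¬p = contradiction (x , ¬p) none
  ... | yes (y′ , eq) = trans (cong (proj₁ ∘ surj) (trans (sym fx) (trans (cong f (sym eq)) (proj₂ (surj y′))))) eq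
... | yes (z , ¬z) = proj₁ (surj y) ∷ z ∷ [] , s≤s (s≤s z≤n) , member
  where
  member : ∀ x → f x ≡ y → x ∈ proj₁ (surj y) ∷ z ∷ []
  member x fx with any? (λ y → proj₁ (surj y) ≟ᶠ x)
  ... | yes (y′ , eq) = here (sym (trans (cong (proj₁ ∘ surj) (trans (sym fx) (trans (cong f (sym eq)) (proj₂ (surj y′))))) eq))
  ... | no ¬x = there (here (decidable-stable (x ≟ᶠ z) λ x≢z → contradiction (injective⇒≤ (inj x≢z)) 1+n≰n))
    where
    g : Fin (suc (suc k)) → Fin (suc k)
    g Fin.zero = x
    g (Fin.suc Fin.zero) = z
    g (Fin.suc (Fin.suc w)) = proj₁ (surj w)
    inj : x ≢ z → ∀ {a b} → g a ≡ g b → a ≡ b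
    inj x≢z {Fin.zero} {Fin.zero} eq = refl
    inj x≢z {Fin.zero} {Fin.suc Fin.zero} eq = contradiction eq x≢z
    inj x≢z {Fin.zero} {Fin.suc (Fin.suc w)} eq = contradiction (w , sym eq) ¬x
    inj x≢z {Fin.suc Fin.zero} {Fin.zero} eq = contradiction (sym eq) x≢z
    inj x≢z {Fin.suc Fin.zero} {Fin.suc Fin.zero} eq = refl
    inj x≢z {Fin.suc Fin.zero} {Fin.suc (Fin.suc w)} eq = contradiction (w , sym eq) ¬z
    inj x≢z {Fin.suc (Fin.suc w)} {Fin.zero} eq = contradiction (w , eq) ¬x
    inj x≢z {Fin.suc (Fin.suc w)} {Fin.suc Fin.zero} eq = contradiction (w , eq) ¬z
    inj x≢z {Fin.suc (Fin.suc w)} {Fin.suc (Fin.suc w′)} eq =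
      cong (Fin.suc ∘ Fin.suc) (trans (sym (proj₂ (surj w))) (trans (cong f eq) (proj₂ (surj w′))))

block : ∀ {k} s → Fin (k * s) → Fin k
block {k} s x = proj₁ (remQuot {k} s x)

block-combine : ∀ {k s} (i : Fin k) (j : Fin s) → block s (combine i j) ≡ i
block-combine i j = cong proj₁ (remQuot-combine i j)

block-mono : ∀ {k} s {x y : Fin (k * s)} → x Fin.≤ y → block {k} s x Fin.≤ block s y
block-mono {k} s {x} {y} x≤y with toℕ (block {k} s y) <? toℕ (block {k} s x)
... | no ¬p = ≮⇒≥ ¬p
... | yes p = contradiction x≤y (<⇒≱ (subst₂ Fin._<_ (combine-remQuot {k} s y) (combine-remQuot {k} s x)
                (combine-monoˡ-< (proj₂ (remQuot {k} s y)) (proj₂ (remQuot {k} s x)) p)))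

module Forms (F : FiniteField) where
  open LinearAlgebra F

  only-sum : ∀ {k l} (i r : Fin k) (f : Fin l → Carrier) → only i r (sum f) ≡ sum (λ x → only i r (f x))
  only-sum {l = l} i r f with i ≟ᶠ r
  ... | yes _ = refl
  ... | no _  = sym (sum-zero {l} (λ _ → 0F) (λ _ → refl))

  only-only : ∀ {k l} (i r : Fin k) (j c : Fin l) x → only i r (only j c x) ≡ only j c (only i r x)
  only-only i r j c x with i ≟ᶠ r | j ≟ᶠ c
  ... | yes _ | yes _ = refl
  ... | yes _ | no _  = refl
  ... | no _  | yes _ = refl
  ... | no _  | no _  = refl

  -- Associativity (A M) B = A (M B) of the product behind `Form`; it makes that normal form
  -- symmetric under transposition.
  comb-comm : ∀ {m n m′ n′} (g : Fin m → Fin m′) (h : Fin n → Fin n′) α β (M : Mat Carrier m n) r c →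
    comb g α (λ x → comb h β (M x) c) r ≡ comb h β (λ y → comb g α (λ x → M x y) r) c
  comb-comm g h α β M r c = begin
    sum (λ x → only (g x) r (α x *F sum (λ y → only (h y) c (β y *F M x y))))
      ≡⟨ sum-cong-≗ (λ x → trans (cong (only (g x) r) (*-distribˡ-sum (α x) (λ y → only (h y) c (β y *F M x y)))) (only-sum (g x) r (λ y → α x *F only (h y) c (β y *F M x y)))) ⟩
    sum (λ x → sum (λ y → only (g x) r (α x *F only (h y) c (β y *F M x y))))
      ≡⟨ sum-comm (λ x y → only (g x) r (α x *F only (h y) c (β y *F M x y))) ⟩
    sum (λ y → sum (λ x → only (g x) r (α x *F only (h y) c (β y *F M x y))))
      ≡⟨ sum-cong-≗ (λ y → sum-cong-≗ (λ x → term x y)) ⟩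
    sum (λ y → sum (λ x → only (h y) c (β y *F only (g x) r (α x *F M x y))))
      ≡⟨ sum-cong-≗ (λ y → sym (trans (cong (only (h y) c) (*-distribˡ-sum (β y) (λ x → only (g x) r (α x *F M x y)))) (only-sum (h y) c (λ x → β y *F only (g x) r (α x *F M x y))))) ⟩
    sum (λ y → only (h y) c (β y *F sum (λ x → only (g x) r (α x *F M x y)))) ∎
    where
    open ≡-Reasoning
    term : ∀ x y → only (g x) r (α x *F only (h y) c (β y *F M x y)) ≡ only (h y) c (β y *F only (g x) r (α x *F M x y))
    term x y = begin
      only (g x) r (α x *F only (h y) c (β y *F M x y)) ≡⟨ cong (only (g x) r) (sym (only-* (h y) c (α x) (β y *F M x y))) ⟩
      only (g x) r (only (h y) c (α x *F (β y *F M x y))) ≡⟨ only-only (g x) r (h y) c (α x *F (β y *F M x y)) ⟩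
      only (h y) c (only (g x) r (α x *F (β y *F M x y))) ≡⟨ cong (λ z → only (h y) c (only (g x) r z)) (*F-swap (α x) (β y) (M x y)) ⟩
      only (h y) c (only (g x) r (β y *F (α x *F M x y))) ≡⟨ cong (only (h y) c) (only-* (g x) r (β y) (α x *F M x y)) ⟩
      only (h y) c (β y *F only (g x) r (α x *F M x y)) ∎

  Form-transpose : ∀ {m n m′ n′} {N : Mat Carrier m′ n′} {M : Mat Carrier m n} → Form N M → Form (flip N) (flip M)
  Form-transpose {M = M} form = record
    { g = h ; h = g ; α = β ; β = α ; g-mono = h-mono ; h-mono = g-mono
    ; formula = λ c r → trans (formula r c) (comb-comm g h α β M r c) }
    where open Form form

  module Blocks (d k₀ : ℕ) where
    -- One more than the number of vectors of `d + 1` weights over the field, so that two rows of an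
    -- identity block receive equal weights.
    s : ℕ
    s = suc (q ^ suc d)

    -- k₀ × k₀ blocks, each of them the identity matrix of size s.
    blocks : Mat Carrier (k₀ * s) (k₀ * s)
    blocks r c = only (proj₂ (remQuot {k₀} s r)) (proj₂ (remQuot {k₀} s c)) 1F

    blocks-combine : ∀ (b : Fin k₀) (i : Fin s) (y : Fin k₀) (l : Fin s) → blocks (combine b i) (combine y l) ≡ only i l 1F
    blocks-combine b i y l = cong₂ (λ u v → only u v 1F) (cong proj₂ (remQuot-combine b i)) (cong proj₂ (remQuot-combine y l))

    blocks-sym : ∀ r c → blocks c r ≡ blocks r c
    blocks-sym r c with proj₂ (remQuot {k₀} s c) ≟ᶠ proj₂ (remQuot {k₀} s r) | proj₂ (remQuot {k₀} s r) ≟ᶠ proj₂ (remQuot {k₀} s c)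
    ... | yes _ | yes _ = refl
    ... | no _  | no _  = refl
    ... | yes p | no ¬p = contradiction (sym p) ¬p
    ... | no ¬p | yes p = contradiction (sym p) ¬p

    Form-sym : ∀ {M : Mat Carrier m n} → Form blocks M → Form blocks (flip M)
    Form-sym form = record
      { g = g ; h = h ; α = α ; β = β ; g-mono = g-mono ; h-mono = h-mono
      ; formula = λ r c → trans (blocks-sym c r) (formula r c) }
      where open Form (Form-transpose form)

    module _ {M : Mat Carrier m n} (form : Form blocks M) where
      open Form form

      -- Entries of a block to which no row contributes are empty sums, but each block contains a 1.
      block-inhabited : ∀ b → ∃ λ x → block s (g x) ≡ b
      block-inhabited b with any? (λ x → block {k₀} s (g x) ≟ᶠ b)
      ... | yes p = p
      ... | no none = contradiction (begin
        0F ≡⟨ sym (sum-zero (λ x → only (g x) r (α x *F comb h β (M x) r)) (λ x → only-≢ {i = g x} {r} _ (λ eq → none (x , trans (cong (block s) eq) (block-combine b Fin.zero))))) ⟩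
        comb g α (λ x → comb h β (M x) r) r ≡⟨ sym (formula r r) ⟩
        blocks r r ≡⟨ blocks-combine b Fin.zero b Fin.zero ⟩
        1F ∎) 0≢1
        where
        open ≡-Reasoning
        r : Fin (k₀ * s)
        r = combine b Fin.zero

      -- The rows of an identity block would be combinations of at most d + 1 vectors, hence not all distinct.
      no-few-classes : ∀ {l} (κ : Fin m → Fin l) (b y : Fin k₀) (A : List (Fin l)) → length A ≤ suc d →
        (∀ x → block s (g x) ≡ b → κ x ∈ A) →
        (∀ x x′ c → block s (g x) ≡ b → block s (g x′) ≡ b → block s (h c) ≡ y → κ x ≡ κ x′ → M x c ≡ M x′ c) → ⊥
      no-few-classes {l} κ b y A short κ∈A same =
        collide (pigeonhole (s≤s (^-monoʳ-≤ q {{>-nonZero (≤-trans (s≤s z≤n) (toℕ<n (index 0F)))}} short)) key)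
        where
        open ≡-Reasoning
        weight : Fin s → Fin l → Carrier
        weight i X = sum (λ x → only (g x) (combine b i) (only (κ x) X (α x)))
        in-block : ∀ {x i} → g x ≡ combine b i → block s (g x) ≡ b
        in-block {i = i} eq = trans (cong (block s) eq) (block-combine b i)
        weight-zero : ∀ i X → X ∉ A → weight i X ≡ 0F
        weight-zero i X ∉A = sum-zero (λ x → only (g x) (combine b i) (only (κ x) X (α x))) zero-term
          where
          zero-term : ∀ x → only (g x) (combine b i) (only (κ x) X (α x)) ≡ 0F
          zero-term x with g x ≟ᶠ combine b i
          ... | no _   = refl
          ... | yes gx = only-≢ {i = κ x} {X} (α x) λ { refl → ∉A (κ∈A x (in-block {x} gx)) }
        equal-weights : ∀ {i i′} → funToFin (λ z → index (weight i (lookup A z))) ≡ funToFin (λ z → index (weight i′ (lookup A z))) →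
          ∀ X → weight i X ≡ weight i′ X
        equal-weights {i} {i′} eq X with Any.any? (X ≟ᶠ_) A
        ... | no ∉A = trans (weight-zero i X ∉A) (sym (weight-zero i′ X ∉A))
        ... | yes ∈A = subst (λ X → weight i X ≡ weight i′ X) (sym (lookup-index ∈A))
                (index-injective (funToFin-injective (λ z → index (weight i (lookup A z))) (λ z → index (weight i′ (lookup A z))) eq (Any.index ∈A)))
        Z : Fin (k₀ * s) → Fin m → Carrier
        Z c x = comb h β (M x) c
        Z-same : ∀ c x x′ → block s c ≡ y → block s (g x) ≡ b → block s (g x′) ≡ b → κ x ≡ κ x′ → Z c x ≡ Z c x′
        Z-same c x x′ cy gx gx′ κx = sum-cong-≗ term
          where
          term : ∀ w → only (h w) c (β w *F M x w) ≡ only (h w) c (β w *F M x′ w)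
          term w with h w ≟ᶠ c
          ... | no _     = refl
          ... | yes refl = cong (β w *F_) (same x x′ w gx gx′ cy κx)
        value : Fin (k₀ * s) → Fin l → Carrier
        value c X with any? (λ x → (block {k₀} s (g x) ≟ᶠ b) ×-dec (κ x ≟ᶠ X))
        ... | yes (x , _) = Z c x
        -- The default is harmless: a class without rows in block `b` has weight 0 in each row of
        -- that block.
        ... | no _        = 0F
        value-κ : ∀ c x → block s c ≡ y → block s (g x) ≡ b → value c (κ x) ≡ Z c x
        value-κ c x cy gx with any? (λ x′ → (block {k₀} s (g x′) ≟ᶠ b) ×-dec (κ x′ ≟ᶠ κ x))
        ... | yes (x′ , gx′ , eq) = Z-same c x′ x cy gx′ gx eq
        ... | no none = contradiction (x , gx , refl) none
        by-weights : ∀ i c → block s c ≡ y → blocks (combine b i) c ≡ sum (λ X → weight i X *F value c X)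
        by-weights i c cy = begin
          blocks r c ≡⟨ formula r c ⟩
          sum (λ x → only (g x) r (α x *F Z c x)) ≡⟨ sum-cong-≗ expand ⟩
          sum (λ x → sum (λ X → only (g x) r (only (κ x) X (α x)) *F value c X)) ≡⟨ sum-comm (λ x X → only (g x) r (only (κ x) X (α x)) *F value c X) ⟩
          sum (λ X → sum (λ x → only (g x) r (only (κ x) X (α x)) *F value c X))
            ≡⟨ sum-cong-≗ (λ X → sym (*-distribʳ-sum (value c X) (λ x → only (g x) r (only (κ x) X (α x))))) ⟩
          sum (λ X → weight i X *F value c X) ∎
          where
          r : Fin (k₀ * s)
          r = combine b i
          expand : ∀ x → only (g x) r (α x *F Z c x) ≡ sum (λ X → only (g x) r (only (κ x) X (α x)) *F value c X)
          expand x with g x ≟ᶠ r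
          ... | no _ = sym (sum-zero (λ X → 0F *F value c X) (λ X → *F-zeroˡ (value c X)))
          ... | yes gx = sym (begin
            sum (λ X → only (κ x) X (α x) *F value c X)
              ≡⟨ sum-single (λ X → only (κ x) X (α x) *F value c X) (κ x) (λ X ne → trans (cong (_*F value c X) (only-≢ {i = κ x} {X} (α x) (ne ∘ sym))) (*F-zeroˡ (value c X))) ⟩
            only (κ x) (κ x) (α x) *F value c (κ x) ≡⟨ cong₂ _*F_ (only-≡ {i = κ x} (α x) refl) (value-κ c x cy (in-block {x} gx)) ⟩
            α x *F Z c x ∎)
        key : Fin s → Fin (q ^ length A)
        key i = funToFin (λ z → index (weight i (lookup A z)))
        collide : ¬ ∃₂ λ i i′ → i Fin.< i′ × key i ≡ key i′
        -- Rows `i` and `i′` with equal weights would agree in column `i` of the block, where the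
        -- identity matrix has 1 and 0.
        collide (i , i′ , i<i′ , eq) = 0≢1 (begin
          0F ≡⟨ sym (only-≢ 1F (λ p → <⇒≢ i<i′ (cong toℕ (sym p)))) ⟩
          only i′ i 1F ≡⟨ sym (blocks-combine b i′ y i) ⟩
          blocks (combine b i′) (combine y i) ≡⟨ by-weights i′ (combine y i) (block-combine y i) ⟩
          sum (λ X → weight i′ X *F value (combine y i) X) ≡⟨ sum-cong-≗ (λ X → cong (_*F value (combine y i) X) (sym (equal-weights eq X))) ⟩
          sum (λ X → weight i X *F value (combine y i) X) ≡⟨ sym (by-weights i (combine y i) (block-combine y i)) ⟩
          blocks (combine b i) (combine y i) ≡⟨ blocks-combine b i y i ⟩
          only i i 1F ≡⟨ only-≡ {i = i} 1F refl ⟩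
          1F ∎)

-- The first part that spans three blocks

within-one : ∀ a b → ¬ (2 + a ≤ b) → ¬ (2 + b ≤ a) → b ∈ pred a ∷ a ∷ suc a ∷ []
within-one a b far₁ far₂ with <-cmp b a
... | tri< p _ _ = here (cong pred (≤-antisym p (s≤s⁻¹ (≰⇒> far₂))))
... | tri≈ _ p _ = there (here p)
... | tri> _ _ p = there (there (here (≤-antisym (s≤s⁻¹ (≰⇒> far₁)) p)))

module Crossing (S : Structure) (d : ℕ) (bl : Fin (Structure.size S) → ℕ)
                (separates : ∀ u w v → bl u < bl w → bl w < bl v → ¬ SameType S u w v w) where
  open Structure S using (size)

  Wide : ∀ {k} → (Fin size → Fin k) → Set
  Wide p = ∃ λ u → ∃ λ v → p u ≡ p v × 2 + bl u ≤ bl v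

  Wide? : ∀ {k} (p : Fin size → Fin k) → Dec (Wide p)
  Wide? p = any? (λ u → any? (λ v → (p u ≟ᶠ p v) ×-dec (2 + bl u ≤? bl v)))

  -- Up to `d + 1` parts meet the middle block, and each has at most `d` red neighbours besides
  -- itself. Each of these parts comes from at most two parts before the merge, and such an earlier
  -- part stays within distance one of the block of its representative, which leaves three
  -- candidates.
  touched-bound : ℕ
  touched-bound = suc d * suc d * 2 * 3

  record Cut : Set where
    field
      {l} : ℕ
      p : Fin size → Fin l
      b : ℕ
      last : Fin size
      b<last : b < bl last
      A : List (Fin l)
      A-short : length A ≤ suc d
      A-meets : ∀ w → bl w ≡ b → p w ∈ A
      touched : List ℕ
      touched-short : length touched ≤ touched-bound
      homogeneous : ∀ x w → p x ∈ A → bl w ∉ touched → p x ≢ p w × ¬ RedAdj S p (p x) (p w)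

  -- At the first moment a part P spans three blocks u < b < v, every part meeting block b is P or
  -- red-adjacent to P, while all parts are still confined to at most four blocks.
  cut-at : ∀ {k} (p⁺ : Fin size → Fin (suc (suc k))) (p : Fin size → Fin (suc k)) (f : Fin (suc (suc k)) → Fin (suc k)) →
    Surj S p⁺ → Surj S f → (∀ u → p u ≡ f (p⁺ u)) → RedDegreeAtMost S d p → ¬ Wide p⁺ → Wide p → Cut
  cut-at {k} p⁺ p f p⁺-surj f-surj p≡ degree narrow (u , v , pu≡pv , far) = record
    { p = p ; b = suc (bl u) ; last = v ; b<last = far ; A = A
    ; A-short = s≤s (proj₁ (proj₂ (degree (p u))))
    ; A-meets = meets ; touched = touched
    ; touched-short = ≤-trans (length-concatMap near 3 (λ _ → ≤-refl) W⁺) (*-monoˡ-≤ 3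
        (≤-trans (length-concatMap fibre 2 (λ X → proj₁ (proj₂ (surjection-fibre f f-surj X))) W) (*-monoˡ-≤ 2
        (≤-trans (length-concatMap closed (suc d) (λ X → s≤s (proj₁ (proj₂ (degree X)))) A) (*-monoˡ-≤ (suc d) (s≤s (proj₁ (proj₂ (degree (p u))))))))))
    ; homogeneous = λ x w x∈A w∉ →
        (λ eq → w∉ (in-touched w (∈-collect closed A x∈A (here (sym eq))))) ,
        (λ red → w∉ (in-touched w (∈-collect closed A x∈A (there (proj₂ (proj₂ (degree (p x))) (p w) red))))) }
    where
    closed : Fin (suc k) → List (Fin (suc k))
    closed X = X ∷ proj₁ (degree X)
    A : List (Fin (suc k))
    A = closed (p u)
    meets : ∀ w → bl w ≡ suc (bl u) → p w ∈ A
    meets w eq with p w ≟ᶠ p u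
    ... | yes same = here same
    ... | no differ = there (proj₂ (proj₂ (degree (p u))) (p w) (differ ∘ sym , u , v , w , w , refl , sym pu≡pv , refl , refl ,
            separates u w v (≤-reflexive (sym eq)) (subst (_< bl v) (sym eq) far)))
    W : List (Fin (suc k))
    W = concatMap closed A
    fibre : Fin (suc k) → List (Fin (suc (suc k)))
    fibre X = proj₁ (surjection-fibre f f-surj X)
    W⁺ : List (Fin (suc (suc k)))
    W⁺ = concatMap fibre W
    rep : Fin (suc (suc k)) → Fin size
    rep X = proj₁ (p⁺-surj X)
    near : Fin (suc (suc k)) → List ℕ
    near X = pred (bl (rep X)) ∷ bl (rep X) ∷ suc (bl (rep X)) ∷ []
    touched : List ℕ
    touched = concatMap near W⁺
    in-touched : ∀ w → p w ∈ W → bl w ∈ touched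
    in-touched w w∈ = ∈-collect near W⁺
      (∈-collect fibre W w∈ (proj₂ (proj₂ (surjection-fibre f f-surj (p w))) (p⁺ w) (sym (p≡ w))))
      (within-one (bl e) (bl w) (λ far → narrow (e , w , e≡w , far)) (λ far → narrow (w , e , sym e≡w , far)))
      where
      e = rep (p⁺ w)
      e≡w : p⁺ e ≡ p⁺ w
      e≡w = proj₂ (p⁺-surj (p⁺ w))

  cut : (c : ContractionSeq S) → IsDSequence S d c → ∀ u v → 2 + bl u ≤ bl v → Cut
  -- Contraction proceeds towards smaller indices, and wide parts stay wide. So the least index
  -- without a wide part is the last partition before one appears; it is not 0, because a single
  -- part contains both `u₀` and `v₀`.
  cut c degree u₀ v₀ far = go (first (λ k → ¬? (Wide? (part k))) (pred size))
    where
    open ContractionSeq c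
    size≡ : suc (pred size) ≡ size
    size≡ = suc-pred size {{>-nonZero (≤-<-trans z≤n (toℕ<n u₀))}}
    go : (∀ k → k ≤ pred size → ¬ ¬ Wide (part k)) ⊎ (∃ λ k → k ≤ pred size × ¬ Wide (part k) × ∀ j → j < k → ¬ ¬ Wide (part j)) → Cut
    go (inj₁ always) = contradiction (λ (u , v , eq , far) → contradiction (subst (λ z → 2 + bl u ≤ bl z) (sym (finest (pred size) size≡ u v eq)) far) (λ p → 1+n≰n (≤-trans (n≤1+n _) p)))
                         (always (pred size) ≤-refl)
    go (inj₂ (zero , _ , narrow , _)) with part 0 u₀ in eq | part 0 v₀ in eq′
    ... | Fin.zero | Fin.zero = contradiction (u₀ , v₀ , trans eq (sym eq′) , far) narrow
    go (inj₂ (suc k , k≤ , narrow , before)) with f , f-surj , p≡ ← merge k (subst (suc (suc k) ≤_) size≡ (s≤s k≤)) =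
      cut-at (part (suc k)) (part k) f (nonempty (suc k) (subst (suc (suc k) ≤_) size≡ (s≤s k≤))) f-surj p≡
        (degree k (subst (suc k ≤_) size≡ (s≤s (<⇒≤ k≤)))) narrow (decidable-stable (Wide? (part k)) (before k ≤-refl))

module _ (F : FiniteField) (d k₀ : ℕ) (3≤k₀ : 3 ≤ k₀) (large : suc d * suc d * 2 * 3 < k₀) where
  open LinearAlgebra F
  open Forms F
  open Blocks d k₀

  bounded⇒minor-free : (M : Mat Carrier m n) → TwinWidthAtMost (matStructure M) d → ¬ LinearMinor F blocks M
  bounded⇒minor-free {m} {n} M (c , degree) minor = impossible (cut c degree (x₀ ↑ˡ n) (x₂ ↑ˡ n) (≤-reflexive (trans (cong (2 +_) (trans (bl-at x₀ gx₀) (toℕ-fromℕ< _))) (sym (trans (bl-at x₂ gx₂) (toℕ-fromℕ< 3≤k₀))))))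
    where
    form : Form blocks M
    form = LinearMinor⇒Form minor
    open Form form
    open SameTypes M
    blockOf : Fin m ⊎ Fin n → ℕ
    blockOf = [ (λ x → toℕ (block {k₀} s (g x))) , (λ y → k₀ + toℕ (block {k₀} s (h y))) ]′
    bl : Fin (m + n) → ℕ
    bl u = blockOf (splitAt m u)
    bl-row : ∀ x → bl (x ↑ˡ n) ≡ toℕ (block {k₀} s (g x))
    bl-row x = cong blockOf (splitAt-↑ˡ m x n)
    bl-column : ∀ y → bl (m ↑ʳ y) ≡ k₀ + toℕ (block {k₀} s (h y))
    bl-column y = cong blockOf (splitAt-↑ʳ m n y)
    bl-mono : ∀ {u v} → u Fin.≤ v → bl u ≤ bl v
    bl-mono {u} {v} u≤v with view m n u | view m n v
    ... | row x | row x′ = subst₂ _≤_ (sym (bl-row x)) (sym (bl-row x′)) (block-mono s (g-mono (subst₂ _≤_ (toℕ-↑ˡ x n) (toℕ-↑ˡ x′ n) u≤v)))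
    ... | row x | column y = subst₂ _≤_ (sym (bl-row x)) (sym (bl-column y)) (≤-trans (<⇒≤ (toℕ<n (block {k₀} s (g x)))) (m≤m+n k₀ _))
    ... | column y | row x = contradiction u≤v (<⇒≱ (row<column x y))
    ... | column y | column y′ = subst₂ _≤_ (sym (bl-column y)) (sym (bl-column y′)) (+-monoʳ-≤ k₀
            (block-mono s (h-mono (+-cancelˡ-≤ m _ _ (subst₂ _≤_ (toℕ-↑ʳ m y) (toℕ-↑ʳ m y′) u≤v)))))
    separates : ∀ u w v → bl u < bl w → bl w < bl v → ¬ SameType (matStructure M) u w v w
    separates u w v u<w w<v (_ , _ , same , _) =
      <⇒≯ (mono-reflects-< bl bl-mono w v w<v) (Equivalence.to (same lt) (mono-reflects-< bl bl-mono u w u<w))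
    open Crossing (matStructure M) d bl separates
    b₀ b₂ : Fin k₀
    b₀ = fromℕ< (≤-trans (s≤s z≤n) 3≤k₀)
    b₂ = fromℕ< 3≤k₀
    x₀ x₂ : Fin m
    x₀ = proj₁ (block-inhabited form b₀)
    x₂ = proj₁ (block-inhabited form b₂)
    gx₀ : block {k₀} s (g x₀) ≡ b₀
    gx₀ = proj₂ (block-inhabited form b₀)
    gx₂ : block {k₀} s (g x₂) ≡ b₂
    gx₂ = proj₂ (block-inhabited form b₂)
    bl-at : ∀ x {b} → block {k₀} s (g x) ≡ b → bl (x ↑ˡ n) ≡ toℕ b
    bl-at x eq = trans (bl-row x) (cong toℕ eq)
    impossible : ¬ Cut
    impossible record { p = p ; b = b ; last = last ; b<last = b<last ; A = A ; A-short = A-short ; A-meets = A-meets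
                      ; touched = touched ; touched-short = touched-short ; homogeneous = homogeneous }
      with b <? k₀
    -- Blocks below `k₀` consist of rows and the others of columns. The middle block is one of rows
    -- here, and a column block missing from `touched` is homogeneous to every part that meets it.
    ... | yes b<k₀ with y , y∉ ← escape touched k₀ k₀ (≤-<-trans touched-short large) =
      no-few-classes form (λ x → p (x ↑ˡ n)) (fromℕ< b<k₀) y A A-short meets same
      where
      meets : ∀ x → block s (g x) ≡ fromℕ< b<k₀ → p (x ↑ˡ n) ∈ A
      meets x eq = A-meets (x ↑ˡ n) (trans (bl-at x eq) (toℕ-fromℕ< b<k₀))
      same : ∀ x x′ c → block s (g x) ≡ fromℕ< b<k₀ → block s (g x′) ≡ fromℕ< b<k₀ → block s (h c) ≡ y →
        p (x ↑ˡ n) ≡ p (x′ ↑ˡ n) → M x c ≡ M x′ c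
      same x x′ c gx _ refl px = decidable-stable (M x c ≟F M x′ c) λ ne →
        let differ , ¬red = homogeneous (x ↑ˡ n) (m ↑ʳ c) (meets x gx) (subst (_∉ touched) (sym (bl-column c)) y∉)
        in ¬red (differ , x ↑ˡ n , x′ ↑ˡ n , m ↑ʳ c , m ↑ʳ c , refl , sym px , refl , refl , λ st → ne (rowColumn⁻¹ st))
    -- The middle block consists of columns. As `blocks` is symmetric, `flip M` has a form for the
    -- same matrix, and the argument is repeated with an untouched row block.
    ... | no b≮k₀ with y , y∉ ← escape touched k₀ 0 (≤-<-trans touched-short large) =
      no-few-classes (Form-sym form) (λ x → p (m ↑ʳ x)) (fromℕ< b′<k₀) y A A-short meets same
      where
      bl<2k₀ : ∀ u → bl u < k₀ + k₀
      bl<2k₀ u with view m n u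
      ... | row x = subst (_< k₀ + k₀) (sym (bl-row x)) (<-≤-trans (toℕ<n (block {k₀} s (g x))) (m≤m+n k₀ k₀))
      ... | column x = subst (_< k₀ + k₀) (sym (bl-column x)) (+-monoʳ-< k₀ (toℕ<n (block {k₀} s (h x))))
      k₀+ : k₀ + (b ∸ k₀) ≡ b
      k₀+ = m+[n∸m]≡n (≮⇒≥ b≮k₀)
      b′<k₀ : b ∸ k₀ < k₀
      b′<k₀ = +-cancelˡ-< k₀ _ _ (subst (_< k₀ + k₀) (sym k₀+) (<-trans b<last (bl<2k₀ last)))
      meets : ∀ x → block s (h x) ≡ fromℕ< b′<k₀ → p (m ↑ʳ x) ∈ A
      meets x eq = A-meets (m ↑ʳ x) (trans (bl-column x) (trans (cong (k₀ +_) (trans (cong toℕ eq) (toℕ-fromℕ< b′<k₀))) k₀+))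
      same : ∀ x x′ c → block s (h x) ≡ fromℕ< b′<k₀ → block s (h x′) ≡ fromℕ< b′<k₀ → block s (g c) ≡ y →
        p (m ↑ʳ x) ≡ p (m ↑ʳ x′) → M c x ≡ M c x′
      same x x′ c hx _ refl px = decidable-stable (M c x ≟F M c x′) λ ne →
        let differ , ¬red = homogeneous (m ↑ʳ x) (c ↑ˡ n) (meets x hx) (subst (_∉ touched) (sym (bl-row c)) y∉)
        in ¬red (differ , m ↑ʳ x , m ↑ʳ x′ , c ↑ˡ n , c ↑ˡ n , refl , sym px , refl , refl ,
                 λ { (a , b , c , d) → ne (rowColumn⁻¹ (b , a , d , c)) })

  bounded⇒excluded : (𝓜 : MatrixClass Carrier) → (∀ {m n} (M : Mat Carrier m n) → MatrixClass.member 𝓜 M → TwinWidthAtMost (matStructure M) d) →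
    Σ ℕ λ m → Σ ℕ λ n → Σ (Mat Carrier m n) λ N → ∀ {m′ n′} (M : Mat Carrier m′ n′) → MatrixClass.member 𝓜 M → ¬ LinearMinor F N M
  bounded⇒excluded 𝓜 bounded = k₀ * s , k₀ * s , blocks , λ M M∈ → bounded⇒minor-free M (bounded M M∈)

LinearMinor-size : ∀ F {m n m′ n′} {N : Mat (FiniteField.Carrier F) m′ n′} {M : Mat (FiniteField.Carrier F) m n} →
  LinearMinor F N M → m′ ≤ m × n′ ≤ n
LinearMinor-size F (done _)        = ≤-refl , ≤-refl
LinearMinor-size F (rowOp _ _ _ l) = map₁ m≤n⇒m≤1+n (LinearMinor-size F l)
LinearMinor-size F (colOp _ _ _ l) = map₂ m≤n⇒m≤1+n (LinearMinor-size F l)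

inject≤-strict : ∀ {k l} (k≤l : k ≤ l) → StrictMono (λ (i : Fin k) → Fin.inject≤ i k≤l)
inject≤-strict k≤l i j = subst₂ _<_ (sym (toℕ-inject≤ i k≤l)) (sym (toℕ-inject≤ j k≤l))

theorem1 : (F : FiniteField) (𝓜 : MatrixClass (FiniteField.Carrier F)) →
    BoundedTwinWidth 𝓜 ⇔
      (Σ ℕ λ m → Σ ℕ λ n → Σ (Mat (FiniteField.Carrier F) m n) λ N →
        ∀ {m' n'} (M : Mat (FiniteField.Carrier F) m' n') →
          MatrixClass.member 𝓜 M → ¬ LinearMinor F N M)
theorem1 F 𝓜 = mk⇔ bounded⇒ ⇒bounded
  where
  open FiniteField F using (Carrier; 0F)
  open MatrixClass 𝓜

  Excluded : Set
  Excluded = Σ ℕ λ m → Σ ℕ λ n → Σ (Mat Carrier m n) λ N → ∀ {m' n'} (M : Mat Carrier m' n') → member M → ¬ LinearMinor F N M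

  bounded⇒ : BoundedTwinWidth 𝓜 → Excluded
  -- The 3 makes the part containing everything span three row blocks; the rest of the sum leaves an
  -- untouched block on either side.
  bounded⇒ (d , bounded) = bounded⇒excluded F d (3 + suc d * suc d * 2 * 3) (s≤s (s≤s (s≤s z≤n))) (m<n+m (suc d * suc d * 2 * 3) {3} (s≤s z≤n)) 𝓜 bounded

  -- An empty N is a submatrix of every matrix that is long enough, hence the members have bounded length
  -- and any longer matrix is excluded as well.
  ⇒bounded : Excluded → BoundedTwinWidth 𝓜
  ⇒bounded (suc m , suc n , N , free) = minor-free⇒bounded F N 𝓜 free
  ⇒bounded (zero , n , N , free) = minor-free⇒bounded F {0} {n} (λ _ _ → 0F) 𝓜 λ M M∈ minor →
    let n≤ = ≤-trans (n≤1+n n) (proj₂ (LinearMinor-size F minor))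
    in free _ (closed M (λ ()) (λ j → Fin.inject≤ j n≤) (λ ()) (inject≤-strict n≤) M∈) (done (λ ()))
  ⇒bounded (suc m , zero , N , free) = minor-free⇒bounded F {m} {0} (λ _ _ → 0F) 𝓜 λ M M∈ minor →
    let m≤ = proj₁ (LinearMinor-size F minor)
    in free _ (closed M (λ i → Fin.inject≤ i m≤) (λ ()) (inject≤-strict m≤) (λ ()) M∈) (done (λ _ ()))
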